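{- Let $p$ be an odd prime and $\alpha$ an indeterminate over $\mathbb F_p$. For $\gamma\in\{\alpha,-\alpha\}$ let \[ G^{(\gamma)}(X)=-\sum_{k=1}^{p-1}\frac{1}{k}\,\frac{X^{k}}{\prod_{s=1}^{k-1}b_{1,s}(\gamma)}\in\mathbb F_p(\alpha)[X] \] (empty product equal to $1$). Then \[ \prod_{k=1}^{p-1}(1+\alpha/k)^{k}\cdot G^{(\alpha)}(X)=-X^{p}\cdot G^{(-\alpha)}\!\left(\frac{1-\alpha^{p-1}}{X}\right) \] in the polynomial ring $\mathbb F_p(\alpha)[X]$.
   Context: $\mathbb F_p$ is the field of $p$ elements, $\binom{x}{m}=x(x-1)\cdots(x-m+1)/m!$. For integers $0<r,s<p$ (interpreted as elements of $\mathbb F_p$), $b_{r,s}(\alpha)=\sum_{k=0}^{p-1}(-r/s)^k\binom{r\alpha-1}{p-1-k}\binom{s\alpha-1}{k}\in\mathbb F_p[\alpha]$; $b_{1,s}(-\alpha)$ denotes the substitution of $-\alpha$ for $\alpha$. -}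

module Defs where

open import Algebra.Bundles using (CommutativeRing; CommutativeMonoid)
import Algebra.Properties.CommutativeSemigroup as CommutativeSemigroupProperties
import Algebra.Properties.Monoid.Sum as MonoidSum
import Algebra.Properties.Ring as RingProperties
import Algebra.Properties.Semiring.Exp as SemiringExp
import Algebra.Properties.Semiring.Mult as SemiringMult
import Algebra.Solver.Ring.NaturalCoefficients.Default as NaturalSolver
open import Data.Empty using (⊥-elim)
open import Data.Fin.Base using (toℕ)
import Data.Integer.Base as ℤ
open import Data.Integer.Base using (ℤ; +_; -[1+_]; ∣_∣)
open import Data.Integer.Divisibility.Signed as ℤ∣ using (divides)
import Data.Integer.Properties as ℤₚ
open import Data.Integer.Solver using (module +-*-Solver)
open import Data.List.Base using (List; []; _∷_; map)
import Data.Nat.Base as ℕ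
open import Data.Nat.Base using (ℕ; zero; suc; _∸_; _!)
import Data.Nat.Coprimality as Coprimality
open import Data.Nat.Coprimality using (Coprime)
import Data.Nat.Divisibility as ℕ∣
open import Data.Nat.GCD using (module Bézout)
open import Data.Nat.Primality using (Prime; prime⇒irreducible; euclidsLemma; ¬prime[1])
open import Data.Product.Base using (∃; _,_; proj₁; proj₂)
open import Data.Sum.Base using (_⊎_; inj₁; inj₂; [_,_]′; map₁; map₂)
open import Level using (Level; _⊔_; 0ℓ) renaming (suc to lsuc)
open import Relation.Binary.Bundles using (Setoid)
open import Relation.Binary.Definitions using (Decidable)
import Relation.Binary.PropositionalEquality as ≡
open import Relation.Binary.PropositionalEquality using (_≡_)
import Relation.Binary.Reasoning.Setoid as SetoidReasoning
open import Relation.Binary.Structures using (IsEquivalence)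
open import Relation.Nullary using (¬_; yes; no; contradiction)
open import Relation.Nullary.Decidable using (map′; _×-dec_)

private
  variable
    c ℓ d m : Level

module RingNotation (R : CommutativeRing c ℓ) where
  open CommutativeRing R
  open SemiringExp semiring public using (_^_)

  infix 5 ∑[_⋯<_]_ ∏[_⋯<_]_

  -- Both ranges are half-open: the index k satisfies a ≤ k < b.
  ∑[_⋯<_]_ : ℕ → ℕ → (ℕ → Carrier) → Carrier
  ∑[ a ⋯< b ] f = MonoidSum.sum +-monoid {b ∸ a} (λ i → f (a ℕ.+ toℕ i))

  ∏[_⋯<_]_ : ℕ → ℕ → (ℕ → Carrier) → Carrier
  ∏[ a ⋯< b ] f = MonoidSum.sum *-monoid {b ∸ a} (λ i → f (a ℕ.+ toℕ i))

  fromℕ : ℕ → Carrier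
  fromℕ n = SemiringMult._×_ semiring n 1#

record IntegralDomain c ℓ : Set (lsuc (c ⊔ ℓ)) where
  field
    commutativeRing : CommutativeRing c ℓ
  open CommutativeRing commutativeRing public
  field
    _≟_            : Decidable _≈_
    1≉0            : ¬ 1# ≈ 0#
    noZeroDivisors : ∀ {x y} → x * y ≈ 0# → x ≈ 0# ⊎ y ≈ 0#

  *-nonZero : ∀ {x y} → ¬ x ≈ 0# → ¬ y ≈ 0# → ¬ x * y ≈ 0#
  *-nonZero x≉0 y≉0 xy≈0 = [ x≉0 , y≉0 ]′ (noZeroDivisors xy≈0)

  *-cancelʳ : ∀ {x y z} → ¬ z ≈ 0# → x * z ≈ y * z → x ≈ y
  *-cancelʳ {x} {y} {z} z≉0 xz≈yz with noZeroDivisors [x-y]z≈0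
    where
    open RingProperties ring
    open SetoidReasoning setoid
    [x-y]z≈0 : (x - y) * z ≈ 0#
    [x-y]z≈0 = begin
      (x - y) * z       ≈⟨ [y-z]x≈yx-zx z x y ⟩
      x * z - y * z     ≈⟨ +-congʳ xz≈yz ⟩
      y * z - y * z     ≈⟨ -‿inverseʳ (y * z) ⟩
      0#                ∎
  ... | inj₁ x-y≈0 = RingProperties.x∙y⁻¹≈ε⇒x≈y ring x y x-y≈0
  ... | inj₂ z≈0   = ⊥-elim (z≉0 z≈0)

record Field c ℓ : Set (lsuc (c ⊔ ℓ)) where
  field
    commutativeRing : CommutativeRing c ℓ
  open CommutativeRing commutativeRing public
  field
    _≟_        : Decidable _≈_
    1≉0        : ¬ 1# ≈ 0#
    invertible : ∀ x → ¬ x ≈ 0# → ∃ λ y → x * y ≈ 1#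

  infix  9 _⁻¹
  infixl 7 _/_

  -- Totalised by 0 ⁻¹ = 0.
  _⁻¹ : Carrier → Carrier
  x ⁻¹ with x ≟ 0#
  ... | yes _   = 0#
  ... | no  x≉0 = proj₁ (invertible x x≉0)

  _/_ : Carrier → Carrier → Carrier
  x / y = x * y ⁻¹

  *-inverseʳ : ∀ {x} → ¬ x ≈ 0# → x * x ⁻¹ ≈ 1#
  *-inverseʳ {x} x≉0 with x ≟ 0#
  ... | yes x≈0  = ⊥-elim (x≉0 x≈0)
  ... | no  x≉0′ = proj₂ (invertible x x≉0′)

  integralDomain : IntegralDomain c ℓ
  integralDomain = record
    { commutativeRing = commutativeRing
    ; _≟_             = _≟_
    ; 1≉0             = 1≉0
    ; noZeroDivisors  = noZeroDivisors
    }
    where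
    open SetoidReasoning setoid
    noZeroDivisors : ∀ {x y} → x * y ≈ 0# → x ≈ 0# ⊎ y ≈ 0#
    noZeroDivisors {x} {y} xy≈0 with x ≟ 0#
    ... | yes x≈0 = inj₁ x≈0
    ... | no  x≉0 = inj₂ (begin
      y                   ≈⟨ *-identityˡ y ⟨
      1# * y              ≈⟨ *-congʳ (*-inverseʳ x≉0) ⟨
      (x * x ⁻¹) * y      ≈⟨ *-congʳ (*-comm x (x ⁻¹)) ⟩
      (x ⁻¹ * x) * y      ≈⟨ *-assoc (x ⁻¹) x y ⟩
      x ⁻¹ * (x * y)      ≈⟨ *-congˡ xy≈0 ⟩
      x ⁻¹ * 0#           ≈⟨ zeroʳ (x ⁻¹) ⟩
      0#                  ∎)

-- Univariate polynomials, as lists of coefficients with the constant term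
-- first; trailing zeros are allowed, so equality compares coefficients.
module Polynomial (R : CommutativeRing c ℓ) where
  private module R = CommutativeRing R
  open R using (Carrier; 0#; 1#)
  open RingProperties R.ring using (-0#≈0#)
  open CommutativeSemigroupProperties
    (CommutativeMonoid.commutativeSemigroup R.+-commutativeMonoid) using (interchange)

  infix  4 _≈_
  infixl 6 _+_
  infixl 7 _*_ _·_
  infix  8 -_

  Poly : Set c
  Poly = List Carrier

  coeff : Poly → ℕ → Carrier
  coeff []      _       = 0#
  coeff (a ∷ f) zero    = a
  coeff (a ∷ f) (suc n) = coeff f n

  record _≈_ (f g : Poly) : Set ℓ where
    constructor coeffwise
    field coeff-≈ : ∀ n → coeff f n R.≈ coeff g n
  open _≈_ public

  const : Carrier → Poly
  const a = a ∷ []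

  X : Poly
  X = 0# ∷ 1# ∷ []

  _+_ : Poly → Poly → Poly
  []      + g       = g
  (a ∷ f) + []      = a ∷ f
  (a ∷ f) + (b ∷ g) = a R.+ b ∷ f + g

  -_ : Poly → Poly
  - f = map R.-_ f

  _·_ : Carrier → Poly → Poly
  a · f = map (a R.*_) f

  _*_ : Poly → Poly → Poly
  []      * g = []
  (a ∷ f) * g = a · g + (0# ∷ f * g)

  coeff-+ : ∀ f g n → coeff (f + g) n R.≈ coeff f n R.+ coeff g n
  coeff-+ []      g       n       = R.sym (R.+-identityˡ _)
  coeff-+ (a ∷ f) []      n       = R.sym (R.+-identityʳ _)
  coeff-+ (a ∷ f) (b ∷ g) zero    = R.refl
  coeff-+ (a ∷ f) (b ∷ g) (suc n) = coeff-+ f g n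

  coeff-neg : ∀ f n → coeff (- f) n R.≈ R.- coeff f n
  coeff-neg []      n       = R.sym -0#≈0#
  coeff-neg (a ∷ f) zero    = R.refl
  coeff-neg (a ∷ f) (suc n) = coeff-neg f n

  coeff-· : ∀ a f n → coeff (a · f) n R.≈ a R.* coeff f n
  coeff-· a []      n       = R.sym (R.zeroʳ a)
  coeff-· a (b ∷ f) zero    = R.refl
  coeff-· a (b ∷ f) (suc n) = coeff-· a f n

  ≈-refl : ∀ {f} → f ≈ f
  ≈-refl = coeffwise λ _ → R.refl

  ≈-sym : ∀ {f g} → f ≈ g → g ≈ f
  ≈-sym f≈g = coeffwise λ n → R.sym (coeff-≈ f≈g n)

  ≈-trans : ∀ {f g h} → f ≈ g → g ≈ h → f ≈ h
  ≈-trans f≈g g≈h = coeffwise λ n → R.trans (coeff-≈ f≈g n) (coeff-≈ g≈h n)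

  isEquivalence : IsEquivalence _≈_
  isEquivalence = record { refl = ≈-refl ; sym = ≈-sym ; trans = ≈-trans }

  setoid : Setoid c ℓ
  setoid = record { isEquivalence = isEquivalence }

  +-cong : ∀ {f f′ g g′} → f ≈ f′ → g ≈ g′ → f + g ≈ f′ + g′
  +-cong {f} {f′} {g} {g′} p q = coeffwise λ n →
    R.trans (coeff-+ f g n)
      (R.trans (R.+-cong (coeff-≈ p n) (coeff-≈ q n)) (R.sym (coeff-+ f′ g′ n)))

  +-assoc : ∀ f g h → (f + g) + h ≈ f + (g + h)
  +-assoc f g h = coeffwise λ n → begin
    coeff ((f + g) + h) n                     ≈⟨ coeff-+ (f + g) h n ⟩
    coeff (f + g) n R.+ coeff h n             ≈⟨ R.+-congʳ (coeff-+ f g n) ⟩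
    coeff f n R.+ coeff g n R.+ coeff h n     ≈⟨ R.+-assoc _ _ _ ⟩
    coeff f n R.+ (coeff g n R.+ coeff h n)   ≈⟨ R.+-congˡ (coeff-+ g h n) ⟨
    coeff f n R.+ coeff (g + h) n             ≈⟨ coeff-+ f (g + h) n ⟨
    coeff (f + (g + h)) n                     ∎
    where open SetoidReasoning R.setoid

  +-comm : ∀ f g → f + g ≈ g + f
  +-comm f g = coeffwise λ n →
    R.trans (coeff-+ f g n) (R.trans (R.+-comm _ _) (R.sym (coeff-+ g f n)))

  +-identityʳ : ∀ f → f + [] ≈ f
  +-identityʳ f = +-comm f []

  +-inverseʳ : ∀ f → f + - f ≈ []
  +-inverseʳ f = coeffwise λ n →
    R.trans (coeff-+ f (- f) n)
      (R.trans (R.+-congˡ (coeff-neg f n)) (R.-‿inverseʳ _))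

  neg-cong : ∀ {f g} → f ≈ g → - f ≈ - g
  neg-cong {f} {g} p = coeffwise λ n →
    R.trans (coeff-neg f n) (R.trans (R.-‿cong (coeff-≈ p n)) (R.sym (coeff-neg g n)))

  +-interchange : ∀ f g h k → (f + g) + (h + k) ≈ (f + h) + (g + k)
  +-interchange f g h k = coeffwise λ n → begin
    coeff ((f + g) + (h + k)) n                                       ≈⟨ expand f g h k n ⟩
    (coeff f n R.+ coeff g n) R.+ (coeff h n R.+ coeff k n)           ≈⟨ interchange _ _ _ _ ⟩
    (coeff f n R.+ coeff h n) R.+ (coeff g n R.+ coeff k n)           ≈⟨ expand f h g k n ⟨
    coeff ((f + h) + (g + k)) n                                       ∎
    where
    open SetoidReasoning R.setoid
    expand : ∀ f g h k n → coeff ((f + g) + (h + k)) n R.≈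
                           (coeff f n R.+ coeff g n) R.+ (coeff h n R.+ coeff k n)
    expand f g h k n =
      R.trans (coeff-+ (f + g) (h + k) n) (R.+-cong (coeff-+ f g n) (coeff-+ h k n))

  ∷-cong : ∀ {a b f g} → a R.≈ b → f ≈ g → a ∷ f ≈ b ∷ g
  ∷-cong a≈b f≈g = coeffwise λ { zero → a≈b ; (suc n) → coeff-≈ f≈g n }

  0∷[]≈[] : 0# ∷ [] ≈ []
  0∷[]≈[] = coeffwise λ { zero → R.refl ; (suc n) → R.refl }

  0∷-+ : ∀ f g → (0# ∷ f) + (0# ∷ g) ≈ 0# ∷ f + g
  0∷-+ f g = ∷-cong (R.+-identityˡ 0#) ≈-refl

  ·-cong : ∀ a {f g} → f ≈ g → a · f ≈ a · g
  ·-cong a {f} {g} p = coeffwise λ n →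
    R.trans (coeff-· a f n) (R.trans (R.*-congˡ (coeff-≈ p n)) (R.sym (coeff-· a g n)))

  ·-distrib-+ : ∀ a f g → a · (f + g) ≈ a · f + a · g
  ·-distrib-+ a f g = coeffwise λ n → begin
    coeff (a · (f + g)) n                   ≈⟨ coeff-· a (f + g) n ⟩
    a R.* coeff (f + g) n                   ≈⟨ R.*-congˡ (coeff-+ f g n) ⟩
    a R.* (coeff f n R.+ coeff g n)         ≈⟨ R.distribˡ _ _ _ ⟩
    a R.* coeff f n R.+ a R.* coeff g n     ≈⟨ R.+-cong (coeff-· a f n) (coeff-· a g n) ⟨
    coeff (a · f) n R.+ coeff (a · g) n     ≈⟨ coeff-+ (a · f) (a · g) n ⟨
    coeff (a · f + a · g) n                 ∎
    where open SetoidReasoning R.setoid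

  ·-assoc : ∀ a b f → (a R.* b) · f ≈ a · (b · f)
  ·-assoc a b f = coeffwise λ n → begin
    coeff ((a R.* b) · f) n      ≈⟨ coeff-· (a R.* b) f n ⟩
    (a R.* b) R.* coeff f n      ≈⟨ R.*-assoc a b _ ⟩
    a R.* (b R.* coeff f n)      ≈⟨ R.*-congˡ (coeff-· b f n) ⟨
    a R.* coeff (b · f) n        ≈⟨ coeff-· a (b · f) n ⟨
    coeff (a · (b · f)) n        ∎
    where open SetoidReasoning R.setoid

  1·f≈f : ∀ f → 1# · f ≈ f
  1·f≈f f = coeffwise λ n → R.trans (coeff-· 1# f n) (R.*-identityˡ _)

  0·f≈[] : ∀ {a} f → a R.≈ 0# → a · f ≈ []
  0·f≈[] {a} f a≈0 = coeffwise λ n →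
    R.trans (coeff-· a f n) (R.trans (R.*-congʳ a≈0) (R.zeroˡ _))

  *-congˡ : ∀ f {g h} → g ≈ h → f * g ≈ f * h
  *-congˡ []      p = ≈-refl
  *-congˡ (a ∷ f) p = +-cong (·-cong a p) (∷-cong R.refl (*-congˡ f p))

  *-zeroʳ : ∀ f → f * [] ≈ []
  *-zeroʳ []      = ≈-refl
  *-zeroʳ (a ∷ f) = ≈-trans (∷-cong R.refl (*-zeroʳ f)) 0∷[]≈[]

  *-∷ : ∀ f b g → f * (b ∷ g) ≈ b · f + (0# ∷ f * g)
  *-∷ []      b g = ≈-sym 0∷[]≈[]
  *-∷ (a ∷ f) b g = ∷-cong (R.+-congʳ (R.*-comm a b)) (begin
    a · g + f * (b ∷ g)                   ≈⟨ +-cong ≈-refl (*-∷ f b g) ⟩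
    a · g + (b · f + (0# ∷ f * g))        ≈⟨ +-assoc (a · g) (b · f) _ ⟨
    (a · g + b · f) + (0# ∷ f * g)        ≈⟨ +-cong (+-comm (a · g) (b · f)) ≈-refl ⟩
    (b · f + a · g) + (0# ∷ f * g)        ≈⟨ +-assoc (b · f) (a · g) _ ⟩
    b · f + (a · g + (0# ∷ f * g))        ∎)
    where open SetoidReasoning setoid

  *-comm : ∀ f g → f * g ≈ g * f
  *-comm []      g = ≈-sym (*-zeroʳ g)
  *-comm (a ∷ f) g =
    ≈-trans (+-cong ≈-refl (∷-cong R.refl (*-comm f g))) (≈-sym (*-∷ g a f))

  *-cong : ∀ {f f′ g g′} → f ≈ f′ → g ≈ g′ → f * g ≈ f′ * g′
  *-cong {f} {f′} {g} {g′} p q =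
    ≈-trans (*-congˡ f q)
      (≈-trans (*-comm f g′) (≈-trans (*-congˡ g′ p) (*-comm g′ f′)))

  *-distribˡ-+ : ∀ f g h → f * (g + h) ≈ f * g + f * h
  *-distribˡ-+ []      g h = ≈-refl
  *-distribˡ-+ (a ∷ f) g h =
    ≈-trans
      (+-cong (·-distrib-+ a g h)
        (≈-trans (∷-cong R.refl (*-distribˡ-+ f g h)) (≈-sym (0∷-+ (f * g) (f * h)))))
      (+-interchange (a · g) (a · h) (0# ∷ f * g) (0# ∷ f * h))

  *-distribʳ-+ : ∀ h f g → (f + g) * h ≈ f * h + g * h
  *-distribʳ-+ h f g =
    ≈-trans (*-comm (f + g) h)
      (≈-trans (*-distribˡ-+ h f g) (+-cong (*-comm h f) (*-comm h g)))

  0∷-* : ∀ {a} f g → a R.≈ 0# → (a ∷ f) * g ≈ 0# ∷ f * g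
  0∷-* f g a≈0 = +-cong (0·f≈[] g a≈0) ≈-refl

  *-0∷ : ∀ {b} f g → b R.≈ 0# → f * (b ∷ g) ≈ 0# ∷ f * g
  *-0∷ {b} f g b≈0 = ≈-trans (*-∷ f b g) (+-cong (0·f≈[] f b≈0) ≈-refl)

  ·-* : ∀ a f g → (a · f) * g ≈ a · (f * g)
  ·-* a []      g = ≈-refl
  ·-* a (b ∷ f) g =
    ≈-trans
      (+-cong (·-assoc a b g) (∷-cong (R.sym (R.zeroʳ a)) (·-* a f g)))
      (≈-sym (·-distrib-+ a (b · g) (0# ∷ f * g)))

  *-assoc : ∀ f g h → (f * g) * h ≈ f * (g * h)
  *-assoc []      g h = ≈-refl
  *-assoc (a ∷ f) g h =
    ≈-trans (*-distribʳ-+ h (a · g) (0# ∷ f * g))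
      (+-cong (·-* a g h)
        (≈-trans (0∷-* (f * g) h R.refl) (∷-cong R.refl (*-assoc f g h))))

  *-identityˡ : ∀ f → const 1# * f ≈ f
  *-identityˡ f = ≈-trans (+-cong (1·f≈f f) 0∷[]≈[]) (+-identityʳ f)

  commutativeRing : CommutativeRing c ℓ
  commutativeRing = record
    { Carrier = Poly
    ; _≈_     = _≈_
    ; _+_     = _+_
    ; _*_     = _*_
    ; -_      = -_
    ; 0#      = []
    ; 1#      = const 1#
    ; isCommutativeRing = record
      { isRing = record
        { +-isAbelianGroup = record
          { isGroup = record
            { isMonoid = record
              { isSemigroup = record
                { isMagma = record
                  { isEquivalence = isEquivalence
                  ; ∙-cong = +-cong
                  }
                ; assoc = +-assoc
                }
              ; identity = (λ _ → ≈-refl) , +-identityʳ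
              }
            ; inverse = (λ f → ≈-trans (+-comm (- f) f) (+-inverseʳ f)) , +-inverseʳ
            ; ⁻¹-cong = neg-cong
            }
          ; comm = +-comm
          }
        ; *-cong     = *-cong
        ; *-assoc    = *-assoc
        ; *-identity = *-identityˡ , λ f → ≈-trans (*-comm f (const 1#)) (*-identityˡ f)
        ; distrib    = *-distribˡ-+ , *-distribʳ-+
        }
      ; *-comm = *-comm
      }
    }

  ∷≈[]⁻¹ : ∀ {a f} → a ∷ f ≈ [] → f ≈ []
  ∷≈[]⁻¹ p = coeffwise λ n → coeff-≈ p (suc n)

  ∷⁻¹ : ∀ {a b f g} → a ∷ f ≈ b ∷ g → f ≈ g
  ∷⁻¹ p = coeffwise λ n → coeff-≈ p (suc n)

  module _ (_≟_ : Decidable R._≈_) where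

    ≈-dec : Decidable _≈_
    ≈-dec []      []      = yes ≈-refl
    ≈-dec []      (b ∷ g) =
      map′ (λ (p , q) → ≈-trans (≈-sym 0∷[]≈[]) (∷-cong p q))
           (λ p → coeff-≈ p 0 , ≈-sym (∷≈[]⁻¹ (≈-sym p)))
           ((0# ≟ b) ×-dec ≈-dec [] g)
    ≈-dec (a ∷ f) []      =
      map′ (λ (p , q) → ≈-trans (∷-cong p q) 0∷[]≈[])
           (λ p → coeff-≈ p 0 , ∷≈[]⁻¹ p)
           ((a ≟ 0#) ×-dec ≈-dec f [])
    ≈-dec (a ∷ f) (b ∷ g) =
      map′ (λ (p , q) → ∷-cong p q) (λ p → coeff-≈ p 0 , ∷⁻¹ p)
           ((a ≟ b) ×-dec ≈-dec f g)

  module _ (noZeroDivisors : ∀ {x y} → x R.* y R.≈ 0# → x R.≈ 0# ⊎ y R.≈ 0#) where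

    *-noZeroDivisors : ∀ f g → f * g ≈ [] → f ≈ [] ⊎ g ≈ []
    *-noZeroDivisors []      g       p = inj₁ ≈-refl
    *-noZeroDivisors (a ∷ f) []      p = inj₂ ≈-refl
    *-noZeroDivisors (a ∷ f) (b ∷ g) p =
      [ (λ a≈0 → map₁ (λ f≈0 → ≈-trans (∷-cong a≈0 f≈0) 0∷[]≈[])
          (*-noZeroDivisors f (b ∷ g) (∷≈[]⁻¹ (≈-trans (≈-sym (0∷-* f (b ∷ g) a≈0)) p))))
      , (λ b≈0 → map₂ (λ g≈0 → ≈-trans (∷-cong b≈0 g≈0) 0∷[]≈[])
          (*-noZeroDivisors (a ∷ f) g (∷≈[]⁻¹ (≈-trans (≈-sym (*-0∷ (a ∷ f) g b≈0)) p))))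
      ]′ (noZeroDivisors {a} {b} (R.trans (R.sym (R.+-identityʳ _)) (coeff-≈ p 0)))

-- f(x) for x in a ring S, the coefficients being sent to S by ι.
evaluate : (R : CommutativeRing c ℓ) (S : CommutativeRing d m)
         → (CommutativeRing.Carrier R → CommutativeRing.Carrier S)
         → Polynomial.Poly R → CommutativeRing.Carrier S → CommutativeRing.Carrier S
evaluate R S ι []      x = CommutativeRing.0# S
evaluate R S ι (a ∷ f) x = ι a + x * evaluate R S ι f x
  where open CommutativeRing S

polynomialDomain : IntegralDomain c ℓ → IntegralDomain c ℓ
polynomialDomain D = record
  { commutativeRing = P.commutativeRing
  ; _≟_             = P.≈-dec D._≟_
  ; 1≉0             = λ p → D.1≉0 (P.coeff-≈ p 0)
  ; noZeroDivisors  = λ {f} {g} → P.*-noZeroDivisors D.noZeroDivisors f g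
  }
  where
  module D = IntegralDomain D
  module P = Polynomial D.commutativeRing

module FractionField (D : IntegralDomain c ℓ) where
  private
    module D = IntegralDomain D
    open NaturalSolver D.commutativeSemiring
    open D using (0#; 1#)

  infix  4 _≈_
  infixl 6 _+_
  infixl 7 _*_
  infix  8 -_

  record Fraction : Set (c ⊔ ℓ) where
    constructor fraction
    field
      numerator   : D.Carrier
      denominator : D.Carrier
      nonZero     : ¬ denominator D.≈ 0#
  open Fraction public

  record _≈_ (x y : Fraction) : Set ℓ where
    constructor crossMultiply
    field cross-≈ : numerator x D.* denominator y D.≈ numerator y D.* denominator x
  open _≈_ public

  embed : D.Carrier → Fraction
  embed a = fraction a 1# D.1≉0

  _+_ : Fraction → Fraction → Fraction
  fraction a b b≉0 + fraction a′ b′ b′≉0 =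
    fraction (a D.* b′ D.+ a′ D.* b) (b D.* b′) (D.*-nonZero b≉0 b′≉0)

  -_ : Fraction → Fraction
  - fraction a b b≉0 = fraction (D.- a) b b≉0

  _*_ : Fraction → Fraction → Fraction
  fraction a b b≉0 * fraction a′ b′ b′≉0 =
    fraction (a D.* a′) (b D.* b′) (D.*-nonZero b≉0 b′≉0)

  private
    ≈-refl : ∀ {x} → x ≈ x
    ≈-refl = crossMultiply D.refl

    ≈-sym : ∀ {x y} → x ≈ y → y ≈ x
    ≈-sym (crossMultiply p) = crossMultiply (D.sym p)

    ≈-trans : ∀ {x y z} → x ≈ y → y ≈ z → x ≈ z
    ≈-trans {fraction a b _} {fraction a′ b′ b′≉0} {fraction a″ b″ _}
            (crossMultiply p) (crossMultiply q) =
      crossMultiply (D.*-cancelʳ b′≉0 (begin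
        a D.* b″ D.* b′     ≈⟨ solve 3 (λ a b″ b′ → a :* b″ :* b′ := a :* b′ :* b″) D.refl a b″ b′ ⟩
        a D.* b′ D.* b″     ≈⟨ D.*-congʳ p ⟩
        a′ D.* b D.* b″     ≈⟨ solve 3 (λ a′ b b″ → a′ :* b :* b″ := a′ :* b″ :* b) D.refl a′ b b″ ⟩
        a′ D.* b″ D.* b     ≈⟨ D.*-congʳ q ⟩
        a″ D.* b′ D.* b     ≈⟨ solve 3 (λ a″ b′ b → a″ :* b′ :* b := a″ :* b :* b′) D.refl a″ b′ b ⟩
        a″ D.* b D.* b′     ∎))
      where open SetoidReasoning D.setoid

    +-cong : ∀ {x x′ y y′} → x ≈ x′ → y ≈ y′ → x + y ≈ x′ + y′
    +-cong {fraction a b _} {fraction a′ b′ _} {fraction e f _} {fraction e′ f′ _}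
           (crossMultiply p) (crossMultiply q) = crossMultiply (begin
      (a D.* f D.+ e D.* b) D.* (b′ D.* f′)
        ≈⟨ solve 6 (λ a b e f b′ f′ → (a :* f :+ e :* b) :* (b′ :* f′)
             := a :* b′ :* (f :* f′) :+ e :* f′ :* (b :* b′)) D.refl a b e f b′ f′ ⟩
      a D.* b′ D.* (f D.* f′) D.+ e D.* f′ D.* (b D.* b′)
        ≈⟨ D.+-cong (D.*-congʳ p) (D.*-congʳ q) ⟩
      a′ D.* b D.* (f D.* f′) D.+ e′ D.* f D.* (b D.* b′)
        ≈⟨ solve 6 (λ a′ b e′ f b′ f′ → a′ :* b :* (f :* f′) :+ e′ :* f :* (b :* b′)
             := (a′ :* f′ :+ e′ :* b′) :* (b :* f)) D.refl a′ b e′ f b′ f′ ⟩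
      (a′ D.* f′ D.+ e′ D.* b′) D.* (b D.* f) ∎)
      where open SetoidReasoning D.setoid

    *-cong : ∀ {x x′ y y′} → x ≈ x′ → y ≈ y′ → x * y ≈ x′ * y′
    *-cong {fraction a b _} {fraction a′ b′ _} {fraction e f _} {fraction e′ f′ _}
           (crossMultiply p) (crossMultiply q) = crossMultiply (begin
      (a D.* e) D.* (b′ D.* f′)
        ≈⟨ solve 4 (λ a e b′ f′ → (a :* e) :* (b′ :* f′) := (a :* b′) :* (e :* f′)) D.refl a e b′ f′ ⟩
      (a D.* b′) D.* (e D.* f′)
        ≈⟨ D.*-cong p q ⟩
      (a′ D.* b) D.* (e′ D.* f)
        ≈⟨ solve 4 (λ a′ b e′ f → (a′ :* b) :* (e′ :* f) := (a′ :* e′) :* (b :* f)) D.refl a′ b e′ f ⟩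
      (a′ D.* e′) D.* (b D.* f) ∎)
      where open SetoidReasoning D.setoid

    neg-cong : ∀ {x y} → x ≈ y → - x ≈ - y
    neg-cong (crossMultiply p) = crossMultiply
      (D.trans (D.sym (-‿distribˡ-* _ _))
        (D.trans (D.-‿cong p) (-‿distribˡ-* _ _)))
      where open RingProperties D.ring using (-‿distribˡ-*)

    +-assoc : ∀ x y z → (x + y) + z ≈ x + (y + z)
    +-assoc (fraction a b _) (fraction a′ b′ _) (fraction a″ b″ _) = crossMultiply
      (solve 6 (λ a b a′ b′ a″ b″ →
        ((a :* b′ :+ a′ :* b) :* b″ :+ a″ :* (b :* b′)) :* (b :* (b′ :* b″))
        := (a :* (b′ :* b″) :+ (a′ :* b″ :+ a″ :* b′) :* b) :* ((b :* b′) :* b″))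
        D.refl a b a′ b′ a″ b″)

    +-comm : ∀ x y → x + y ≈ y + x
    +-comm (fraction a b _) (fraction a′ b′ _) = crossMultiply
      (solve 4 (λ a b a′ b′ →
        (a :* b′ :+ a′ :* b) :* (b′ :* b) := (a′ :* b :+ a :* b′) :* (b :* b′))
        D.refl a b a′ b′)

    +-identityˡ : ∀ x → embed 0# + x ≈ x
    +-identityˡ (fraction a b _) = crossMultiply
      (solve 2 (λ a b → (con 0 :* b :+ a :* con 1) :* b := a :* (con 1 :* b)) D.refl a b)

    +-inverseʳ : ∀ x → x + - x ≈ embed 0#
    +-inverseʳ (fraction a b _) = crossMultiply (begin
      (a D.* b D.+ D.- a D.* b) D.* 1#      ≈⟨ D.*-identityʳ _ ⟩
      a D.* b D.+ D.- a D.* b               ≈⟨ D.distribʳ b a (D.- a) ⟨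
      (a D.+ D.- a) D.* b                   ≈⟨ D.*-congʳ (D.-‿inverseʳ a) ⟩
      0# D.* b                              ≈⟨ D.zeroˡ b ⟩
      0#                                    ≈⟨ D.zeroˡ (b D.* b) ⟨
      0# D.* (b D.* b)                      ∎)
      where open SetoidReasoning D.setoid

    *-assoc : ∀ x y z → (x * y) * z ≈ x * (y * z)
    *-assoc (fraction a b _) (fraction a′ b′ _) (fraction a″ b″ _) = crossMultiply
      (solve 6 (λ a b a′ b′ a″ b″ →
        ((a :* a′) :* a″) :* (b :* (b′ :* b″)) := (a :* (a′ :* a″)) :* ((b :* b′) :* b″))
        D.refl a b a′ b′ a″ b″)

    *-comm : ∀ x y → x * y ≈ y * x
    *-comm (fraction a b _) (fraction a′ b′ _) = crossMultiply
      (solve 4 (λ a b a′ b′ → (a :* a′) :* (b′ :* b) := (a′ :* a) :* (b :* b′))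
        D.refl a b a′ b′)

    *-identityˡ : ∀ x → embed 1# * x ≈ x
    *-identityˡ (fraction a b _) = crossMultiply
      (solve 2 (λ a b → (con 1 :* a) :* b := a :* (con 1 :* b)) D.refl a b)

    *-distribˡ-+ : ∀ x y z → x * (y + z) ≈ x * y + x * z
    *-distribˡ-+ (fraction a b _) (fraction a′ b′ _) (fraction a″ b″ _) = crossMultiply
      (solve 6 (λ a b a′ b′ a″ b″ →
        (a :* (a′ :* b″ :+ a″ :* b′)) :* ((b :* b′) :* (b :* b″))
        := ((a :* a′) :* (b :* b″) :+ (a :* a″) :* (b :* b′)) :* (b :* (b′ :* b″)))
        D.refl a b a′ b′ a″ b″)

    *-distribʳ-+ : ∀ z x y → (x + y) * z ≈ x * z + y * z
    *-distribʳ-+ z x y =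
      ≈-trans (*-comm (x + y) z)
        (≈-trans (*-distribˡ-+ z x y) (+-cong (*-comm z x) (*-comm z y)))

  commutativeRing : CommutativeRing (c ⊔ ℓ) ℓ
  commutativeRing = record
    { Carrier = Fraction
    ; _≈_     = _≈_
    ; _+_     = _+_
    ; _*_     = _*_
    ; -_      = -_
    ; 0#      = embed 0#
    ; 1#      = embed 1#
    ; isCommutativeRing = record
      { isRing = record
        { +-isAbelianGroup = record
          { isGroup = record
            { isMonoid = record
              { isSemigroup = record
                { isMagma = record
                  { isEquivalence = record
                    { refl = ≈-refl ; sym = ≈-sym ; trans = ≈-trans }
                  ; ∙-cong = +-cong
                  }
                ; assoc = +-assoc
                }
              ; identity = +-identityˡ , λ x → ≈-trans (+-comm x (embed 0#)) (+-identityˡ x)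
              }
            ; inverse = (λ x → ≈-trans (+-comm (- x) x) (+-inverseʳ x)) , +-inverseʳ
            ; ⁻¹-cong = neg-cong
            }
          ; comm = +-comm
          }
        ; *-cong     = *-cong
        ; *-assoc    = *-assoc
        ; *-identity = *-identityˡ , λ x → ≈-trans (*-comm x (embed 1#)) (*-identityˡ x)
        ; distrib    = *-distribˡ-+ , *-distribʳ-+
        }
      ; *-comm = *-comm
      }
    }

  embed-injective : ∀ {a b} → embed a ≈ embed b → a D.≈ b
  embed-injective (crossMultiply p) =
    D.trans (D.sym (D.*-identityʳ _)) (D.trans p (D.*-identityʳ _))

  fractionField : Field (c ⊔ ℓ) ℓ
  fractionField = record
    { commutativeRing = commutativeRing
    ; _≟_             = λ x y → map′ crossMultiply cross-≈
                          ((numerator x D.* denominator y) D.≟ (numerator y D.* denominator x))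
    ; 1≉0             = λ p → D.1≉0 (embed-injective p)
    ; invertible      = invertible
    }
    where
    invertible : ∀ x → ¬ x ≈ embed 0# → ∃ λ y → x * y ≈ embed 1#
    invertible (fraction a b b≉0) x≉0 = fraction b a a≉0 , crossMultiply
      (solve 2 (λ a b → (a :* b) :* con 1 := con 1 :* (b :* a)) D.refl a b)
      where
      a≉0 : ¬ a D.≈ 0#
      a≉0 a≈0 = x≉0 (crossMultiply
        (D.trans (D.*-identityʳ a) (D.trans a≈0 (D.sym (D.zeroˡ b)))))

-- ℤ modulo p.
module PrimeField (p : ℕ) (p-prime : Prime p) where
  open +-*-Solver

  infix 4 _≈_

  record _≈_ (x y : ℤ) : Set where
    constructor congruent
    field p∣x-y : + p ℤ∣.∣ x ℤ.- y
  open _≈_ public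

  private
    along : ∀ {x y z} → x ℤ.- y ≡ z → + p ℤ∣.∣ z → x ≈ y
    along eq p∣z = congruent (≡.subst (+ p ℤ∣.∣_) (≡.sym eq) p∣z)

    ≡⇒≈ : ∀ {x y} → x ≡ y → x ≈ y
    ≡⇒≈ {x} ≡.refl = along (ℤₚ.+-inverseʳ x) (divides (+ 0) ≡.refl)

    ≈-sym : ∀ {x y} → x ≈ y → y ≈ x
    ≈-sym {x} {y} (congruent q) =
      along (solve 2 (λ x y → y :- x := :- (x :- y)) ≡.refl x y) (ℤ∣.∣m⇒∣-m q)

    ≈-trans : ∀ {x y z} → x ≈ y → y ≈ z → x ≈ z
    ≈-trans {x} {y} {z} (congruent q) (congruent r) =
      along (solve 3 (λ x y z → x :- z := (x :- y) :+ (y :- z)) ≡.refl x y z)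
            (ℤ∣.∣m∣n⇒∣m+n q r)

    +-cong : ∀ {x x′ y y′} → x ≈ x′ → y ≈ y′ → x ℤ.+ y ≈ x′ ℤ.+ y′
    +-cong {x} {x′} {y} {y′} (congruent q) (congruent r) =
      along (solve 4 (λ x x′ y y′ → x :+ y :- (x′ :+ y′) := (x :- x′) :+ (y :- y′))
               ≡.refl x x′ y y′)
            (ℤ∣.∣m∣n⇒∣m+n q r)

    *-cong : ∀ {x x′ y y′} → x ≈ x′ → y ≈ y′ → x ℤ.* y ≈ x′ ℤ.* y′
    *-cong {x} {x′} {y} {y′} (congruent q) (congruent r) =
      along (solve 4 (λ x x′ y y′ → x :* y :- x′ :* y′ := x :* (y :- y′) :+ (x :- x′) :* y′)
               ≡.refl x x′ y y′)
            (ℤ∣.∣m∣n⇒∣m+n (ℤ∣.∣n⇒∣m*n x r) (ℤ∣.∣m⇒∣m*n y′ q))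

    neg-cong : ∀ {x y} → x ≈ y → ℤ.- x ≈ ℤ.- y
    neg-cong {x} {y} (congruent q) =
      along (solve 2 (λ x y → :- x :- :- y := :- (x :- y)) ≡.refl x y) (ℤ∣.∣m⇒∣-m q)

  commutativeRing : CommutativeRing 0ℓ 0ℓ
  commutativeRing = record
    { Carrier = ℤ
    ; _≈_     = _≈_
    ; _+_     = ℤ._+_
    ; _*_     = ℤ._*_
    ; -_      = ℤ.-_
    ; 0#      = + 0
    ; 1#      = + 1
    ; isCommutativeRing = record
      { isRing = record
        { +-isAbelianGroup = record
          { isGroup = record
            { isMonoid = record
              { isSemigroup = record
                { isMagma = record
                  { isEquivalence = record
                    { refl = ≡⇒≈ ≡.refl ; sym = ≈-sym ; trans = ≈-trans }
                  ; ∙-cong = +-cong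
                  }
                ; assoc = λ x y z → ≡⇒≈ (ℤₚ.+-assoc x y z)
                }
              ; identity = (λ x → ≡⇒≈ (ℤₚ.+-identityˡ x)) , λ x → ≡⇒≈ (ℤₚ.+-identityʳ x)
              }
            ; inverse = (λ x → ≡⇒≈ (ℤₚ.+-inverseˡ x)) , λ x → ≡⇒≈ (ℤₚ.+-inverseʳ x)
            ; ⁻¹-cong = neg-cong
            }
          ; comm = λ x y → ≡⇒≈ (ℤₚ.+-comm x y)
          }
        ; *-cong     = *-cong
        ; *-assoc    = λ x y z → ≡⇒≈ (ℤₚ.*-assoc x y z)
        ; *-identity = (λ x → ≡⇒≈ (ℤₚ.*-identityˡ x)) , λ x → ≡⇒≈ (ℤₚ.*-identityʳ x)
        ; distrib    = (λ x y z → ≡⇒≈ (ℤₚ.*-distribˡ-+ x y z))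
                     , λ x y z → ≡⇒≈ (ℤₚ.*-distribʳ-+ x y z)
        }
      ; *-comm = λ x y → ≡⇒≈ (ℤₚ.*-comm x y)
      }
    }

  private
    1≉0 : ¬ + 1 ≈ + 0
    1≉0 (congruent q) =
      ¬prime[1] (≡.subst Prime (ℕ∣.∣1⇒≡1 (ℤ∣.∣⇒∣ᵤ q)) p-prime)

    ∣∣-coprime : ∀ {x} → ¬ x ≈ + 0 → Coprime ∣ x ∣ p
    ∣∣-coprime {x} x≉0 (d∣x , d∣p) with prime⇒irreducible p-prime d∣p
    ... | inj₁ d≡1    = d≡1
    ... | inj₂ ≡.refl = contradiction (along (ℤₚ.+-identityʳ x) (ℤ∣.∣ᵤ⇒∣ d∣x)) x≉0

    pos-invertible : ∀ n → Coprime n p → ∃ λ y → + n ℤ.* y ≈ + 1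
    pos-invertible n n⊥p with Coprimality.coprime-Bézout n⊥p
    ... | Bézout.+- u v eq = + u , along (begin
      + n ℤ.* + u ℤ.- + 1                      ≡⟨ ≡.cong (ℤ._- + 1) (ℤₚ.*-comm (+ n) (+ u)) ⟩
      + u ℤ.* + n ℤ.- + 1                      ≡⟨ ≡.cong (ℤ._- + 1) (ℤₚ.pos-* u n) ⟨
      + (u ℕ.* n) ℤ.- + 1                      ≡⟨ ≡.cong (λ z → + z ℤ.- + 1) eq ⟨
      + 1 ℤ.+ + (v ℕ.* p) ℤ.- + 1              ≡⟨ solve 1 (λ z → con (+ 1) :+ z :- con (+ 1) := z) ≡.refl _ ⟩
      + (v ℕ.* p)                              ≡⟨ ℤₚ.pos-* v p ⟩
      + v ℤ.* + p                              ∎) (divides (+ v) ≡.refl)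
      where open ≡.≡-Reasoning
    ... | Bézout.-+ u v eq = ℤ.- (+ u) , along (begin
      + n ℤ.* (ℤ.- (+ u)) ℤ.- + 1              ≡⟨ solve 2 (λ n u → n :* (:- u) :- con (+ 1)
                                                    := :- (con (+ 1) :+ u :* n)) ≡.refl (+ n) (+ u) ⟩
      ℤ.- (+ 1 ℤ.+ + u ℤ.* + n)                ≡⟨ ≡.cong (λ z → ℤ.- (+ 1 ℤ.+ z)) (ℤₚ.pos-* u n) ⟨
      ℤ.- (+ (1 ℕ.+ u ℕ.* n))                  ≡⟨ ≡.cong (λ z → ℤ.- (+ z)) eq ⟩
      ℤ.- (+ (v ℕ.* p))                        ≡⟨ ≡.cong ℤ.-_ (ℤₚ.pos-* v p) ⟩
      ℤ.- (+ v ℤ.* + p)                        ∎) (ℤ∣.∣m⇒∣-m (divides (+ v) ≡.refl))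
      where open ≡.≡-Reasoning

    invertible : ∀ x → ¬ x ≈ + 0 → ∃ λ y → x ℤ.* y ≈ + 1
    invertible (+ n)      x≉0 = pos-invertible n (∣∣-coprime x≉0)
    invertible x@(-[1+ n ]) x≉0 with pos-invertible (suc n) (∣∣-coprime x≉0)
    ... | y , eq = ℤ.- y ,
      ≈-trans (≡⇒≈ (solve 2 (λ x y → x :* (:- y) := (:- x) :* y) ≡.refl x y)) eq

  primeField : Field 0ℓ 0ℓ
  primeField = record
    { commutativeRing = commutativeRing
    ; _≟_             = λ x y → map′ congruent p∣x-y (+ p ℤ∣.∣? x ℤ.- y)
    ; 1≉0             = 1≉0
    ; invertible      = invertible
    }

module Setting (p : ℕ) (p-prime : Prime p) where

  𝔽ₚ : Field 0ℓ 0ℓ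
  𝔽ₚ = PrimeField.primeField p p-prime

  𝔽ₚ[α] : IntegralDomain 0ℓ 0ℓ
  𝔽ₚ[α] = polynomialDomain (Field.integralDomain 𝔽ₚ)

  𝔽ₚ⟨α⟩ : Field 0ℓ 0ℓ
  𝔽ₚ⟨α⟩ = FractionField.fractionField 𝔽ₚ[α]

  𝔽ₚ⟨α⟩[X] : IntegralDomain 0ℓ 0ℓ
  𝔽ₚ⟨α⟩[X] = polynomialDomain (Field.integralDomain 𝔽ₚ⟨α⟩)

  𝔽ₚ⟨α⟩⟨X⟩ : Field 0ℓ 0ℓ
  𝔽ₚ⟨α⟩⟨X⟩ = FractionField.fractionField 𝔽ₚ⟨α⟩[X]

  -- F = 𝔽ₚ, A = 𝔽ₚ[α], K = 𝔽ₚ(α), P = K[X], L = K(X).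
  module F where
    open Field 𝔽ₚ public
    open RingNotation commutativeRing public

  module A where
    open IntegralDomain 𝔽ₚ[α] public
    open RingNotation commutativeRing public
    open Polynomial F.commutativeRing public using (const) renaming (X to α)

  module K where
    open Field 𝔽ₚ⟨α⟩ public
    open RingNotation commutativeRing public
    open FractionField 𝔽ₚ[α] public using (embed)

    α : Carrier
    α = embed A.α

  module P where
    open IntegralDomain 𝔽ₚ⟨α⟩[X] public
    open RingNotation commutativeRing public
    open Polynomial K.commutativeRing public using (const; X)

  module L where
    open Field 𝔽ₚ⟨α⟩⟨X⟩ public
    open RingNotation commutativeRing public
    open FractionField 𝔽ₚ⟨α⟩[X] public using (embed)

    X : Carrier
    X = embed P.X

    constant : K.Carrier → Carrier
    constant x = embed (P.const x)

  binomial : A.Carrier → ℕ → A.Carrier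
  binomial x m = A.const (F.fromℕ (m !) F.⁻¹) * (∏[ 0 ⋯< m ] λ i → x - fromℕ i)
    where open A

  -- b r s is b_{r,s}(α); it is meant for 0 < r, s < p.
  b : ℕ → ℕ → A.Carrier
  b r s = ∑[ 0 ⋯< p ] λ k →
    A.const ((F.- (F.fromℕ r F./ F.fromℕ s)) F.^ k)
      * binomial (fromℕ r * α - 1#) (p ∸ 1 ∸ k)
      * binomial (fromℕ s * α - 1#) k
    where open A

  -- b_{r,s}(γ), by substituting γ ∈ 𝔽ₚ(α) for α.
  b⟨_,_⟩_ : ℕ → ℕ → K.Carrier → K.Carrier
  b⟨ r , s ⟩ γ =
    evaluate F.commutativeRing K.commutativeRing (λ a → K.embed (A.const a)) (b r s) γ

  -- For γ = ± α no division by zero occurs: k and s stay below p, and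
  -- b_{1,s} has constant coefficient 1 for 0 < s < p - 1.
  G : K.Carrier → P.Carrier
  G γ = - (∑[ 1 ⋯< p ] λ k →
    const (K.1# K./ K.fromℕ k K./ (K.∏[ 1 ⋯< k ] λ s → b⟨ 1 , s ⟩ γ)) * X ^ k)
    where open P

  -- G^{(γ)}(y) for y in K(X).
  G⟨_⟩_ : K.Carrier → L.Carrier → L.Carrier
  G⟨ γ ⟩ y = evaluate K.commutativeRing L.commutativeRing L.constant (G γ) y

{-# OPTIONS --safe #-}
module Submission where

-- Let U = 1 − α^{p−1} and λ_k = 1 + α/k, so that U = ∏_{k=1}^{p−1} λ_k.  As b_{1,s}(α) is the coefficient
-- of z^{p−1} in (1+z)^{α−1} (1−z/s)^{sα−1}, it satisfies a recursion which bounds its degree by (p−1)/2,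
-- and it vanishes at every k ∈ {1,…,p−1} with k + (sk mod p) < p, i.e. ⌊(s+1)k/p⌋ = ⌊sk/p⌋; this holds for
-- exactly one of k and p−k.  A product of degree at most p−1 which vanishes on 𝔽ₚ* and takes the value 1 at 0
-- equals U.  Multiplying b_{1,s}(−α) by three polynomials therefore gives U each time, whence
--   b_{1,s}(α) b_{1,s}(−α) = U,   b_{1,p−1−s} = b_{1,s},   b_{1,s} = ∏_k λ_k^{⌊(s+1)k/p⌋ − ⌊sk/p⌋}.
-- The product of the latter over s telescopes, so ∏_k λ_k^k = U ∏_{s=1}^{p−2} b_{1,s}.  With D_k = ∏_{s<k} b_{1,s}
-- the symmetry gives D_k D_{p−k} = ∏_{s=1}^{p−2} b_{1,s} for every k, which turns the coefficient of X^k on the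
-- left, −(∏_k λ_k^k)/(k D_k) = −U D_{p−k}/k, into the one on the right.

open import Defs
open import Data.Nat.Base using (ℕ; _∸_)
open import Data.Nat.Divisibility using (_∤_)
open import Data.Nat.Primality using (Prime)

open import Algebra.Bundles using (CommutativeMonoid; CommutativeRing)
import Algebra.Morphism.Construct.Composition as Composition
open import Algebra.Morphism.Structures using (IsMonoidHomomorphism; IsRingHomomorphism)
import Algebra.Properties.CommutativeSemigroup as CommutativeSemigroupProperties
import Algebra.Properties.CommutativeSemiring.Binomial as Binomial
import Algebra.Properties.CommutativeSemiring.Exp as CommutativeSemiringExp
import Algebra.Properties.Monoid.Sum as MonoidSum
import Algebra.Properties.Ring as RingProperties
import Algebra.Properties.Semiring.Exp as SemiringExp
import Algebra.Properties.Semiring.Mult as SemiringMult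
import Algebra.Solver.Ring.NaturalCoefficients.Default as NaturalSolver
open import Data.Empty using (⊥-elim)
open import Data.Fin.Base as Fin using (Fin; toℕ)
import Data.Fin.Properties as Finₚ
import Data.Integer.Base as ℤ
import Data.Integer.Divisibility.Signed as ℤ∣
import Data.Integer.Properties as ℤₚ
open import Data.List.Base using ([]; _∷_)
import Data.Nat.Base as ℕ
open import Data.Nat.Base using (zero; suc; _≤_; _<_; z≤n; s≤s; _!; NonZero; ⌊_/2⌋)
open import Data.Nat.Combinatorics
  using (nCk≡nC[n∸k]; nCn≡1; nCk≡n!/k![n-k]!; k![n∸k]!∣n!) renaming (_C_ to _choose_)
open import Data.Nat.Divisibility using (_∣_; divides; ∣⇒≤; m∣m*n; ∣1⇒≡1)
open import Data.Nat.DivMod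
  using (_/_; _%_; m≡m%n+[m/n]*n; m%n<n; +-distrib-/; +-distrib-/-∣ʳ; m<n⇒m/n≡0; m*n/n≡m
        ; m<n⇒m%n≡m; m/n*n≡m; /-monoˡ-≤)
open import Data.Nat.Primality using (euclidsLemma; prime⇒nonTrivial; ¬prime[0])
import Data.Nat.Properties as ℕₚ
open import Data.Nat.Solver using (module +-*-Solver)
open import Data.Product.Base using (_×_; _,_)
open import Data.Sum.Base using (_⊎_; inj₁; inj₂)
open import Level using (Level; _⊔_)
open import Relation.Binary.PropositionalEquality as ≡ using (_≡_)
import Relation.Binary.Reasoning.Setoid as SetoidReasoning
open import Relation.Nullary using (¬_; yes; no)

-- At α = k the exponents α - 1 and sα - 1 agree modulo p with the natural numbers k - 1 and r - 1,
-- where r = sk mod p. The power product is then a polynomial in z of degree k + r - 2, so for k + r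
-- < p it has no term z^{p-1}; this is the source of the roots. At α = 0 both exponents are -1, and
-- the coefficient is a geometric sum which Fermat's theorem evaluates to 1 as long as s ≠ p - 1.
-- Hence s runs up to p - 2 only.
--
-- The roots found fill only half of 𝔽ₚ*, and which half depends on s. The factor b_{1,s}(-α) has
-- the opposite roots, so the product vanishes on all of 𝔽ₚ* and no list of roots is ever needed.
-- This requires the degree bound (p-1)/2: the bound p - 1, evident from the definition, would leave
-- the product undetermined. In the factorisation the indices are reflected, because λ_k vanishes at
-- -k, that is at p - k.
--
-- The sign in the final identity comes from 1/k + 1/(p-k) = 0.

private
  variable
    c ℓ d m : Level

-- Sums, products and ring homomorphisms

module Fold (M : CommutativeMonoid c ℓ) where
  open CommutativeMonoid M
  open CommutativeSemigroupProperties commutativeSemigroup using (interchange)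
  open SetoidReasoning setoid

  -- This is the form to which both range notations reduce: a range from 0 to `n` is `fold n f`, and
  -- a range from 1 to `suc n` is `fold n (λ i → f (suc i))`, by conversion. Hence the index shift
  -- by one in all products below.
  fold : ℕ → (ℕ → Carrier) → Carrier
  fold n f = MonoidSum.sum monoid {n} (λ i → f (toℕ i))

  fold-cong : ∀ n f g → (∀ i → i < n → f i ≈ g i) → fold n f ≈ fold n g
  fold-cong zero    f g f≈g = refl
  fold-cong (suc n) f g f≈g = ∙-cong (f≈g 0 (s≤s z≤n))
    (fold-cong n (λ i → f (suc i)) (λ i → g (suc i)) (λ i i<n → f≈g (suc i) (s≤s i<n)))

  fold-ε : ∀ n → fold n (λ _ → ε) ≈ ε
  fold-ε zero    = refl
  fold-ε (suc n) = trans (identityˡ _) (fold-ε n)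

  fold-last : ∀ n f → fold (suc n) f ≈ fold n f ∙ f n
  fold-last zero    f = comm (f 0) ε
  fold-last (suc n) f = begin
    f 0 ∙ fold (suc n) (λ i → f (suc i))               ≈⟨ ∙-congˡ (fold-last n (λ i → f (suc i))) ⟩
    f 0 ∙ (fold n (λ i → f (suc i)) ∙ f (suc n))       ≈⟨ assoc _ _ _ ⟨
    fold (suc n) f ∙ f (suc n)                         ∎

  fold-∙ : ∀ n f g → fold n (λ i → f i ∙ g i) ≈ fold n f ∙ fold n g
  fold-∙ zero    f g = sym (identityˡ ε)
  fold-∙ (suc n) f g = begin
    (f 0 ∙ g 0) ∙ fold n (λ i → f (suc i) ∙ g (suc i))  ≈⟨ ∙-congˡ (fold-∙ n (λ i → f (suc i)) (λ i → g (suc i))) ⟩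
    (f 0 ∙ g 0) ∙ (fold n (λ i → f (suc i)) ∙ fold n (λ i → g (suc i)))
      ≈⟨ interchange _ _ _ _ ⟩
    fold (suc n) f ∙ fold (suc n) g                     ∎

  fold-reverse : ∀ n f → fold n f ≈ fold n (λ i → f (n ∸ suc i))
  fold-reverse zero    f = refl
  fold-reverse (suc n) f = begin
    fold (suc n) f                         ≈⟨ fold-last n f ⟩
    fold n f ∙ f n                         ≈⟨ comm _ _ ⟩
    f n ∙ fold n f                         ≈⟨ ∙-congˡ (fold-reverse n f) ⟩
    f n ∙ fold n (λ i → f (n ∸ suc i))     ∎

module FoldHomomorphism (M : CommutativeMonoid c ℓ) (N : CommutativeMonoid d m)
  {φ : CommutativeMonoid.Carrier M → CommutativeMonoid.Carrier N}
  (φ-hom : IsMonoidHomomorphism (CommutativeMonoid.rawMonoid M) (CommutativeMonoid.rawMonoid N) φ)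
  where
  open CommutativeMonoid N
  open IsMonoidHomomorphism φ-hom

  fold-homo : ∀ n f → φ (Fold.fold M n f) ≈ Fold.fold N n (λ i → φ (f i))
  fold-homo zero    f = ε-homo
  fold-homo (suc n) f = trans (homo _ _) (∙-congˡ (fold-homo n (λ i → f (suc i))))

module _ (R : CommutativeRing c ℓ) (S : CommutativeRing d m) where
  private
    module R = CommutativeRing R
    module S = CommutativeRing S

  Homomorphism : (R.Carrier → S.Carrier) → Set _
  Homomorphism φ = IsRingHomomorphism R.rawRing S.rawRing φ

  homomorphism : ∀ {φ}
    → (∀ {x y} → x R.≈ y → φ x S.≈ φ y)
    → (∀ x y → φ (x R.+ y) S.≈ φ x S.+ φ y)
    → (∀ x y → φ (x R.* y) S.≈ φ x S.* φ y)
    → φ R.0# S.≈ S.0# → φ R.1# S.≈ S.1#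
    → (∀ x → φ (R.- x) S.≈ S.- φ x)
    → Homomorphism φ
  homomorphism φ-cong φ-+ φ-* φ-0 φ-1 φ-neg = record
    { isSemiringHomomorphism = record
      { isNearSemiringHomomorphism = record
        { +-isMonoidHomomorphism = record
          { isMagmaHomomorphism = record
            { isRelHomomorphism = record { cong = φ-cong }
            ; homo = φ-+
            }
          ; ε-homo = φ-0
          }
        ; *-homo = φ-*
        }
      ; 1#-homo = φ-1
      }
    ; -‿homo = φ-neg
    }

module HomomorphismProperties (R : CommutativeRing c ℓ) (S : CommutativeRing d m)
  {φ : CommutativeRing.Carrier R → CommutativeRing.Carrier S} (φ-hom : Homomorphism R S φ)
  where
  private
    module R = CommutativeRing R
    module S = CommutativeRing S
    module Rₙ = RingNotation R
    module Sₙ = RingNotation S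
  open IsRingHomomorphism φ-hom public

  ∑-homo : ∀ n f → φ (Fold.fold R.+-commutativeMonoid n f)
                   S.≈ Fold.fold S.+-commutativeMonoid n (λ i → φ (f i))
  ∑-homo = FoldHomomorphism.fold-homo R.+-commutativeMonoid S.+-commutativeMonoid
             +-isMonoidHomomorphism

  ∏-homo : ∀ n f → φ (Fold.fold R.*-commutativeMonoid n f)
                   S.≈ Fold.fold S.*-commutativeMonoid n (λ i → φ (f i))
  ∏-homo = FoldHomomorphism.fold-homo R.*-commutativeMonoid S.*-commutativeMonoid
             *-isMonoidHomomorphism

  ^-homo : ∀ x n → φ (x Rₙ.^ n) S.≈ φ x Sₙ.^ n
  ^-homo x zero    = 1#-homo
  ^-homo x (suc n) = S.trans (*-homo _ _) (S.*-congˡ (^-homo x n))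

  fromℕ-homo : ∀ n → φ (Rₙ.fromℕ n) S.≈ Sₙ.fromℕ n
  fromℕ-homo zero    = 0#-homo
  fromℕ-homo (suc n) = S.trans (+-homo _ _) (S.+-cong 1#-homo (fromℕ-homo n))

  x-y-homo : ∀ x y → φ (x R.- y) S.≈ φ x S.- φ y
  x-y-homo x y = S.trans (+-homo _ _) (S.+-congˡ (-‿homo y))

-- Evaluation of polynomials as a ring homomorphism

module Evaluation (R : CommutativeRing c ℓ) (S : CommutativeRing d m)
  {ι : CommutativeRing.Carrier R → CommutativeRing.Carrier S} (ι-hom : Homomorphism R S ι)
  (x : CommutativeRing.Carrier S)
  where
  private
    module R = CommutativeRing R
    module P = Polynomial R
    module ι = IsRingHomomorphism ι-hom
  open CommutativeRing S
  open RingProperties ring using (-0#≈0#; -‿+-comm; -‿distribʳ-*)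
  open CommutativeSemigroupProperties
    (CommutativeMonoid.commutativeSemigroup +-commutativeMonoid) using (interchange)
  open CommutativeSemigroupProperties
    (CommutativeMonoid.commutativeSemigroup *-commutativeMonoid) using (x∙yz≈y∙xz)
  open SetoidReasoning setoid

  eval : P.Poly → Carrier
  eval f = evaluate R S ι f x

  private
    eval-[] : ∀ f → f P.≈ [] → eval f ≈ 0#
    eval-[] []      _   = refl
    eval-[] (a ∷ f) f≈0 = begin
      ι a + x * eval f  ≈⟨ +-cong (trans (ι.⟦⟧-cong (P.coeff-≈ f≈0 0)) ι.0#-homo)
                                  (*-congˡ (eval-[] f (P.∷≈[]⁻¹ f≈0))) ⟩
      0# + x * 0#       ≈⟨ +-identityˡ _ ⟩
      x * 0#            ≈⟨ zeroʳ x ⟩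
      0#                ∎

  eval-cong : ∀ {f g} → f P.≈ g → eval f ≈ eval g
  eval-cong {[]}    {g}     f≈g = sym (eval-[] g (P.≈-sym f≈g))
  eval-cong {a ∷ f} {[]}    f≈g = eval-[] (a ∷ f) f≈g
  eval-cong {a ∷ f} {b ∷ g} f≈g =
    +-cong (ι.⟦⟧-cong (P.coeff-≈ f≈g 0)) (*-congˡ (eval-cong (P.∷⁻¹ f≈g)))

  eval-+ : ∀ f g → eval (f P.+ g) ≈ eval f + eval g
  eval-+ []      g       = sym (+-identityˡ _)
  eval-+ (a ∷ f) []      = sym (+-identityʳ _)
  eval-+ (a ∷ f) (b ∷ g) = begin
    ι (a R.+ b) + x * eval (f P.+ g)             ≈⟨ +-cong (ι.+-homo a b) (*-congˡ (eval-+ f g)) ⟩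
    (ι a + ι b) + x * (eval f + eval g)          ≈⟨ +-congˡ (distribˡ _ _ _) ⟩
    (ι a + ι b) + (x * eval f + x * eval g)      ≈⟨ interchange _ _ _ _ ⟩
    (ι a + x * eval f) + (ι b + x * eval g)      ∎

  eval-neg : ∀ f → eval (P.- f) ≈ - eval f
  eval-neg []      = sym -0#≈0#
  eval-neg (a ∷ f) = begin
    ι (R.- a) + x * eval (P.- f)   ≈⟨ +-cong (ι.-‿homo a) (*-congˡ (eval-neg f)) ⟩
    - ι a + x * - eval f           ≈⟨ +-congˡ (-‿distribʳ-* _ _) ⟨
    - ι a + - (x * eval f)         ≈⟨ -‿+-comm _ _ ⟩
    - (ι a + x * eval f)           ∎

  eval-· : ∀ a f → eval (a P.· f) ≈ ι a * eval f
  eval-· a []      = sym (zeroʳ _)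
  eval-· a (b ∷ f) = begin
    ι (a R.* b) + x * eval (a P.· f)     ≈⟨ +-cong (ι.*-homo a b) (*-congˡ (eval-· a f)) ⟩
    ι a * ι b + x * (ι a * eval f)       ≈⟨ +-congˡ (x∙yz≈y∙xz _ _ _) ⟩
    ι a * ι b + ι a * (x * eval f)       ≈⟨ distribˡ _ _ _ ⟨
    ι a * (ι b + x * eval f)             ∎

  eval-0∷ : ∀ f → eval (R.0# ∷ f) ≈ x * eval f
  eval-0∷ f = trans (+-congʳ ι.0#-homo) (+-identityˡ _)

  eval-* : ∀ f g → eval (f P.* g) ≈ eval f * eval g
  eval-* []      g = sym (zeroˡ _)
  eval-* (a ∷ f) g = begin
    eval (a P.· g P.+ (R.0# ∷ f P.* g))            ≈⟨ eval-+ (a P.· g) (R.0# ∷ f P.* g) ⟩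
    eval (a P.· g) + eval (R.0# ∷ f P.* g)         ≈⟨ +-cong (eval-· a g) (eval-0∷ (f P.* g)) ⟩
    ι a * eval g + x * eval (f P.* g)              ≈⟨ +-congˡ (*-congˡ (eval-* f g)) ⟩
    ι a * eval g + x * (eval f * eval g)           ≈⟨ +-congˡ (*-assoc _ _ _) ⟨
    ι a * eval g + (x * eval f) * eval g           ≈⟨ distribʳ _ _ _ ⟨
    (ι a + x * eval f) * eval g                    ∎

  eval-const : ∀ a → eval (P.const a) ≈ ι a
  eval-const a = trans (+-congˡ (zeroʳ x)) (+-identityʳ _)

  eval-X : eval P.X ≈ x
  eval-X = begin
    eval P.X               ≈⟨ eval-0∷ (P.const R.1#) ⟩
    x * eval (P.const R.1#)  ≈⟨ *-congˡ (eval-const R.1#) ⟩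
    x * ι R.1#             ≈⟨ *-congˡ ι.1#-homo ⟩
    x * 1#                 ≈⟨ *-identityʳ x ⟩
    x                      ∎

  eval-hom : Homomorphism P.commutativeRing S eval
  eval-hom = homomorphism P.commutativeRing S eval-cong eval-+ eval-* refl
    (trans (eval-const R.1#) ι.1#-homo) eval-neg

module _ (R : CommutativeRing c ℓ) where
  private
    module R = CommutativeRing R
    module P = Polynomial R

  id-hom : Homomorphism R R (λ x → x)
  id-hom = homomorphism R R (λ p → p) (λ _ _ → R.refl) (λ _ _ → R.refl) R.refl R.refl (λ _ → R.refl)

  const-hom : Homomorphism R P.commutativeRing P.const
  const-hom = homomorphism R P.commutativeRing
    (λ p → P.∷-cong p P.≈-refl)
    (λ _ _ → P.≈-refl)
    (λ _ _ → P.∷-cong (R.sym (R.+-identityʳ _)) P.≈-refl)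
    P.0∷[]≈[]
    P.≈-refl
    (λ _ → P.≈-refl)

  const-* : ∀ a f → P.const a P.* f P.≈ a P.· f
  const-* a f = P.≈-trans (P.+-cong P.≈-refl P.0∷[]≈[]) (P.+-identityʳ _)

  X-* : ∀ f → P.X P.* f P.≈ R.0# ∷ f
  X-* f = P.≈-trans (P.0∷-* (P.const R.1#) f R.refl) (P.∷-cong R.refl (P.*-identityˡ f))

module _ (R : CommutativeRing c ℓ) where
  private
    module P = Polynomial R
    module R = CommutativeRing R
  open Evaluation R P.commutativeRing (const-hom R) P.X

  eval-X-const : ∀ f → eval f P.≈ f
  eval-X-const []      = P.≈-refl
  eval-X-const (a ∷ f) = P.≈-trans (P.+-cong {P.const a} P.≈-refl
      (P.≈-trans (X-* R (eval f)) (P.∷-cong R.refl (eval-X-const f))))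
    (P.∷-cong (R.+-identityʳ a) P.≈-refl)

module _ {e f : Level} (R : CommutativeRing c ℓ) (S : CommutativeRing d m) (T : CommutativeRing e f)
  {ι : CommutativeRing.Carrier R → CommutativeRing.Carrier S}
  {κ : CommutativeRing.Carrier R → CommutativeRing.Carrier T}
  {φ : CommutativeRing.Carrier S → CommutativeRing.Carrier T} (φ-hom : Homomorphism S T φ)
  where
  private
    module S = CommutativeRing S
    module T = CommutativeRing T
    module φ = IsRingHomomorphism φ-hom

  evaluate-homo : (∀ a → φ (ι a) T.≈ κ a) → ∀ {x y} → φ x T.≈ y →
    ∀ f → φ (evaluate R S ι f x) T.≈ evaluate R T κ f y
  evaluate-homo φι≈κ φx≈y []      = φ.0#-homo
  evaluate-homo φι≈κ φx≈y (a ∷ f) = T.trans (φ.+-homo _ _)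
    (T.+-cong (φι≈κ a) (T.trans (φ.*-homo _ _)
      (T.*-cong φx≈y (evaluate-homo φι≈κ φx≈y f))))

module _ (D : IntegralDomain c ℓ) where
  private
    module D = IntegralDomain D
    module Q = FractionField D
    module K = Field Q.fractionField
  open NaturalSolver D.commutativeSemiring

  embed-hom : Homomorphism D.commutativeRing K.commutativeRing Q.embed
  embed-hom = homomorphism D.commutativeRing K.commutativeRing
    (λ p → Q.crossMultiply (D.*-congʳ p))
    (λ x y → Q.crossMultiply (solve 2 (λ x y →
      (x :+ y) :* (con 1 :* con 1) := (x :* con 1 :+ y :* con 1) :* con 1) D.refl x y))
    (λ x y → Q.crossMultiply (solve 2 (λ x y →
      (x :* y) :* (con 1 :* con 1) := (x :* y) :* con 1) D.refl x y))
    K.refl K.refl (λ _ → K.refl)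

-- Degrees, roots and convolutions

module Degree (R : CommutativeRing c ℓ) where
  open CommutativeRing R using (Carrier; 0#; 1#)
  private module R = CommutativeRing R
  open Polynomial R
  private module Rₙ = RingNotation R
  private module Pₙ = RingNotation commutativeRing

  infix 4 _HasDegree≤_

  -- Lists may end in zeros, so their length says nothing invariant under `_≈_`. An upper bound,
  -- phrased through vanishing coefficients, is all that the root count needs.
  record _HasDegree≤_ (f : Poly) (n : ℕ) : Set ℓ where
    constructor bounded
    field vanishes : ∀ m → n < m → coeff f m R.≈ 0#
  open _HasDegree≤_ public

  degree-cong : ∀ {f g n} → f ≈ g → f HasDegree≤ n → g HasDegree≤ n
  degree-cong f≈g deg-f = bounded λ m n<m →
    R.trans (R.sym (coeff-≈ f≈g m)) (vanishes deg-f m n<m)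

  degree-mono : ∀ {f n n′} → n ≤ n′ → f HasDegree≤ n → f HasDegree≤ n′
  degree-mono n≤n′ deg-f = bounded λ m n′<m → vanishes deg-f m (ℕₚ.≤-<-trans n≤n′ n′<m)

  degree-[] : ∀ {f n} → f ≈ [] → f HasDegree≤ n
  degree-[] f≈[] = bounded λ m _ → coeff-≈ f≈[] m

  degree-const : ∀ {a n} → const a HasDegree≤ n
  degree-const = bounded λ { (suc m) _ → R.refl }

  degree-+ : ∀ {f g n} → f HasDegree≤ n → g HasDegree≤ n → f + g HasDegree≤ n
  degree-+ {f} {g} deg-f deg-g = bounded λ m n<m → R.trans (coeff-+ f g m)
    (R.trans (R.+-cong (vanishes deg-f m n<m) (vanishes deg-g m n<m)) (R.+-identityˡ 0#))

  -- The recursions are stated as sums without subtraction; this isolates the new term once the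
  -- remaining ones are bounded.
  degree-+⁻¹ : ∀ {f g n} → f + g HasDegree≤ n → g HasDegree≤ n → f HasDegree≤ n
  degree-+⁻¹ {f} {g} deg-f+g deg-g = bounded λ m n<m → R.trans (R.sym (R.+-identityʳ _))
    (R.trans (R.+-congˡ (R.sym (vanishes deg-g m n<m)))
      (R.trans (R.sym (coeff-+ f g m)) (vanishes deg-f+g m n<m)))

  degree-neg : ∀ {f n} → f HasDegree≤ n → - f HasDegree≤ n
  degree-neg {f} deg-f = bounded λ m n<m → R.trans (coeff-neg f m)
    (R.trans (R.-‿cong (vanishes deg-f m n<m)) (RingProperties.-0#≈0# R.ring))

  degree-· : ∀ a {f n} → f HasDegree≤ n → a · f HasDegree≤ n
  degree-· a {f} deg-f = bounded λ m n<m → R.trans (coeff-· a f m)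
    (R.trans (R.*-congˡ (vanishes deg-f m n<m)) (R.zeroʳ a))

  degree-0∷ : ∀ {f n} → f HasDegree≤ n → 0# ∷ f HasDegree≤ suc n
  degree-0∷ deg-f = bounded λ { (suc m) (s≤s n<m) → vanishes deg-f m n<m }

  degree-X : X HasDegree≤ 1
  degree-X = degree-0∷ degree-const

  degree-∷⁻¹ : ∀ {a f n} → a ∷ f HasDegree≤ suc n → f HasDegree≤ n
  degree-∷⁻¹ deg = bounded λ m n<m → vanishes deg (suc m) (s≤s n<m)

  degree-∷-0⁻¹ : ∀ {a f} → a ∷ f HasDegree≤ 0 → f ≈ []
  degree-∷-0⁻¹ deg = coeffwise λ m → vanishes deg (suc m) (s≤s z≤n)

  degree-* : ∀ {f g n n′} → f HasDegree≤ n → g HasDegree≤ n′ → f * g HasDegree≤ n ℕ.+ n′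
  degree-* {[]}                deg-f deg-g = degree-[] ≈-refl
  -- Here the tail of the first factor is zero; the general case would lose one degree to the shift
  -- by `0# ∷_`.
  degree-* {a ∷ f} {g} {zero}  deg-f deg-g = degree-+ (degree-· a deg-g)
    (degree-[] (≈-trans (∷-cong R.refl (*-cong (degree-∷-0⁻¹ deg-f) (≈-refl {g}))) 0∷[]≈[]))
  degree-* {a ∷ f} {g} {suc n} deg-f deg-g = degree-+
    (degree-mono (ℕₚ.m≤n+m _ (suc n)) (degree-· a deg-g))
    (degree-0∷ (degree-* (degree-∷⁻¹ deg-f) deg-g))

  degree-^ : ∀ {f} → f HasDegree≤ 1 → ∀ e → f Pₙ.^ e HasDegree≤ e
  degree-^ deg-f zero    = degree-const
  degree-^ deg-f (suc e) = degree-* deg-f (degree-^ deg-f e)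

  degree-∏ : ∀ n f e → (∀ i → i < n → f i HasDegree≤ e i) →
    Fold.fold (CommutativeRing.*-commutativeMonoid commutativeRing) n f
      HasDegree≤ Fold.fold ℕₚ.+-0-commutativeMonoid n e
  degree-∏ zero    f e deg = degree-const
  degree-∏ (suc n) f e deg = degree-* (deg 0 (s≤s z≤n))
    (degree-∏ n (λ i → f (suc i)) (λ i → e (suc i)) (λ i i<n → deg (suc i) (s≤s i<n)))

  open Evaluation R commutativeRing (const-hom R) using (eval; eval-cong)

  degree-eval : ∀ {g} → g HasDegree≤ 1 → ∀ {f n} → f HasDegree≤ n → eval g f HasDegree≤ n
  degree-eval         deg-g {[]}            deg-f = degree-[] ≈-refl
  degree-eval {g = g} deg-g {a ∷ f} {zero}  deg-f = degree-+ degree-const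
    (degree-[] (≈-trans (*-congˡ g (eval-cong g (degree-∷-0⁻¹ deg-f))) (*-zeroʳ g)))
  degree-eval         deg-g {a ∷ f} {suc n} deg-f = degree-+ degree-const
    (degree-* deg-g (degree-eval deg-g (degree-∷⁻¹ deg-f)))

module Roots (D : IntegralDomain c ℓ) where
  open IntegralDomain D
  private
    module P = Polynomial commutativeRing
    module Pₙ = RingNotation P.commutativeRing
    module Dₙ = RingNotation commutativeRing
  open Degree commutativeRing
  open SetoidReasoning setoid
  module _ (a : Carrier) where
    open Evaluation commutativeRing commutativeRing (id-hom commutativeRing) a public
      using () renaming (eval to infixl 8 _at)

  -- A recursion of the type (m+1) c_{m+1} = ... bounds only a multiple of the new coefficient; this
  -- divides by the integer, which is nonzero in the domain.
  degree-fromℕ* : ∀ k {f n} → ¬ Dₙ.fromℕ k ≈ 0# →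
    Pₙ.fromℕ k P.* f HasDegree≤ n → f HasDegree≤ n
  degree-fromℕ* k {f} {n} k≉0 deg = bounded fₘ≈0
    where
    open HomomorphismProperties commutativeRing P.commutativeRing (const-hom commutativeRing)
    fₘ≈0 : ∀ m → n < m → P.coeff f m ≈ 0#
    fₘ≈0 m n<m with noZeroDivisors (begin
      Dₙ.fromℕ k * P.coeff f m            ≈⟨ P.coeff-· (Dₙ.fromℕ k) f m ⟨
      P.coeff (Dₙ.fromℕ k P.· f) m        ≈⟨ P.coeff-≈ (const-* commutativeRing (Dₙ.fromℕ k) f) m ⟨
      P.coeff (P.const (Dₙ.fromℕ k) P.* f) m
        ≈⟨ P.coeff-≈ (P.*-cong (fromℕ-homo k) (P.≈-refl {f})) m ⟩
      P.coeff (Pₙ.fromℕ k P.* f) m        ≈⟨ vanishes deg m n<m ⟩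
      0#                                  ∎)
    ... | inj₁ k≈0  = ⊥-elim (k≉0 k≈0)
    ... | inj₂ fₘ≈0 = fₘ≈0

  -- Synthetic division by X - a: the coefficients of the quotient are the intermediate values of
  -- Horner's scheme. The last entry is the value of the empty list, hence 0, so the degree drops
  -- although the length does not.
  quotient : P.Poly → Carrier → P.Poly
  quotient []      a = []
  quotient (x ∷ f) a = (a at) f ∷ quotient f a

  -- f(x) − f(a) = (x − a) q(x), with both sides moved so that no subtraction occurs.
  quotient-spec : ∀ f a x →
    (x at) f + a * (x at) (quotient f a) ≈ (a at) f + x * (x at) (quotient f a)
  quotient-spec []      a x = trans (+-congˡ (zeroʳ a)) (+-congˡ (sym (zeroʳ x)))
  quotient-spec (y ∷ f) a x = begin
    (y + x * fx) + a * (fa + x * q)   ≈⟨ solve 6 (λ y x fx a fa q →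
      (y :+ x :* fx) :+ a :* (fa :+ x :* q) := (y :+ a :* fa) :+ x :* (fx :+ a :* q)) refl y x fx a fa q ⟩
    (y + a * fa) + x * (fx + a * q)   ≈⟨ +-congˡ (*-congˡ (quotient-spec f a x)) ⟩
    (y + a * fa) + x * (fa + x * q)   ∎
    where
    open NaturalSolver commutativeSemiring
    fx = (x at) f
    fa = (a at) f
    q  = (x at) (quotient f a)

  private
    -- A strict degree bound. Unlike `_HasDegree≤_` it can express at `n` = 0 that the polynomial is
    -- zero, which is where the induction over the roots starts.
    Below : ℕ → P.Poly → Set _
    Below n f = ∀ m → n ≤ m → P.coeff f m ≈ 0#

    quotient-below : ∀ f a n → Below (suc n) f → Below n (quotient f a)
    quotient-below []      a n below m       n≤m = refl
    quotient-below (y ∷ f) a n below zero    n≤m =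
      -- In this case `n` is 0, so the tail `f` vanishes identically and so does its value at `a`.
      Evaluation.eval-cong commutativeRing commutativeRing (id-hom commutativeRing) a {f} {[]}
        (P.coeffwise λ k → below (suc k) (s≤s (ℕₚ.≤-trans n≤m z≤n)))
    quotient-below (y ∷ f) a n below (suc m) n≤m = quotient-below f a m
      (λ k m<k → below (suc k) (s≤s (ℕₚ.≤-trans n≤m m<k))) m ℕₚ.≤-refl

    quotient≈[] : ∀ f a → quotient f a P.≈ [] → f P.≈ P.const ((a at) f)
    quotient≈[] []      a q≈[] = P.≈-sym P.0∷[]≈[]
    quotient≈[] (y ∷ f) a q≈[] = P.∷-cong
      (sym (trans (+-congˡ (trans (*-congˡ (P.coeff-≈ q≈[] 0)) (zeroʳ a))) (+-identityʳ y)))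
      (P.≈-trans (quotient≈[] f a (P.∷≈[]⁻¹ q≈[]))
        (P.≈-trans (P.∷-cong (P.coeff-≈ q≈[] 0) P.≈-refl) P.0∷[]≈[]))

    -- Dividing by X - a for the last root a leaves a quotient that still vanishes at all the other
    -- points. By induction it is zero, so the polynomial is the constant f(a) = 0.
    roots-below : ∀ n f (xs : ℕ → Carrier) → Below n f →
      (∀ i j → i < j → j < n → ¬ xs i ≈ xs j) →
      (∀ i → i < n → (xs i at) f ≈ 0#) → f P.≈ []
    roots-below zero    f xs below distinct root = P.coeffwise λ m → below m z≤n
    roots-below (suc n) f xs below distinct root = P.≈-trans (quotient≈[] f a
        (roots-below n q xs (quotient-below f a n below)
          (λ i j i<j j<n → distinct i j i<j (ℕₚ.m≤n⇒m≤1+n j<n)) q-root))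
      (P.≈-trans (P.∷-cong (root n ℕₚ.≤-refl) P.≈-refl) P.0∷[]≈[])
      where
      a = xs n
      q = quotient f a
      q-root : ∀ i → i < n → (xs i at) q ≈ 0#
      q-root i i<n with ((xs i at) q) ≟ 0#
      ... | yes q≈0 = q≈0
      -- Both values of f in `quotient-spec` are 0, which leaves a q = xᵢ q at xᵢ. If q were nonzero
      -- there, cancelling it would identify the two points.
      ... | no  q≉0 = ⊥-elim (distinct i n i<n ℕₚ.≤-refl (sym (*-cancelʳ q≉0 (begin
        a * (xs i at) q                     ≈⟨ +-identityˡ _ ⟨
        0# + a * (xs i at) q                ≈⟨ +-congʳ (root i (ℕₚ.m≤n⇒m≤1+n i<n)) ⟨
        (xs i at) f + a * (xs i at) q       ≈⟨ quotient-spec f a (xs i) ⟩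
        (a at) f + xs i * (xs i at) q       ≈⟨ +-congʳ (root n ℕₚ.≤-refl) ⟩
        0# + xs i * (xs i at) q             ≈⟨ +-identityˡ _ ⟩
        xs i * (xs i at) q                  ∎))))

  roots : ∀ n f (xs : ℕ → Carrier) → f HasDegree≤ n →
    (∀ i j → i < j → j < suc n → ¬ xs i ≈ xs j) →
    (∀ i → i < suc n → (xs i at) f ≈ 0#) → f P.≈ []
  roots n f xs deg-f = roots-below (suc n) f xs (vanishes deg-f)

module Convolution (R : CommutativeRing c ℓ) where
  open CommutativeRing R
  open RingNotation R using (fromℕ; _^_)
  open Fold +-commutativeMonoid
  open SetoidReasoning setoid
  open NaturalSolver commutativeSemiring

  fold-*ˡ : ∀ n x f → fold n (λ i → x * f i) ≈ x * fold n f
  fold-*ˡ zero    x f = sym (zeroʳ x)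
  fold-*ˡ (suc n) x f =
    trans (+-congˡ (fold-*ˡ n x (λ i → f (suc i)))) (sym (distribˡ _ _ _))

  -- The coefficient of zⁿ in the product of the two generating functions, with the falling index on
  -- the first factor as in the definition of b_{r,s}.
  conv : (ℕ → Carrier) → (ℕ → Carrier) → ℕ → Carrier
  conv A B n = fold (suc n) (λ k → A (n ∸ k) * B k)

  -- If A = (C(x,i))ᵢ and B = (τʲ C(y,j))ⱼ, then A and B satisfy these hypotheses
  -- and the recursion below expresses (1+z)(1+τz) F' = (x(1+τz) + τy(1+z)) F for the
  -- generating function F = (1+z)ˣ(1+τz)ʸ of conv A B.
  module Recursion (A B : ℕ → Carrier) (x y τ : Carrier) (N : ℕ)
    (A-rec : ∀ i → i < N → fromℕ (suc i) * A (suc i) + fromℕ i * A i ≈ x * A i)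
    (B-rec : ∀ j → j < N → fromℕ (suc j) * B (suc j) + τ * (fromℕ j * B j) ≈ τ * (y * B j))
    where

    -- The coefficients of A · zB′. Eliminating them would give a recursion for `conv A B` of second
    -- order; keeping them gives a system of first order, in which degrees are easy to follow.
    convʳ : ℕ → Carrier
    convʳ = conv A (λ j → fromℕ j * B j)

    private
      convˡ : ℕ → Carrier
      convˡ = conv (λ i → fromℕ i * A i) B

      -- The Leibniz rule for the derivation z d/dz, which multiplies the coefficient of zⁿ by n.
      weights : ∀ n → convˡ n + convʳ n ≈ fromℕ n * conv A B n
      weights n = begin
        convˡ n + convʳ n
          ≈⟨ fold-∙ (suc n) (λ k → (fromℕ (n ∸ k) * A (n ∸ k)) * B k) (λ k → A (n ∸ k) * (fromℕ k * B k)) ⟨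
        fold (suc n) (λ k → (fromℕ (n ∸ k) * A (n ∸ k)) * B k + A (n ∸ k) * (fromℕ k * B k))
          ≈⟨ fold-cong (suc n) _ (λ k → fromℕ n * (A (n ∸ k) * B k)) (λ { k (s≤s k≤n) → pointwise k k≤n }) ⟩
        fold (suc n) (λ k → fromℕ n * (A (n ∸ k) * B k))
          ≈⟨ fold-*ˡ (suc n) (fromℕ n) (λ k → A (n ∸ k) * B k) ⟩
        fromℕ n * conv A B n ∎
        where
        pointwise : ∀ k → k ≤ n →
          (fromℕ (n ∸ k) * A (n ∸ k)) * B k + A (n ∸ k) * (fromℕ k * B k) ≈ fromℕ n * (A (n ∸ k) * B k)
        pointwise k k≤n = begin
          (fromℕ (n ∸ k) * A (n ∸ k)) * B k + A (n ∸ k) * (fromℕ k * B k)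
            ≈⟨ solve 4 (λ u v a b → (u :* a) :* b :+ a :* (v :* b) := (u :+ v) :* (a :* b)) refl
                 (fromℕ (n ∸ k)) (fromℕ k) (A (n ∸ k)) (B k) ⟩
          (fromℕ (n ∸ k) + fromℕ k) * (A (n ∸ k) * B k)
            ≈⟨ *-congʳ (SemiringMult.×-homo-+ semiring 1# (n ∸ k) k) ⟨
          fromℕ (n ∸ k ℕ.+ k) * (A (n ∸ k) * B k)
            ≡⟨ ≡.cong (λ m → fromℕ m * (A (n ∸ k) * B k)) (ℕₚ.m∸n+n≡m k≤n) ⟩
          fromℕ n * (A (n ∸ k) * B k) ∎

      -- The equation (1+z) A′ = x A, multiplied by B and compared at zⁿ.
      convˡ-rec : ∀ n → n < N → convˡ (suc n) + convˡ n ≈ x * conv A B n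
      convˡ-rec n n<N = begin
        convˡ (suc n) + convˡ n
          ≈⟨ +-congʳ (fold-last (suc n) (λ k → (fromℕ (suc n ∸ k) * A (suc n ∸ k)) * B k)) ⟩
        (fold (suc n) (λ k → (fromℕ (suc n ∸ k) * A (suc n ∸ k)) * B k)
          + (fromℕ (n ∸ n) * A (n ∸ n)) * B (suc n)) + convˡ n
          -- `convˡ (suc n)` has one summand more than `convˡ n`; its weight is `n ∸ n`, so it drops
          -- out and the sums can be added termwise.
          ≈⟨ +-congʳ (+-congˡ (trans (*-congʳ (trans (*-congʳ (reflexive (≡.cong fromℕ (ℕₚ.n∸n≡0 n)))) (zeroˡ _))) (zeroˡ _))) ⟩
        (fold (suc n) (λ k → (fromℕ (suc n ∸ k) * A (suc n ∸ k)) * B k) + 0#) + convˡ n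
          ≈⟨ +-congʳ (+-identityʳ _) ⟩
        fold (suc n) (λ k → (fromℕ (suc n ∸ k) * A (suc n ∸ k)) * B k) + convˡ n
          ≈⟨ fold-∙ (suc n) (λ k → (fromℕ (suc n ∸ k) * A (suc n ∸ k)) * B k)
               (λ k → (fromℕ (n ∸ k) * A (n ∸ k)) * B k) ⟨
        fold (suc n) (λ k → (fromℕ (suc n ∸ k) * A (suc n ∸ k)) * B k + (fromℕ (n ∸ k) * A (n ∸ k)) * B k)
          ≈⟨ fold-cong (suc n) _ (λ k → x * (A (n ∸ k) * B k)) (λ { k (s≤s k≤n) → pointwise k k≤n }) ⟩
        fold (suc n) (λ k → x * (A (n ∸ k) * B k))
          ≈⟨ fold-*ˡ (suc n) x (λ k → A (n ∸ k) * B k) ⟩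
        x * conv A B n ∎
        where
        pointwise : ∀ k → k ≤ n →
          (fromℕ (suc n ∸ k) * A (suc n ∸ k)) * B k + (fromℕ (n ∸ k) * A (n ∸ k)) * B k ≈ x * (A (n ∸ k) * B k)
        pointwise k k≤n = begin
          (fromℕ (suc n ∸ k) * A (suc n ∸ k)) * B k + (fromℕ (n ∸ k) * A (n ∸ k)) * B k
            ≈⟨ distribʳ _ _ _ ⟨
          (fromℕ (suc n ∸ k) * A (suc n ∸ k) + fromℕ (n ∸ k) * A (n ∸ k)) * B k
            ≡⟨ ≡.cong (λ m → (fromℕ m * A m + fromℕ (n ∸ k) * A (n ∸ k)) * B k) (ℕₚ.+-∸-assoc 1 k≤n) ⟩
          (fromℕ (suc (n ∸ k)) * A (suc (n ∸ k)) + fromℕ (n ∸ k) * A (n ∸ k)) * B k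
            ≈⟨ *-congʳ (A-rec (n ∸ k) (ℕₚ.≤-<-trans (ℕₚ.m∸n≤m n k) n<N)) ⟩
          (x * A (n ∸ k)) * B k
            ≈⟨ *-assoc _ _ _ ⟩
          x * (A (n ∸ k) * B k) ∎

    convʳ-0 : convʳ 0 ≈ 0#
    convʳ-0 = solve 2 (λ a b → a :* (con 0 :* b) :+ con 0 := con 0) refl (A 0) (B 0)

    -- The equation (1+τz) B′ = τ y B, multiplied by A and compared at zⁿ.
    convʳ-rec : ∀ n → n < N → convʳ (suc n) + τ * convʳ n ≈ τ * (y * conv A B n)
    convʳ-rec n n<N = begin
      convʳ (suc n) + τ * convʳ n
        -- This time it is the first summand that has weight 0; without it the sum is shifted by one
        -- and matches the other in length.
        ≈⟨ +-cong (trans (+-congʳ (trans (*-congˡ (zeroˡ _)) (zeroʳ _))) (+-identityˡ _))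
                  (sym (fold-*ˡ (suc n) τ (λ k → A (n ∸ k) * (fromℕ k * B k)))) ⟩
      fold (suc n) (λ k → A (n ∸ k) * (fromℕ (suc k) * B (suc k)))
        + fold (suc n) (λ k → τ * (A (n ∸ k) * (fromℕ k * B k)))
        ≈⟨ fold-∙ (suc n) (λ k → A (n ∸ k) * (fromℕ (suc k) * B (suc k))) (λ k → τ * (A (n ∸ k) * (fromℕ k * B k))) ⟨
      fold (suc n) (λ k → A (n ∸ k) * (fromℕ (suc k) * B (suc k)) + τ * (A (n ∸ k) * (fromℕ k * B k)))
        ≈⟨ fold-cong (suc n) _ (λ k → τ * (y * (A (n ∸ k) * B k))) (λ { k (s≤s k≤n) → pointwise k k≤n }) ⟩
      fold (suc n) (λ k → τ * (y * (A (n ∸ k) * B k)))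
        ≈⟨ trans (fold-*ˡ (suc n) τ (λ k → y * (A (n ∸ k) * B k)))
                 (*-congˡ (fold-*ˡ (suc n) y (λ k → A (n ∸ k) * B k))) ⟩
      τ * (y * conv A B n) ∎
      where
      pointwise : ∀ k → k ≤ n →
        A (n ∸ k) * (fromℕ (suc k) * B (suc k)) + τ * (A (n ∸ k) * (fromℕ k * B k)) ≈ τ * (y * (A (n ∸ k) * B k))
      pointwise k k≤n = begin
        a * w + τ * (a * v)                ≈⟨ solve 4 (λ a w τ v → a :* w :+ τ :* (a :* v) := a :* (w :+ τ :* v)) refl a w τ v ⟩
        a * (w + τ * v)                    ≈⟨ *-congˡ (B-rec k (ℕₚ.≤-<-trans k≤n n<N)) ⟩
        a * (τ * (y * B k))                ≈⟨ solve 4 (λ a τ y b → a :* (τ :* (y :* b)) := τ :* (y :* (a :* b))) refl a τ y (B k) ⟩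
        τ * (y * (a * B k))                ∎
        where
        a = A (n ∸ k)
        w = fromℕ (suc k) * B (suc k)
        v = fromℕ k * B k

    conv-rec : ∀ n → n < N →
      fromℕ (suc n) * conv A B (suc n) + (fromℕ n * conv A B n + τ * convʳ n)
        ≈ (x + τ * y) * conv A B n + convʳ n
    conv-rec n n<N = begin
      fromℕ (suc n) * conv A B (suc n) + (fromℕ n * conv A B n + τ * convʳ n)
        ≈⟨ +-cong (sym (weights (suc n))) (+-congʳ (sym (weights n))) ⟩
      (convˡ (suc n) + convʳ (suc n)) + ((convˡ n + convʳ n) + τ * convʳ n)
        ≈⟨ solve 5 (λ l′ r′ l r τr → (l′ :+ r′) :+ ((l :+ r) :+ τr) := (l′ :+ l) :+ (r′ :+ τr) :+ r) refl
             (convˡ (suc n)) (convʳ (suc n)) (convˡ n) (convʳ n) (τ * convʳ n) ⟩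
      (convˡ (suc n) + convˡ n) + (convʳ (suc n) + τ * convʳ n) + convʳ n
        ≈⟨ +-congʳ (+-cong (convˡ-rec n n<N) (convʳ-rec n n<N)) ⟩
      x * conv A B n + τ * (y * conv A B n) + convʳ n
        ≈⟨ +-congʳ (+-congˡ (sym (*-assoc _ _ _))) ⟩
      x * conv A B n + (τ * y) * conv A B n + convʳ n
        ≈⟨ +-congʳ (distribʳ _ _ _) ⟨
      (x + τ * y) * conv A B n + convʳ n ∎

  -- (ρ − σ) Σ ρⁿ⁻ᵏ σᵏ = ρⁿ⁺¹ − σⁿ⁺¹, with both sides moved so that no subtraction occurs.
  geometric-conv : ∀ ρ σ n → ρ * conv (ρ ^_) (σ ^_) n + σ ^ suc n ≈ σ * conv (ρ ^_) (σ ^_) n + ρ ^ suc n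
  geometric-conv ρ σ zero    =
    solve 2 (λ ρ σ → ρ :* (con 1 :* con 1 :+ con 0) :+ σ :* con 1
                  := σ :* (con 1 :* con 1 :+ con 0) :+ ρ :* con 1) refl ρ σ
  geometric-conv ρ σ (suc n) = begin
    ρ * C (suc n) + σ * σ ^ suc n                     ≈⟨ +-congʳ (*-congˡ C-suc) ⟩
    ρ * (ρ ^ suc n + σ * C n) + σ * σ ^ suc n
      ≈⟨ solve 5 (λ ρ σ c r s → ρ :* (r :+ σ :* c) :+ σ :* s := σ :* (ρ :* c :+ s) :+ ρ :* r) refl
           ρ σ (C n) (ρ ^ suc n) (σ ^ suc n) ⟩
    σ * (ρ * C n + σ ^ suc n) + ρ * ρ ^ suc n         ≈⟨ +-congʳ (*-congˡ (geometric-conv ρ σ n)) ⟩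
    σ * (σ * C n + ρ ^ suc n) + ρ * ρ ^ suc n         ≈⟨ +-congʳ (*-congˡ (trans (+-comm _ _) (sym C-suc))) ⟩
    σ * C (suc n) + ρ * ρ ^ suc n                     ∎
    where
    C : ℕ → Carrier
    C = conv (ρ ^_) (σ ^_)
    C-suc : C (suc n) ≈ ρ ^ suc n + σ * C n
    C-suc = +-cong (*-identityʳ _) (begin
      fold (suc n) (λ k → ρ ^ (n ∸ k) * (σ * σ ^ k))
        ≈⟨ fold-cong (suc n) _ (λ k → σ * (ρ ^ (n ∸ k) * σ ^ k)) (λ k _ →
             solve 3 (λ r σ s → r :* (σ :* s) := σ :* (r :* s)) refl (ρ ^ (n ∸ k)) σ (σ ^ k)) ⟩
      fold (suc n) (λ k → σ * (ρ ^ (n ∸ k) * σ ^ k))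
        ≈⟨ fold-*ˡ (suc n) σ (λ k → ρ ^ (n ∸ k) * σ ^ k) ⟩
      σ * C n ∎)

-- Floors of multiples modulo a prime

∑-1 : ∀ n → Fold.fold ℕₚ.+-0-commutativeMonoid n (λ _ → 1) ≡ n
∑-1 zero    = ≡.refl
∑-1 (suc n) = ≡.cong suc (∑-1 n)

[r+qd]/d≡q : ∀ {r d} .{{_ : NonZero d}} q → r < d → (r ℕ.+ q ℕ.* d) / d ≡ q
[r+qd]/d≡q {r} {d} q r<d = ≡.trans (+-distrib-/-∣ʳ r (divides q ≡.refl))
  (≡.cong₂ ℕ._+_ (m<n⇒m/n≡0 r<d) (m*n/n≡m q d))

/-+ : ∀ x y d .{{_ : NonZero d}} →
  (x % d ℕ.+ y % d < d × (x ℕ.+ y) / d ≡ x / d ℕ.+ y / d)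
  ⊎ (d ≤ x % d ℕ.+ y % d × (x ℕ.+ y) / d ≡ suc (x / d ℕ.+ y / d))
/-+ x y d with (x % d ℕ.+ y % d) ℕₚ.<? d
... | yes small = inj₁ (small , +-distrib-/ x y small)
... | no  large = inj₂ (d≤r+s , (begin
  (x ℕ.+ y) / d
    ≡⟨ ≡.cong (_/ d) (≡.cong₂ ℕ._+_ (m≡m%n+[m/n]*n x d) (m≡m%n+[m/n]*n y d)) ⟩
  (x % d ℕ.+ x / d ℕ.* d ℕ.+ (y % d ℕ.+ y / d ℕ.* d)) / d
    ≡⟨ ≡.cong (_/ d) (solve 5 (λ r q s t d → r :+ q :* d :+ (s :+ t :* d) := r :+ s :+ (q :+ t) :* d) ≡.refl
         (x % d) (x / d) (y % d) (y / d) d) ⟩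
  (x % d ℕ.+ y % d ℕ.+ (x / d ℕ.+ y / d) ℕ.* d) / d
    ≡⟨ ≡.cong (λ m → (m ℕ.+ (x / d ℕ.+ y / d) ℕ.* d) / d) (ℕₚ.m∸n+n≡m d≤r+s) ⟨
  (x % d ℕ.+ y % d ∸ d ℕ.+ d ℕ.+ (x / d ℕ.+ y / d) ℕ.* d) / d
    ≡⟨ ≡.cong (_/ d) (ℕₚ.+-assoc (x % d ℕ.+ y % d ∸ d) d _) ⟩
  (x % d ℕ.+ y % d ∸ d ℕ.+ suc (x / d ℕ.+ y / d) ℕ.* d) / d
    ≡⟨ [r+qd]/d≡q (suc (x / d ℕ.+ y / d))
         (ℕₚ.+-cancelʳ-< d _ _ (≡.subst (_< d ℕ.+ d) (≡.sym (ℕₚ.m∸n+n≡m d≤r+s))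
           (ℕₚ.+-mono-< (m%n<n x d) (m%n<n y d)))) ⟩
  suc (x / d ℕ.+ y / d) ∎))
  where
  open ≡.≡-Reasoning
  open +-*-Solver
  d≤r+s = ℕₚ.≮⇒≥ large

module Floor (n : ℕ) (p-prime : Prime (suc n)) where
  p : ℕ
  p = suc n

  ⌊_*_/p⌋ : ℕ → ℕ → ℕ
  ⌊ s * k /p⌋ = s ℕ.* k / p

  p∤small : ∀ {m} → 0 < m → m < p → p ∤ m
  p∤small {suc m} _ m<p p∣m = ℕₚ.<⇒≱ m<p (∣⇒≤ p∣m)

  p∤s*k : ∀ {s k} → 0 < s → s < p → 0 < k → k < p → p ∤ s ℕ.* k
  p∤s*k {s} {k} 0<s s<p 0<k k<p p∣sk with euclidsLemma s k p-prime p∣sk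
  ... | inj₁ p∣s = p∤small 0<s s<p p∣s
  ... | inj₂ p∣k = p∤small 0<k k<p p∣k

  0<[s*k]%p : ∀ {s k} → 0 < s → s < p → 0 < k → k < p → 0 < s ℕ.* k % p
  0<[s*k]%p {s} {k} 0<s s<p 0<k k<p with s ℕ.* k % p in eq
  ... | suc _ = s≤s z≤n
  ... | zero  = ⊥-elim (p∤s*k 0<s s<p 0<k k<p (divides (s ℕ.* k / p)
    (≡.trans (m≡m%n+[m/n]*n (s ℕ.* k) p) (≡.cong (ℕ._+ s ℕ.* k / p ℕ.* p) eq))))

  ⌊⌋-comm : ∀ s k → ⌊ s * k /p⌋ ≡ ⌊ k * s /p⌋
  ⌊⌋-comm s k = ≡.cong (_/ p) (ℕₚ.*-comm s k)

  sk+[p-s]k≡kp : ∀ {s} k → s < p → s ℕ.* k ℕ.+ (p ∸ s) ℕ.* k ≡ k ℕ.* p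
  sk+[p-s]k≡kp {s} k s<p = ≡.trans (≡.sym (ℕₚ.*-distribʳ-+ k s (p ∸ s)))
    (≡.trans (≡.cong (ℕ._* k) (ℕₚ.m+[n∸m]≡n (ℕₚ.<⇒≤ s<p))) (ℕₚ.*-comm p k))

  -- The products sk and (p-s)k add up to kp. Since p does not divide sk, the residues cannot both
  -- be 0, so their sum overflows exactly once.
  ⌊⌋-reflectˡ : ∀ {s k} → 0 < s → s < p → 0 < k → k < p →
    suc (⌊ s * k /p⌋ ℕ.+ ⌊ p ∸ s * k /p⌋) ≡ k
  ⌊⌋-reflectˡ {s} {k} 0<s s<p 0<k k<p with /-+ (s ℕ.* k) ((p ∸ s) ℕ.* k) p
  ... | inj₂ (_ , eq) = ≡.trans (≡.sym eq) (≡.trans (≡.cong (_/ p) (sk+[p-s]k≡kp k s<p)) (m*n/n≡m k p))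
  ... | inj₁ (_ , eq) = ⊥-elim (ℕₚ.<⇒≢ (0<[s*k]%p 0<s s<p 0<k k<p)
      (≡.sym (ℕₚ.m+n≡0⇒m≡0 r (ℕₚ.+-cancelʳ-≡ ((q ℕ.+ q′) ℕ.* p) (r ℕ.+ r′) 0 (begin
        r ℕ.+ r′ ℕ.+ (q ℕ.+ q′) ℕ.* p
          ≡⟨ solve 5 (λ r r′ q q′ p → r :+ r′ :+ (q :+ q′) :* p := r :+ q :* p :+ (r′ :+ q′ :* p))
               ≡.refl r r′ q q′ p ⟩
        r ℕ.+ q ℕ.* p ℕ.+ (r′ ℕ.+ q′ ℕ.* p)
          ≡⟨ ≡.cong₂ ℕ._+_ (m≡m%n+[m/n]*n (s ℕ.* k) p) (m≡m%n+[m/n]*n ((p ∸ s) ℕ.* k) p) ⟨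
        s ℕ.* k ℕ.+ (p ∸ s) ℕ.* k
          ≡⟨ sk+[p-s]k≡kp k s<p ⟩
        k ℕ.* p
          ≡⟨ ≡.cong (ℕ._* p) (≡.trans (≡.sym (m*n/n≡m k p)) (≡.trans (≡.cong (_/ p) (≡.sym (sk+[p-s]k≡kp k s<p))) eq)) ⟩
        (q ℕ.+ q′) ℕ.* p ∎)))))
    where
    open ≡.≡-Reasoning
    open +-*-Solver
    q = s ℕ.* k / p
    q′ = (p ∸ s) ℕ.* k / p
    r = s ℕ.* k % p
    r′ = (p ∸ s) ℕ.* k % p

  ⌊⌋-reflectʳ : ∀ {s k} → 0 < s → s < p → 0 < k → k < p →
    suc (⌊ s * k /p⌋ ℕ.+ ⌊ s * p ∸ k /p⌋) ≡ s
  ⌊⌋-reflectʳ {s} {k} 0<s s<p 0<k k<p = ≡.trans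
    (≡.cong suc (≡.cong₂ ℕ._+_ (⌊⌋-comm s k) (⌊⌋-comm s (p ∸ k))))
    (⌊⌋-reflectˡ 0<k k<p 0<s s<p)

  -- The overflow when k is added to sk mod p, and the future exponent of λ_k in b_{1,s}. The
  -- truncated subtraction is exact because the floor is monotone; see `⌊⌋-step`.
  carry : ℕ → ℕ → ℕ
  carry s k = ⌊ suc s * k /p⌋ ∸ ⌊ s * k /p⌋

  ⌊⌋-step : ∀ {s k} → ⌊ s * k /p⌋ ℕ.+ carry s k ≡ ⌊ suc s * k /p⌋
  ⌊⌋-step {s} {k} = ℕₚ.m+[n∸m]≡n (/-monoˡ-≤ p (ℕₚ.m≤n+m (s ℕ.* k) k))

  no-carry : ∀ {s k} → k < p → carry s k ≡ 0 → k ℕ.+ s ℕ.* k % p < p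
  no-carry {s} {k} k<p carry≡0 with /-+ k (s ℕ.* k) p
  ... | inj₁ (small , _) = ≡.subst (λ m → m ℕ.+ s ℕ.* k % p < p) (m<n⇒m%n≡m k<p) small
  ... | inj₂ (_ , eq) = ⊥-elim (ℕₚ.m≢1+m+n _ (begin
    ⌊ s * k /p⌋                                 ≡⟨ ℕₚ.+-identityʳ _ ⟨
    ⌊ s * k /p⌋ ℕ.+ 0                           ≡⟨ ≡.cong (⌊ s * k /p⌋ ℕ.+_) carry≡0 ⟨
    ⌊ s * k /p⌋ ℕ.+ carry s k                   ≡⟨ ⌊⌋-step {s} {k} ⟩
    ⌊ suc s * k /p⌋                             ≡⟨ eq ⟩
    suc (k / p ℕ.+ ⌊ s * k /p⌋)                 ≡⟨ ≡.cong suc (ℕₚ.+-comm (k / p) _) ⟩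
    suc (⌊ s * k /p⌋ ℕ.+ k / p)                 ∎))
    where open ≡.≡-Reasoning

  -- The difference of `⌊⌋-reflectʳ` at s + 1 and at s. The former needs s + 1 < p, whence `s < n`.
  carry-reflect : ∀ {s k} → 0 < s → s < n → 0 < k → k < p → carry s k ℕ.+ carry s (p ∸ k) ≡ 1
  carry-reflect {s} {k} 0<s s<n 0<k k<p = ℕₚ.+-cancelˡ-≡ (suc (a ℕ.+ b)) (e ℕ.+ e′) 1 (begin
    suc (a ℕ.+ b) ℕ.+ (e ℕ.+ e′)
      ≡⟨ solve 4 (λ a b e e′ → con 1 :+ (a :+ b) :+ (e :+ e′) := con 1 :+ ((a :+ e) :+ (b :+ e′))) ≡.refl a b e e′ ⟩
    suc (a ℕ.+ e ℕ.+ (b ℕ.+ e′))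
      ≡⟨ ≡.cong suc (≡.cong₂ ℕ._+_ (⌊⌋-step {s} {k}) (⌊⌋-step {s} {p ∸ k})) ⟩
    suc (⌊ suc s * k /p⌋ ℕ.+ ⌊ suc s * p ∸ k /p⌋)
      ≡⟨ ⌊⌋-reflectʳ (s≤s z≤n) (s≤s s<n) 0<k k<p ⟩
    suc s
      ≡⟨ ℕₚ.+-comm 1 s ⟩
    s ℕ.+ 1
      ≡⟨ ≡.cong (ℕ._+ 1) (⌊⌋-reflectʳ 0<s (ℕₚ.m≤n⇒m≤1+n s<n) 0<k k<p) ⟨
    suc (a ℕ.+ b) ℕ.+ 1 ∎)
    where
    open ≡.≡-Reasoning
    open +-*-Solver
    a = ⌊ s * k /p⌋
    b = ⌊ s * p ∸ k /p⌋
    e = carry s k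
    e′ = carry s (p ∸ k)

  -- By `⌊⌋-reflectˡ` the floors for s and p - s have the same sum as those for s + 1 and p - 1 - s.
  -- So the step from s to s + 1 equals the step from p - 1 - s to p - s.
  carry-complement : ∀ {s k} → 0 < s → s < n → 0 < k → k < p → carry (n ∸ s) k ≡ carry s k
  carry-complement {s} {k} 0<s s<n 0<k k<p = ℕₚ.+-cancelˡ-≡ (suc (a ℕ.+ b)) e′ e (begin
    suc (a ℕ.+ b) ℕ.+ e′
      ≡⟨ ≡.cong suc (ℕₚ.+-assoc a b e′) ⟩
    suc (a ℕ.+ (b ℕ.+ e′))
      ≡⟨ ≡.cong (λ m → suc (a ℕ.+ m)) (⌊⌋-step {n ∸ s} {k}) ⟩
    suc (a ℕ.+ ⌊ suc (n ∸ s) * k /p⌋)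
      ≡⟨ ≡.cong (λ m → suc (a ℕ.+ ⌊ m * k /p⌋)) (ℕₚ.+-∸-assoc 1 (ℕₚ.<⇒≤ s<n)) ⟨
    suc (a ℕ.+ ⌊ p ∸ s * k /p⌋)
      ≡⟨ ⌊⌋-reflectˡ 0<s (ℕₚ.m≤n⇒m≤1+n s<n) 0<k k<p ⟩
    k
      ≡⟨ ⌊⌋-reflectˡ (s≤s z≤n) (s≤s s<n) 0<k k<p ⟨
    suc (⌊ suc s * k /p⌋ ℕ.+ b)
      ≡⟨ ≡.cong (λ m → suc (m ℕ.+ b)) (⌊⌋-step {s} {k}) ⟨
    suc (a ℕ.+ e ℕ.+ b)
      ≡⟨ solve 3 (λ a b e → con 1 :+ (a :+ e :+ b) := con 1 :+ (a :+ b) :+ e) ≡.refl a b e ⟩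
    suc (a ℕ.+ b) ℕ.+ e ∎)
    where
    open ≡.≡-Reasoning
    open +-*-Solver
    a = ⌊ s * k /p⌋
    b = ⌊ n ∸ s * k /p⌋
    e = carry s k
    e′ = carry (n ∸ s) k

  ⌊1*k⌋ : ∀ {k} → k < p → ⌊ 1 * k /p⌋ ≡ 0
  ⌊1*k⌋ {k} k<p = m<n⇒m/n≡0 (≡.subst (_< p) (≡.sym (ℕₚ.*-identityˡ k)) k<p)

  ⌊n*k⌋ : ∀ {k} → 0 < n → 0 < k → k < p → suc ⌊ n * k /p⌋ ≡ k
  ⌊n*k⌋ {k} 0<n 0<k k<p = begin
    suc ⌊ n * k /p⌋                                  ≡⟨ ≡.cong suc (ℕₚ.+-identityʳ _) ⟨
    suc (⌊ n * k /p⌋ ℕ.+ 0)                          ≡⟨ ≡.cong (λ m → suc (⌊ n * k /p⌋ ℕ.+ m)) (⌊1*k⌋ k<p) ⟨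
    suc (⌊ n * k /p⌋ ℕ.+ ⌊ 1 * k /p⌋)
      ≡⟨ ≡.cong (λ m → suc (⌊ n * k /p⌋ ℕ.+ ⌊ m * k /p⌋)) (ℕₚ.m+n∸n≡m 1 n) ⟨
    suc (⌊ n * k /p⌋ ℕ.+ ⌊ p ∸ n * k /p⌋)            ≡⟨ ⌊⌋-reflectˡ 0<n ℕₚ.≤-refl 0<k k<p ⟩
    k                                                ∎
    where open ≡.≡-Reasoning

  open Fold ℕₚ.+-0-commutativeMonoid

  -- Added to its own reversal the sum pairs k with p - k, and every pair contributes 1 by
  -- `carry-reflect`; so twice the sum is n.
  ∑-carry : ∀ {s} → 0 < s → s < n → fold n (λ i → carry s (suc i)) ≡ ⌊ n /2⌋
  ∑-carry {s} 0<s s<n = begin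
    Σ                    ≡⟨ ℕₚ.n≡⌊n+n/2⌋ Σ ⟩
    ⌊ Σ ℕ.+ Σ /2⌋        ≡⟨ ≡.cong ⌊_/2⌋ (begin
      Σ ℕ.+ Σ
        ≡⟨ ≡.cong (Σ ℕ.+_) (fold-reverse n (λ i → carry s (suc i))) ⟩
      Σ ℕ.+ fold n (λ i → carry s (suc (n ∸ suc i)))
        ≡⟨ fold-∙ n (λ i → carry s (suc i)) (λ i → carry s (suc (n ∸ suc i))) ⟨
      fold n (λ i → carry s (suc i) ℕ.+ carry s (suc (n ∸ suc i)))
        ≡⟨ fold-cong n _ (λ _ → 1) (λ i i<n → ≡.trans
             (≡.cong (λ m → carry s (suc i) ℕ.+ carry s m) (≡.sym (ℕₚ.+-∸-assoc 1 i<n)))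
             (carry-reflect 0<s s<n (s≤s z≤n) (s≤s i<n))) ⟩
      fold n (λ _ → 1)
        ≡⟨ ∑-1 n ⟩
      n ∎) ⟩
    ⌊ n /2⌋              ∎
    where
    open ≡.≡-Reasoning
    Σ = fold n (λ i → carry s (suc i))

-- The Frobenius map

p∤m! : ∀ {p m} → Prime p → m < p → p ∤ m !
p∤m! {p} {zero}  p-prime m<p p∣1 with ≡.refl ← ∣1⇒≡1 p∣1 =
  ℕₚ.<-irrefl ≡.refl (ℕ.nonTrivial⇒n>1 1 {{prime⇒nonTrivial p-prime}})
p∤m! {p} {suc m} p-prime m<p p∣m! with euclidsLemma (suc m) (m !) p-prime p∣m!
... | inj₁ p∣suc-m = ℕₚ.<⇒≱ m<p (∣⇒≤ p∣suc-m)
... | inj₂ p∣m!    = p∤m! p-prime (ℕₚ.<⇒≤ m<p) p∣m!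

-- p divides p! = C(p,k) k! (p-k)!, but neither of the two factorials.
p∣pCk : ∀ {p k} → Prime p → 0 < k → k < p → p ∣ p choose k
p∣pCk {zero}  {k} p-prime 0<k k<p = ⊥-elim (ℕₚ.n≮0 k<p)
p∣pCk {suc n} {k} p-prime 0<k k<p with euclidsLemma (p choose k) (k ! ℕ.* (p ∸ k) !) p-prime
    (≡.subst (p ∣_) (≡.sym pCk*k![p-k]!≡p!) (m∣m*n (n !)))
  where
  p = suc n
  instance _ = k ℕₚ.!* (p ∸ k) !≢0
  pCk*k![p-k]!≡p! : (p choose k) ℕ.* (k ! ℕ.* (p ∸ k) !) ≡ p !
  pCk*k![p-k]!≡p! = ≡.trans (≡.cong (ℕ._* (k ! ℕ.* (p ∸ k) !)) (nCk≡n!/k![n-k]! (ℕₚ.<⇒≤ k<p)))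
    (m/n*n≡m (k![n∸k]!∣n! (ℕₚ.<⇒≤ k<p)))
... | inj₁ p∣pCk = p∣pCk
... | inj₂ p∣k![p-k]! with euclidsLemma (k !) ((suc n ∸ k) !) p-prime p∣k![p-k]!
...   | inj₁ p∣k!     = ⊥-elim (p∤m! p-prime k<p p∣k!)
...   | inj₂ p∣[p-k]! = ⊥-elim (p∤m! p-prime (ℕₚ.∸-monoʳ-< 0<k (ℕₚ.<⇒≤ k<p)) p∣[p-k]!)

module Characteristic (R : CommutativeRing c ℓ) (n : ℕ) (p-prime : Prime (suc n))
  (p≈0 : CommutativeRing._≈_ R (RingNotation.fromℕ R (suc n)) (CommutativeRing.0# R)) where
  open CommutativeRing R
  open RingNotation R using (fromℕ; _^_)
  open RingProperties ring using (+-inverseʳ-unique)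
  open SemiringMult semiring using (×-congˡ; ×-congʳ; ×-assocˡ; ×-assoc-*) renaming (_×_ to infixr 8 _·_)
  open SemiringExp semiring using (^-congˡ; ^-congʳ)
  open MonoidSum +-monoid using (sum; sum-init-last; sum-cong-≋; sum-replicate-zero)
  open SetoidReasoning setoid

  p : ℕ
  p = suc n

  p∣m⇒m·x≈0 : ∀ {m} x → p ∣ m → m · x ≈ 0#
  p∣m⇒m·x≈0 x (divides q ≡.refl) = begin
    (q ℕ.* p) · x       ≈⟨ ×-congˡ (ℕₚ.*-comm q p) ⟩
    (p ℕ.* q) · x       ≈⟨ ×-assocˡ x p q ⟨
    p · (q · x)         ≈⟨ ×-congʳ p (*-identityˡ _) ⟨
    p · (1# * (q · x))  ≈⟨ ×-assoc-* p 1# (q · x) ⟨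
    fromℕ p * (q · x)   ≈⟨ *-congʳ p≈0 ⟩
    0# * (q · x)        ≈⟨ zeroˡ _ ⟩
    0#                  ∎

  ^-distrib-+ : ∀ x y → (x + y) ^ p ≈ x ^ p + y ^ p
  ^-distrib-+ x y = begin
    (x + y) ^ p                                   ≈⟨ theorem p x y ⟩
    term Fin.zero + sum (λ i → term (Fin.suc i))  ≈⟨ +-cong first (sum-init-last (λ i → term (Fin.suc i))) ⟩
    y ^ p + (sum (λ i → term (Fin.suc (Fin.inject₁ i))) + term (Fin.suc (Fin.fromℕ n)))
      ≈⟨ +-congˡ (+-cong middle last) ⟩
    y ^ p + (0# + x ^ p)                          ≈⟨ +-congˡ (+-identityˡ _) ⟩
    y ^ p + x ^ p                                 ≈⟨ +-comm _ _ ⟩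
    x ^ p + y ^ p                                 ∎
    where
    open Binomial commutativeSemiring using (theorem; binomialTerm)
    term : Fin (suc p) → Carrier
    term = binomialTerm x y p
    first : term Fin.zero ≈ y ^ p
    first = begin
      (p choose 0) · (1# * y ^ p)  ≈⟨ ×-congˡ (≡.trans (nCk≡nC[n∸k] {0} {p} z≤n) (nCn≡1 p)) ⟩
      1 · (1# * y ^ p)        ≈⟨ trans (+-identityʳ _) (*-identityˡ _) ⟩
      y ^ p                   ∎
    middle : sum (λ i → term (Fin.suc (Fin.inject₁ i))) ≈ 0#
    middle = trans
      (sum-cong-≋ (λ i → p∣m⇒m·x≈0 _ (p∣pCk p-prime (s≤s z≤n)
        (s≤s (≡.subst (_< n) (≡.sym (Finₚ.toℕ-inject₁ i)) (Finₚ.toℕ<n i))))))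
      (sum-replicate-zero n)
    last : term (Fin.suc (Fin.fromℕ n)) ≈ x ^ p
    last = begin
      (p choose suc (toℕ (Fin.fromℕ n))) · (x ^ suc (toℕ (Fin.fromℕ n)) * y ^ (n ∸ toℕ (Fin.fromℕ n)))
        ≡⟨ ≡.cong (λ m → (p choose suc m) · (x ^ suc m * y ^ (n ∸ m))) (Finₚ.toℕ-fromℕ n) ⟩
      (p choose p) · (x ^ p * y ^ (n ∸ n))   ≈⟨ ×-congˡ (nCn≡1 p) ⟩
      1 · (x ^ p * y ^ (n ∸ n))         ≈⟨ +-identityʳ _ ⟩
      x ^ p * y ^ (n ∸ n)               ≈⟨ *-congˡ (^-congʳ y (ℕₚ.n∸n≡0 n)) ⟩
      x ^ p * 1#                        ≈⟨ *-identityʳ _ ⟩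
      x ^ p                             ∎

  0^p≈0 : 0# ^ p ≈ 0#
  0^p≈0 = zeroˡ _

  1^m≈1 : ∀ m → 1# ^ m ≈ 1#
  1^m≈1 zero    = refl
  1^m≈1 (suc m) = trans (*-identityˡ _) (1^m≈1 m)

  fromℕ^p≈fromℕ : ∀ m → fromℕ m ^ p ≈ fromℕ m
  fromℕ^p≈fromℕ zero    = 0^p≈0
  fromℕ^p≈fromℕ (suc m) =
    trans (^-distrib-+ 1# (fromℕ m)) (+-cong (1^m≈1 p) (fromℕ^p≈fromℕ m))

  -- Additivity of the p-th power, applied to x + (-x) = 0. It serves the negative representatives
  -- in the proof of `fermat`, where elements of 𝔽ₚ are given by integers.
  [-x]^p≈-x : ∀ {x} → x ^ p ≈ x → (- x) ^ p ≈ - x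
  [-x]^p≈-x {x} x^p≈x = +-inverseʳ-unique x ((- x) ^ p) (begin
    x + (- x) ^ p        ≈⟨ +-congʳ x^p≈x ⟨
    x ^ p + (- x) ^ p    ≈⟨ ^-distrib-+ x (- x) ⟨
    (x + - x) ^ p        ≈⟨ ^-congˡ p (-‿inverseʳ x) ⟩
    0# ^ p               ≈⟨ 0^p≈0 ⟩
    0#                   ∎)

  fromℕ-∸ : ∀ {m k} → k ≤ m → fromℕ m ≈ fromℕ (m ∸ k) + fromℕ k
  fromℕ-∸ {m} {k} k≤m = trans (reflexive (≡.cong fromℕ (≡.sym (ℕₚ.m∸n+n≡m k≤m))))
    (SemiringMult.×-homo-+ semiring 1# (m ∸ k) k)

  fromℕ[p-k] : ∀ {k} → k ≤ p → fromℕ (p ∸ k) ≈ - fromℕ k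
  fromℕ[p-k] {k} k≤p = RingProperties.+-inverseˡ-unique ring (fromℕ (p ∸ k)) (fromℕ k)
    (trans (sym (fromℕ-∸ k≤p)) p≈0)

module PrimeFieldProperties (n : ℕ) (p-prime : Prime (suc n)) where
  open Setting (suc n) p-prime
  open Field 𝔽ₚ
  open RingNotation commutativeRing using (fromℕ; _^_)

  p : ℕ
  p = suc n

  fromℕ≡+ : ∀ m → fromℕ m ≡ ℤ.+ m
  fromℕ≡+ zero    = ≡.refl
  fromℕ≡+ (suc m) = ≡.cong (λ x → 1# + x) (fromℕ≡+ m)

  fromℕ-p≈0 : fromℕ p ≈ 0#
  fromℕ-p≈0 = trans (reflexive (fromℕ≡+ p))
    (PrimeField.congruent (≡.subst (ℤ.+ p ℤ∣.∣_) (≡.sym (ℤₚ.+-identityʳ (ℤ.+ p))) ℤ∣.∣-refl))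

  open Characteristic commutativeRing n p-prime fromℕ-p≈0 public
    using (fromℕ^p≈fromℕ; [-x]^p≈-x)

  fermat : ∀ x → x ^ p ≈ x
  fermat (ℤ.+ m)    = ≡.subst (λ x → x ^ p ≈ x) (fromℕ≡+ m) (fromℕ^p≈fromℕ m)
  fermat ℤ.-[1+ m ] = [-x]^p≈-x {ℤ.+ suc m} (fermat (ℤ.+ suc m))

  fromℕ≉0 : ∀ {m} → p ∤ m → ¬ fromℕ m ≈ 0#
  fromℕ≉0 {m} p∤m m≈0 with trans (reflexive (≡.sym (fromℕ≡+ m))) m≈0
  ... | PrimeField.congruent p∣m-0 =
    p∤m (ℤ∣.∣⇒∣ᵤ (≡.subst (ℤ.+ p ℤ∣.∣_) (ℤₚ.+-identityʳ (ℤ.+ m)) p∣m-0))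

-- The polynomials b_{1,s}

module _ (R : CommutativeRing c ℓ) where
  open CommutativeRing R

  ∏-zero : ∀ n (f : ℕ → Carrier) {i} → i < n → f i ≈ 0# → Fold.fold *-commutativeMonoid n f ≈ 0#
  ∏-zero (suc n) f {zero}  _         f0≈0 = trans (*-congʳ f0≈0) (zeroˡ _)
  ∏-zero (suc n) f {suc i} (s≤s i<n) fi≈0 =
    trans (*-congˡ (∏-zero n (λ j → f (suc j)) i<n fi≈0)) (zeroʳ _)

module FieldProperties (F : Field c ℓ) where
  open Field F
  open SetoidReasoning setoid

  x*[y/x]≈y : ∀ {x} y → ¬ x ≈ 0# → x * (y * x ⁻¹) ≈ y
  x*[y/x]≈y {x} y x≉0 = begin
    x * (y * x ⁻¹)    ≈⟨ *-comm x _ ⟩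
    y * x ⁻¹ * x      ≈⟨ *-assoc y _ x ⟩
    y * (x ⁻¹ * x)    ≈⟨ *-congˡ (trans (*-comm _ x) (*-inverseʳ x≉0)) ⟩
    y * 1#            ≈⟨ *-identityʳ y ⟩
    y                 ∎

  open IntegralDomain integralDomain public using (*-cancelʳ; *-nonZero)

  ⁻¹-unique : ∀ {x y} → x * y ≈ 1# → y ≈ x ⁻¹
  ⁻¹-unique {x} {y} xy≈1 = *-cancelʳ x≉0 (begin
    y * x       ≈⟨ *-comm y x ⟩
    x * y       ≈⟨ xy≈1 ⟩
    1#          ≈⟨ *-inverseʳ x≉0 ⟨
    x * x ⁻¹    ≈⟨ *-comm _ _ ⟩
    x ⁻¹ * x    ∎)
    where
    x≉0 : ¬ x ≈ 0#
    x≉0 x≈0 = 1≉0 (trans (sym xy≈1) (trans (*-congʳ x≈0) (zeroˡ y)))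

-- What the argument uses of 𝔽ₚ beyond the field axioms and the primality of p.
record IsPrimeField (F : Field c ℓ) (p : ℕ) : Set (c ⊔ ℓ) where
  open Field F
  open RingNotation commutativeRing
  field
    fromℕ-p≈0 : fromℕ p ≈ 0#
    fromℕ≉0   : ∀ {m} → p ∤ m → ¬ fromℕ m ≈ 0#
    fermat    : ∀ x → x ^ p ≈ x

module _ (D : IntegralDomain c ℓ) where
  open IntegralDomain D
  open SetoidReasoning setoid
  open RingProperties ring using (x[y-z]≈xy-xz; +-cancelʳ)

  -- The hypothesis is (x - y) z = x - y in the subtraction-free shape in which `geometric-conv`
  -- delivers it.
  cancel-difference : ∀ {x y z} → ¬ x ≈ y → x * z + y ≈ y * z + x → z ≈ 1#
  cancel-difference {x} {y} {z} x≉y eq = *-cancelʳ {z} {1#} {x - y}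
    (λ x-y≈0 → x≉y (RingProperties.x∙y⁻¹≈ε⇒x≈y ring x y x-y≈0)) (begin
      z * (x - y)       ≈⟨ x[y-z]≈xy-xz z x y ⟩
      z * x - z * y     ≈⟨ +-cancelʳ (z * y + y) _ _ (begin
        (z * x - z * y) + (z * y + y)   ≈⟨ solve 4 (λ zx zy -zy y → (zx :+ -zy) :+ (zy :+ y) := (-zy :+ zy) :+ (zx :+ y))
                                             refl (z * x) (z * y) (- (z * y)) y ⟩
        (- (z * y) + z * y) + (z * x + y)   ≈⟨ +-cong (-‿inverseˡ (z * y)) (trans (+-congʳ (*-comm z x)) eq) ⟩
        0# + (y * z + x)                ≈⟨ +-cong (sym (-‿inverseˡ y)) (+-congʳ (*-comm y z)) ⟩
        (- y + y) + (z * y + x)         ≈⟨ solve 4 (λ x y -y zy → (-y :+ y) :+ (zy :+ x) := (x :+ -y) :+ (zy :+ y))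
                                             refl x y (- y) (z * y) ⟩
        (x - y) + (z * y + y)           ∎) ⟩
      x - y             ≈⟨ *-identityˡ _ ⟨
      1# * (x - y)      ∎)
    where open NaturalSolver commutativeSemiring

module BinomialSum (F : Field c ℓ) (n : ℕ) (p-prime : Prime (suc n))
  (isPrimeField : IsPrimeField F (suc n)) where

  open IsPrimeField isPrimeField

  -- The definitions of Setting over an arbitrary field in place of 𝔽ₚ, whose integer arithmetic would be
  -- unfolded; at 𝔽ₚ, b s is Setting.b 1 s by conversion.
  module F where
    open Field F public
    open RingNotation commutativeRing public

  module A where
    open IntegralDomain (polynomialDomain (Field.integralDomain F)) public
    open RingNotation commutativeRing public
    open Polynomial F.commutativeRing public using (const) renaming (X to α)

  binomial : A.Carrier → ℕ → A.Carrier
  binomial x m = A.const (F.fromℕ (m !) F.⁻¹) * (∏[ 0 ⋯< m ] λ i → x - fromℕ i)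
    where open A

  b : ℕ → A.Carrier
  b s = ∑[ 0 ⋯< suc n ] λ k →
    A.const ((F.- (F.fromℕ 1 F./ F.fromℕ s)) F.^ k)
      * binomial (fromℕ 1 * α - 1#) (suc n ∸ 1 ∸ k)
      * binomial (fromℕ s * α - 1#) k
    where open A

  open Characteristic F.commutativeRing n p-prime fromℕ-p≈0 using (fromℕ-∸; fromℕ[p-k])
  open Floor n p-prime
  open Polynomial F.commutativeRing using (≈-refl)
  open Degree F.commutativeRing
  open Roots F.integralDomain
  open Fold A.*-commutativeMonoid using (fold; fold-last)
  open FieldProperties F using (⁻¹-unique)
  module C = HomomorphismProperties F.commutativeRing A.commutativeRing (const-hom F.commutativeRing)
  module Eval (a : F.Carrier) = Evaluation F.commutativeRing F.commutativeRing (id-hom F.commutativeRing) a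
  module at (a : F.Carrier) =
    HomomorphismProperties A.commutativeRing F.commutativeRing {Eval.eval a} (Eval.eval-hom a)
  open Convolution A.commutativeRing using (conv; module Recursion)

  fromℕ-injective : ∀ i j → i < j → j < p → ¬ F.fromℕ i F.≈ F.fromℕ j
  fromℕ-injective i j i<j j<p i≈j = fromℕ≉0 (p∤small (ℕₚ.m<n⇒0<n∸m i<j)
      (ℕₚ.≤-<-trans (ℕₚ.m∸n≤m j i) j<p))
    (RingProperties.+-cancelʳ F.ring (F.fromℕ i) (F.fromℕ (j ∸ i)) F.0#
      (F.trans (F.sym (fromℕ-∸ (ℕₚ.<⇒≤ i<j))) (F.trans (F.sym i≈j) (F.sym (F.+-identityˡ _)))))

  x^n≈1 : ∀ {x} → ¬ x F.≈ F.0# → x F.^ n F.≈ F.1#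
  x^n≈1 {x} x≉0 = IntegralDomain.*-cancelʳ F.integralDomain x≉0
    (F.trans (F.*-comm _ x) (F.trans (fermat x) (F.sym (F.*-identityˡ x))))

  fromℕ-suc≉0 : ∀ {m} → m < n → ¬ F.fromℕ (suc m) F.≈ F.0#
  fromℕ-suc≉0 m<n = fromℕ≉0 (p∤small (s≤s z≤n) (s≤s m<n))

  fromℕ!≉0 : ∀ {m} → m ≤ n → ¬ F.fromℕ (m !) F.≈ F.0#
  fromℕ!≉0 m≤n = fromℕ≉0 (p∤m! p-prime (s≤s m≤n))

  !⁻¹-rec : ∀ {m} → m < n → F.fromℕ (suc m) F.* F.fromℕ (suc m !) F.⁻¹ F.≈ F.fromℕ (m !) F.⁻¹
  !⁻¹-rec {m} m<n = ⁻¹-unique (begin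
    F.fromℕ (m !) F.* (F.fromℕ (suc m) F.* i)    ≈⟨ F.*-assoc _ _ i ⟨
    F.fromℕ (m !) F.* F.fromℕ (suc m) F.* i      ≈⟨ F.*-congʳ (F.*-comm (F.fromℕ (m !)) _) ⟩
    F.fromℕ (suc m) F.* F.fromℕ (m !) F.* i      ≈⟨ F.*-congʳ (SemiringMult.×1-homo-* F.semiring (suc m) (m !)) ⟨
    F.fromℕ (suc m !) F.* i                      ≈⟨ F.*-inverseʳ (fromℕ!≉0 m<n) ⟩
    F.1#                                         ∎)
    where
    open SetoidReasoning F.setoid
    i = F.fromℕ (suc m !) F.⁻¹

  -- The equation (1+z) F′ = x F for F = (1+z)ˣ, read at zᵐ. The bound on m keeps (m+1)! invertible
  -- modulo p.
  binomial-rec : ∀ x {m} → m < n →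
    A.fromℕ (suc m) A.* binomial x (suc m) A.+ A.fromℕ m A.* binomial x m A.≈ x A.* binomial x m
  binomial-rec x {m} m<n = begin
    A.fromℕ (suc m) A.* (A.const i′ A.* fold (suc m) (λ j → x A.- A.fromℕ j)) A.+ ν A.* (A.const i A.* Π)
      ≈⟨ A.+-congʳ (A.*-congˡ {A.fromℕ (suc m)} (A.*-congˡ {A.const i′} (fold-last m (λ j → x A.- A.fromℕ j)))) ⟩
    A.fromℕ (suc m) A.* (A.const i′ A.* (Π A.* (x A.- ν))) A.+ ν A.* (A.const i A.* Π)
      ≈⟨ A.+-congʳ (A.*-assoc (A.fromℕ (suc m)) (A.const i′) (Π A.* (x A.- ν))) ⟨
    A.fromℕ (suc m) A.* A.const i′ A.* (Π A.* (x A.- ν)) A.+ ν A.* (A.const i A.* Π)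
      ≈⟨ A.+-congʳ (A.*-congʳ {Π A.* (x A.- ν)} (begin
           A.fromℕ (suc m) A.* A.const i′             ≈⟨ A.*-congʳ {A.const i′} (C.fromℕ-homo (suc m)) ⟨
           A.const (F.fromℕ (suc m)) A.* A.const i′   ≈⟨ C.*-homo (F.fromℕ (suc m)) i′ ⟨
           A.const (F.fromℕ (suc m) F.* i′)           ≈⟨ C.⟦⟧-cong (!⁻¹-rec m<n) ⟩
           A.const i                                  ∎)) ⟩
    A.const i A.* (Π A.* (x A.- ν)) A.+ ν A.* (A.const i A.* Π)
      ≈⟨ solve 5 (λ i Π x ν -ν → i :* (Π :* (x :+ -ν)) :+ ν :* (i :* Π) := x :* (i :* Π) :+ (-ν :+ ν) :* (i :* Π)) ≈-refl
           (A.const i) Π x ν (A.- ν) ⟩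
    x A.* (A.const i A.* Π) A.+ (A.- ν A.+ ν) A.* (A.const i A.* Π)
      ≈⟨ A.+-congˡ {x A.* (A.const i A.* Π)} (A.*-congʳ {A.const i A.* Π} (A.-‿inverseˡ ν)) ⟩
    x A.* (A.const i A.* Π) A.+ A.0#
      ≈⟨ A.+-identityʳ _ ⟩
    x A.* (A.const i A.* Π) ∎
    where
    open SetoidReasoning A.setoid
    open NaturalSolver A.commutativeSemiring
    ν = A.fromℕ m
    i = F.fromℕ (m !) F.⁻¹
    i′ = F.fromℕ (suc m !) F.⁻¹
    Π = fold m (λ j → x A.- A.fromℕ j)

  -- For r < m the falling factorial contains the factor x - r.
  binomial-at-zero : ∀ a x r {m} → (a at) x F.≈ F.fromℕ r → r < m → (a at) (binomial x m) F.≈ F.0#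
  binomial-at-zero a x r {m} x≈r r<m = begin
    (a at) (binomial x m)
      ≈⟨ at.*-homo a (A.const (F.fromℕ (m !) F.⁻¹)) (fold m (λ j → x A.- A.fromℕ j)) ⟩
    (a at) (A.const (F.fromℕ (m !) F.⁻¹)) F.* (a at) (fold m (λ j → x A.- A.fromℕ j))
      ≈⟨ F.*-congˡ {(a at) (A.const (F.fromℕ (m !) F.⁻¹))} (F.trans (at.∏-homo a m (λ j → x A.- A.fromℕ j))
           (∏-zero F.commutativeRing m (λ j → (a at) (x A.- A.fromℕ j)) r<m (begin
             (a at) (x A.- A.fromℕ r)               ≈⟨ at.x-y-homo a x (A.fromℕ r) ⟩
             (a at) x F.- (a at) (A.fromℕ r)        ≈⟨ F.+-cong x≈r (F.-‿cong (at.fromℕ-homo a r)) ⟩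
             F.fromℕ r F.- F.fromℕ r                ≈⟨ F.-‿inverseʳ _ ⟩
             F.0#                                   ∎))) ⟩
    (a at) (A.const (F.fromℕ (m !) F.⁻¹)) F.* F.0#
      ≈⟨ F.zeroʳ _ ⟩
    F.0# ∎
    where open SetoidReasoning F.setoid

  module _ {s : ℕ} (0<s : 0 < s) (s<n : s < n) where
    private
      x y τ : A.Carrier
      t : F.Carrier
      x = A.fromℕ 1 A.* A.α A.- A.1#
      y = A.fromℕ s A.* A.α A.- A.1#
      t = F.- (F.fromℕ 1 F./ F.fromℕ s)
      τ = A.const t

      -- The coefficients of (1+tz)^y for t = -1/s. Moving the powers of t into this sequence makes
      -- b_{1,s} an ordinary convolution.
      B : ℕ → A.Carrier
      B k = A.const (t F.^ k) A.* binomial y k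

      s≉0 : ¬ F.fromℕ s F.≈ F.0#
      s≉0 = fromℕ≉0 (p∤small 0<s (ℕₚ.m≤n⇒m≤1+n s<n))

      ts≈-1 : t F.* F.fromℕ s F.≈ F.- F.1#
      ts≈-1 = begin
        F.- (F.fromℕ 1 F.* i) F.* F.fromℕ s        ≈⟨ -‿distribˡ-* (F.fromℕ 1 F.* i) (F.fromℕ s) ⟨
        F.- (F.fromℕ 1 F.* i F.* F.fromℕ s)        ≈⟨ F.-‿cong (F.*-congʳ (F.*-congʳ (F.+-identityʳ F.1#))) ⟩
        F.- (F.1# F.* i F.* F.fromℕ s)             ≈⟨ F.-‿cong (F.*-congʳ (F.*-identityˡ i)) ⟩
        F.- (i F.* F.fromℕ s)                      ≈⟨ F.-‿cong (F.*-comm i _) ⟩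
        F.- (F.fromℕ s F.* i)                      ≈⟨ F.-‿cong (F.*-inverseʳ s≉0) ⟩
        F.- F.1#                                   ∎
        where
        open SetoidReasoning F.setoid
        open RingProperties F.ring using (-‿distribˡ-*)
        i = F.fromℕ s F.⁻¹

      b≈conv : b s A.≈ conv (binomial x) B n
      b≈conv = Fold.fold-cong A.+-commutativeMonoid (suc n)
        (λ k → A.const (t F.^ k) A.* binomial x (n ∸ k) A.* binomial y k)
        (λ k → binomial x (n ∸ k) A.* B k)
        (λ k _ → solve 3 (λ c a b → c :* a :* b := a :* (c :* b)) ≈-refl
          (A.const (t F.^ k)) (binomial x (n ∸ k)) (binomial y k))
        where open NaturalSolver A.commutativeSemiring

      B-rec : ∀ j → j < n →
        A.fromℕ (suc j) A.* B (suc j) A.+ τ A.* (A.fromℕ j A.* B j) A.≈ τ A.* (y A.* B j)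
      B-rec j j<n = begin
        A.fromℕ (suc j) A.* (A.const (t F.* t F.^ j) A.* β′) A.+ τ A.* (A.fromℕ j A.* (T A.* β))
          ≈⟨ A.+-congʳ (A.*-congˡ {A.fromℕ (suc j)} (A.*-congʳ {β′} (C.*-homo t (t F.^ j)))) ⟩
        A.fromℕ (suc j) A.* ((τ A.* T) A.* β′) A.+ τ A.* (A.fromℕ j A.* (T A.* β))
          ≈⟨ solve 6 (λ u v τ T β β′ → u :* ((τ :* T) :* β′) :+ τ :* (v :* (T :* β)) := τ :* (T :* (u :* β′ :+ v :* β)))
               ≈-refl (A.fromℕ (suc j)) (A.fromℕ j) τ T β β′ ⟩
        τ A.* (T A.* (A.fromℕ (suc j) A.* β′ A.+ A.fromℕ j A.* β))
          ≈⟨ A.*-congˡ {τ} (A.*-congˡ {T} (binomial-rec y j<n)) ⟩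
        τ A.* (T A.* (y A.* β))
          ≈⟨ solve 4 (λ τ T y β → τ :* (T :* (y :* β)) := τ :* (y :* (T :* β))) ≈-refl τ T y β ⟩
        τ A.* (y A.* (T A.* β)) ∎
        where
        open SetoidReasoning A.setoid
        open NaturalSolver A.commutativeSemiring
        T = A.const (t F.^ j)
        β = binomial y j
        β′ = binomial y (suc j)

      open Recursion (binomial x) B x y τ n (λ i → binomial-rec x) B-rec

      degree-fromℕ : ∀ m → A.fromℕ m HasDegree≤ 0
      degree-fromℕ m = degree-cong (C.fromℕ-homo m) degree-const

      degree-const* : ∀ a {f m} → f HasDegree≤ m → A.const a A.* f HasDegree≤ m
      degree-const* a deg = degree-* {A.const a} {n = 0} degree-const deg

      degree-linear : ∀ m → A.fromℕ m A.* A.α A.- A.1# HasDegree≤ 1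
      degree-linear m = degree-+ (degree-* {A.fromℕ m} (degree-fromℕ m) degree-X)
        (degree-neg {A.1#} degree-const)

      -- The coefficient of α in x + τ y vanishes; hence log ((1+z)ᵅ (1+tz)ˢᵅ) = O(z²), and
      -- the degrees in α grow only half as fast as the exponents of z.
      degree-x+τy : x A.+ τ A.* y HasDegree≤ 0
      degree-x+τy = degree-cong (A.sym x+τy≈const)
          (degree-+ {A.- A.1#} {τ A.* A.- A.1#}
            (degree-neg {A.1#} degree-const) (degree-const* t (degree-neg {A.1#} degree-const)))
        where
        open SetoidReasoning A.setoid
        open NaturalSolver A.commutativeSemiring
        cancel : A.fromℕ 1 A.+ τ A.* A.fromℕ s A.≈ A.0#
        cancel = begin
          A.fromℕ 1 A.+ τ A.* A.fromℕ s
            ≈⟨ A.+-cong (C.fromℕ-homo 1) (A.*-congˡ {τ} (C.fromℕ-homo s)) ⟨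
          A.const (F.fromℕ 1) A.+ τ A.* A.const (F.fromℕ s)
            ≈⟨ A.+-congˡ {A.const (F.fromℕ 1)} (C.*-homo t (F.fromℕ s)) ⟨
          A.const (F.fromℕ 1 F.+ t F.* F.fromℕ s)
            ≈⟨ C.⟦⟧-cong (F.+-cong (F.+-identityʳ F.1#) ts≈-1) ⟩
          A.const (F.1# F.- F.1#)
            ≈⟨ C.⟦⟧-cong (F.-‿inverseʳ F.1#) ⟩
          A.const F.0#
            ≈⟨ C.0#-homo ⟩
          A.0# ∎
        x+τy≈const : x A.+ τ A.* y A.≈ A.- A.1# A.+ τ A.* A.- A.1#
        x+τy≈const = begin
          x A.+ τ A.* y
            ≈⟨ solve 5 (λ u v a m τ → (u :* a :+ m) :+ τ :* (v :* a :+ m) := (u :+ τ :* v) :* a :+ (m :+ τ :* m))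
                 ≈-refl (A.fromℕ 1) (A.fromℕ s) A.α (A.- A.1#) τ ⟩
          (A.fromℕ 1 A.+ τ A.* A.fromℕ s) A.* A.α A.+ (A.- A.1# A.+ τ A.* A.- A.1#)
            ≈⟨ A.+-congʳ {A.- A.1# A.+ τ A.* A.- A.1#} (A.*-congʳ {A.α} cancel) ⟩
          A.- A.1# A.+ τ A.* A.- A.1# ∎

      -- The two bounds grow alternately. By `conv-rec` a coefficient is a combination, with factors
      -- of degree 0, of the preceding `conv` and `convʳ`; only `convʳ-rec` brings in the linear
      -- factor y, and it applies it to `conv`. So the degree rises once in two steps.
      degree-conv : ∀ m → m ≤ n → conv (binomial x) B m HasDegree≤ ⌊ m /2⌋
      degree-convʳ : ∀ m → m ≤ n → convʳ m HasDegree≤ ⌊ suc m /2⌋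

      degree-conv zero    _   = degree-const
      degree-conv (suc m) m<n = degree-fromℕ* (suc m) (fromℕ-suc≉0 m<n)
        (degree-+⁻¹ (degree-cong (A.sym (conv-rec m m<n))
            (degree-+ (degree-mono (ℕₚ.⌊n/2⌋-mono (ℕₚ.n≤1+n m)) (degree-* degree-x+τy deg)) degʳ))
          (degree-+ (degree-mono (ℕₚ.⌊n/2⌋-mono (ℕₚ.n≤1+n m)) (degree-* (degree-fromℕ m) deg)) (degree-const* t degʳ)))
        where
        deg = degree-conv m (ℕₚ.<⇒≤ m<n)
        degʳ = degree-convʳ m (ℕₚ.<⇒≤ m<n)

      degree-convʳ zero    _   = degree-[] convʳ-0
      degree-convʳ (suc m) m<n = degree-+⁻¹ (degree-cong (A.sym (convʳ-rec m m<n))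
          (degree-const* t (degree-* (degree-linear s) (degree-conv m (ℕₚ.<⇒≤ m<n)))))
        (degree-mono (ℕₚ.⌊n/2⌋-mono (ℕₚ.n≤1+n (suc m))) (degree-const* t (degree-convʳ m (ℕₚ.<⇒≤ m<n))))

    degree-b : b s HasDegree≤ ⌊ n /2⌋
    degree-b = degree-cong (A.sym b≈conv) (degree-conv n ℕₚ.≤-refl)

    private
      at-linear : ∀ a m → (a at) (A.fromℕ m A.* A.α A.- A.1#) F.≈ F.fromℕ m F.* a F.- F.1#
      at-linear a m = F.trans (at.x-y-homo a (A.fromℕ m A.* A.α) A.1#)
        (F.+-cong (F.trans (at.*-homo a (A.fromℕ m) A.α) (F.*-cong (at.fromℕ-homo a m) (Eval.eval-X a)))
                  (F.-‿cong (at.1#-homo a)))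

      at-conv : ∀ a → (a at) (b s) F.≈ Convolution.conv F.commutativeRing
        (λ i → (a at) (binomial x i)) (λ k → t F.^ k F.* (a at) (binomial y k)) n
      at-conv a = F.trans (at.⟦⟧-cong a b≈conv)
        (F.trans (at.∑-homo a (suc n) (λ k → binomial x (n ∸ k) A.* B k))
          (Fold.fold-cong F.+-commutativeMonoid (suc n)
            (λ k → (a at) (binomial x (n ∸ k) A.* B k))
            (λ k → (a at) (binomial x (n ∸ k)) F.* (t F.^ k F.* (a at) (binomial y k)))
            (λ k _ → F.trans (at.*-homo a (binomial x (n ∸ k)) (B k))
              (F.*-congˡ (F.trans (at.*-homo a (A.const (t F.^ k)) (binomial y k))
                (F.*-congʳ (Eval.eval-const a (t F.^ k))))))))

    b-root : ∀ {k} → 0 < k → k < p → carry s k ≡ 0 → (F.fromℕ k at) (b s) F.≈ F.0#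
    b-root {suc k} _ k<p carry≡0 with s ℕ.* suc k % p in r≡
      | 0<[s*k]%p 0<s (ℕₚ.m≤n⇒m≤1+n s<n) (s≤s z≤n) k<p | no-carry {s} k<p carry≡0
    -- The point is now `suc k`, and the residue of its multiple by s is nonzero, hence of the form
    -- `suc r`. Thus k and r are the two exponents at this point.
    ... | suc r | _ | s≤s k+r<n = F.trans (at-conv a)
        (F.trans (Fold.fold-cong F.+-commutativeMonoid (suc n)
            (λ j → (a at) (binomial x (n ∸ j)) F.* (t F.^ j F.* (a at) (binomial y j))) (λ _ → F.0#)
            (λ { j (s≤s j≤n) → term j j≤n }))
          (Fold.fold-ε F.+-commutativeMonoid (suc n)))
      where
      a = F.fromℕ (suc k)
      open SetoidReasoning F.setoid

      suc-1 : ∀ m → F.fromℕ (suc m) F.- F.1# F.≈ F.fromℕ m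
      suc-1 m = begin
        F.1# F.+ F.fromℕ m F.- F.1#         ≈⟨ F.+-congʳ (F.+-comm F.1# _) ⟩
        F.fromℕ m F.+ F.1# F.- F.1#         ≈⟨ F.+-assoc _ _ _ ⟩
        F.fromℕ m F.+ (F.1# F.- F.1#)       ≈⟨ F.+-congˡ (F.-‿inverseʳ F.1#) ⟩
        F.fromℕ m F.+ F.0#                  ≈⟨ F.+-identityʳ _ ⟩
        F.fromℕ m                           ∎

      x-at : (a at) x F.≈ F.fromℕ k
      x-at = begin
        (a at) x                   ≈⟨ at-linear a 1 ⟩
        F.fromℕ 1 F.* a F.- F.1#   ≈⟨ F.+-congʳ (F.trans (F.*-congʳ (F.+-identityʳ F.1#)) (F.*-identityˡ a)) ⟩
        a F.- F.1#                 ≈⟨ suc-1 k ⟩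
        F.fromℕ k                  ∎

      y-at : (a at) y F.≈ F.fromℕ r
      y-at = begin
        (a at) y                            ≈⟨ at-linear a s ⟩
        F.fromℕ s F.* a F.- F.1#            ≈⟨ F.+-congʳ (SemiringMult.×1-homo-* F.semiring s (suc k)) ⟨
        F.fromℕ (s ℕ.* suc k) F.- F.1#      ≡⟨ ≡.cong (λ m → F.fromℕ m F.- F.1#)
                                                 (≡.trans (m≡m%n+[m/n]*n (s ℕ.* suc k) p)
                                                   (≡.cong (ℕ._+ s ℕ.* suc k / p ℕ.* p) r≡)) ⟩
        F.fromℕ (suc r ℕ.+ s ℕ.* suc k / p ℕ.* p) F.- F.1#
          ≈⟨ F.+-congʳ (SemiringMult.×-homo-+ F.semiring F.1# (suc r) _) ⟩
        F.fromℕ (suc r) F.+ F.fromℕ (s ℕ.* suc k / p ℕ.* p) F.- F.1#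
          ≈⟨ F.+-congʳ (F.+-congˡ (F.trans (SemiringMult.×1-homo-* F.semiring (s ℕ.* suc k / p) p)
               (F.trans (F.*-congˡ fromℕ-p≈0) (F.zeroʳ _)))) ⟩
        F.fromℕ (suc r) F.+ F.0# F.- F.1#   ≈⟨ F.+-congʳ (F.+-identityʳ _) ⟩
        F.fromℕ (suc r) F.- F.1#            ≈⟨ suc-1 r ⟩
        F.fromℕ r                           ∎

      term : ∀ j → j ≤ n → (a at) (binomial x (n ∸ j)) F.* (t F.^ j F.* (a at) (binomial y j)) F.≈ F.0#
      term j j≤n with r ℕₚ.<? j
      -- The second binomial vanishes for j > r and the first for n - j > k. As k + r < n, each j
      -- falls under one of the two cases.
      ... | yes r<j = F.trans (F.*-congˡ (F.trans (F.*-congˡ (binomial-at-zero a y r y-at r<j)) (F.zeroʳ _))) (F.zeroʳ _)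
      ... | no  r≮j = F.trans (F.*-congʳ (binomial-at-zero a x k x-at k<n-j)) (F.zeroˡ _)
        where
        k<n-j : k < n ∸ j
        k<n-j = ℕₚ.m+n≤o⇒m≤o∸n (suc k) (ℕₚ.≤-trans
          (ℕₚ.+-monoʳ-≤ (suc k) (ℕₚ.m≤n⇒m≤1+n (ℕₚ.≮⇒≥ r≮j))) k+r<n)

    b-at-0 : (F.0# at) (b s) F.≈ F.1#
    b-at-0 = begin
      (F.0# at) (b s)
        ≈⟨ at-conv F.0# ⟩
      convF (λ i → (F.0# at) (binomial x i)) (λ k → t F.^ k F.* (F.0# at) (binomial y k)) n
        ≈⟨ Fold.fold-cong F.+-commutativeMonoid (suc n) _ (λ k → -1F F.^ (n ∸ k) F.* σ F.^ k)
             (λ { k (s≤s k≤n) → F.*-cong (binomial-at-0 x (at-0 1) (n ∸ k) (ℕₚ.m∸n≤m n k))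
               (F.trans (F.*-congˡ (binomial-at-0 y (at-0 s) k k≤n))
                 (F.sym (^-distrib-* t -1F k))) }) ⟩
      convF (-1F F.^_) (σ F.^_) n
        -- The geometric sum is (ρ^p - σ^p)/(ρ - σ) with ρ = -1, and Fermat's theorem reduces the
        -- numerator to ρ - σ.
        ≈⟨ cancel-difference F.integralDomain -1≉σ (F.trans (F.+-congˡ (F.sym (fermat σ)))
             (F.trans (geometric-conv -1F σ n) (F.+-congˡ (fermat -1F)))) ⟩
      F.1# ∎
      where
      open SetoidReasoning F.setoid
      open Convolution F.commutativeRing using (geometric-conv) renaming (conv to convF)
      open CommutativeSemiringExp F.commutativeSemiring using (^-distrib-*)
      open RingProperties F.ring using (+-cancelʳ; -1*x≈-x; -‿involutive)
      -1F σ : F.Carrier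
      -1F = F.- F.1#
      σ = t F.* -1F

      -- Since σ = 1/s, equality would make s + 1 divisible by p; this is excluded by `s < n`.
      -1≉σ : ¬ -1F F.≈ σ
      -1≉σ -1≈σ = fromℕ≉0 (p∤small (s≤s z≤n) (s≤s s<n)) (begin
        F.1# F.+ F.fromℕ s            ≈⟨ F.+-congʳ (-‿involutive F.1#) ⟨
        F.- -1F F.+ F.fromℕ s         ≈⟨ F.+-congʳ (-1*x≈-x -1F) ⟨
        -1F F.* -1F F.+ F.fromℕ s     ≈⟨ F.+-congʳ (F.*-congʳ ts≈-1) ⟨
        t F.* F.fromℕ s F.* -1F F.+ F.fromℕ s
          ≈⟨ F.+-congʳ (solve 3 (λ t s m → t :* s :* m := (t :* m) :* s) F.refl t (F.fromℕ s) -1F) ⟩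
        σ F.* F.fromℕ s F.+ F.fromℕ s    ≈⟨ F.+-congʳ (F.*-congʳ -1≈σ) ⟨
        -1F F.* F.fromℕ s F.+ F.fromℕ s  ≈⟨ F.+-congʳ (-1*x≈-x _) ⟩
        F.- F.fromℕ s F.+ F.fromℕ s      ≈⟨ F.-‿inverseˡ _ ⟩
        F.0#                             ∎)
        where open NaturalSolver F.commutativeSemiring

      at-0 : ∀ m → (F.0# at) (A.fromℕ m A.* A.α A.- A.1#) F.≈ -1F
      at-0 m = F.trans (at-linear F.0# m) (F.trans (F.+-congʳ (F.zeroʳ _)) (F.+-identityˡ _))

      binomial-at-0 : ∀ z → (F.0# at) z F.≈ -1F → ∀ m → m ≤ n → (F.0# at) (binomial z m) F.≈ -1F F.^ m
      binomial-at-0 z z≈-1 zero    _   = begin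
        (F.0# at) (A.const (F.fromℕ 1 F.⁻¹) A.* A.1#)
          ≈⟨ at.⟦⟧-cong F.0# (A.*-identityʳ (A.const (F.fromℕ 1 F.⁻¹))) ⟩
        (F.0# at) (A.const (F.fromℕ 1 F.⁻¹))   ≈⟨ Eval.eval-const F.0# _ ⟩
        F.fromℕ 1 F.⁻¹                         ≈⟨ ⁻¹-unique (F.trans (F.*-identityʳ _) (F.+-identityʳ F.1#)) ⟨
        F.1#                                   ∎
      -- With z = -1 at the point, `binomial-rec` reads (m+1) β′ + m β = -β, so β′ = -β after
      -- cancelling m + 1.
      binomial-at-0 z z≈-1 (suc m) m<n = IntegralDomain.*-cancelʳ F.integralDomain (fromℕ-suc≉0 m<n) (begin
        β′ F.* F.fromℕ (suc m)                ≈⟨ F.*-comm β′ _ ⟩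
        F.fromℕ (suc m) F.* β′                ≈⟨ +-cancelʳ (F.fromℕ m F.* β) _ _ (begin
          F.fromℕ (suc m) F.* β′ F.+ F.fromℕ m F.* β
            ≈⟨ F.+-cong (at-* (suc m) (binomial z (suc m))) (at-* m (binomial z m)) ⟨
          (F.0# at) (A.fromℕ (suc m) A.* binomial z (suc m)) F.+ (F.0# at) (A.fromℕ m A.* binomial z m)
            ≈⟨ at.+-homo F.0# (A.fromℕ (suc m) A.* binomial z (suc m)) (A.fromℕ m A.* binomial z m) ⟨
          (F.0# at) (A.fromℕ (suc m) A.* binomial z (suc m) A.+ A.fromℕ m A.* binomial z m)
            ≈⟨ at.⟦⟧-cong F.0# (binomial-rec z m<n) ⟩
          (F.0# at) (z A.* binomial z m)
            ≈⟨ at.*-homo F.0# z (binomial z m) ⟩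
          (F.0# at) z F.* β
            ≈⟨ F.*-congʳ z≈-1 ⟩
          -1F F.* β
            ≈⟨ F.+-identityʳ _ ⟨
          -1F F.* β F.+ F.0#
            -- To the semiring solver -1 is an opaque element; adding (-1 + 1) m β = 0 by hand
            -- supplies the only property of it that is used.
            ≈⟨ F.+-congˡ (F.trans (F.*-congʳ (F.-‿inverseˡ F.1#)) (F.zeroˡ _)) ⟨
          -1F F.* β F.+ (-1F F.+ F.1#) F.* (F.fromℕ m F.* β)
            ≈⟨ solve 3 (λ m β v → m :* β :+ (m :+ con 1) :* (v :* β) := (m :* β) :* (con 1 :+ v) :+ v :* β)
                 F.refl -1F β (F.fromℕ m) ⟩
          -1F F.* β F.* F.fromℕ (suc m) F.+ F.fromℕ m F.* β ∎) ⟩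
        -1F F.* β F.* F.fromℕ (suc m)         ≈⟨ F.*-congʳ (F.*-congˡ (binomial-at-0 z z≈-1 m (ℕₚ.<⇒≤ m<n))) ⟩
        -1F F.^ suc m F.* F.fromℕ (suc m)     ∎)
        where
        open NaturalSolver F.commutativeSemiring
        β = (F.0# at) (binomial z m)
        β′ = (F.0# at) (binomial z (suc m))
        at-* : ∀ m f → (F.0# at) (A.fromℕ m A.* f) F.≈ F.fromℕ m F.* (F.0# at) f
        at-* m f = F.trans (at.*-homo F.0# (A.fromℕ m) f) (F.*-congʳ (at.fromℕ-homo F.0# m))

-- The factorisation of b_{1,s}

module Factorisation (F : Field c ℓ) (n : ℕ) (p-prime : Prime (suc n))
  (isPrimeField : IsPrimeField F (suc n)) where

  open IsPrimeField isPrimeField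
  open BinomialSum F n p-prime isPrimeField public
  open Characteristic F.commutativeRing n p-prime fromℕ-p≈0 using (fromℕ[p-k]; 1^m≈1)
  open Floor n p-prime
  open Polynomial F.commutativeRing using (≈-refl)
  open Degree F.commutativeRing
  open Roots F.integralDomain
  open Fold A.*-commutativeMonoid using (fold; fold-cong; fold-∙; fold-last; fold-ε)
  private
    module ℕFold = Fold ℕₚ.+-0-commutativeMonoid

  0<n : 0 < n
  0<n = ℕₚ.≤-pred (ℕ.nonTrivial⇒n>1 p {{prime⇒nonTrivial p-prime}})

  at-determines : ∀ f g → f HasDegree≤ n → g HasDegree≤ n →
    (∀ i → i < p → (F.fromℕ i at) f F.≈ (F.fromℕ i at) g) → f A.≈ g
  at-determines f g deg-f deg-g f≈g = RingProperties.x∙y⁻¹≈ε⇒x≈y A.ring f g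
    (roots n (f A.- g) F.fromℕ (degree-+ deg-f (degree-neg deg-g)) fromℕ-injective
      (λ i i<p → begin
        (F.fromℕ i at) (f A.- g)                      ≈⟨ at.x-y-homo (F.fromℕ i) f g ⟩
        (F.fromℕ i at) f F.- (F.fromℕ i at) g         ≈⟨ F.+-congʳ (f≈g i i<p) ⟩
        (F.fromℕ i at) g F.- (F.fromℕ i at) g         ≈⟨ F.-‿inverseʳ _ ⟩
        F.0#                                          ∎))
    where open SetoidReasoning F.setoid

  1-αⁿ : A.Carrier
  1-αⁿ = A.1# A.- A.α A.^ n

  1-αⁿ-at : ∀ a → (a at) 1-αⁿ F.≈ F.1# F.- a F.^ n
  1-αⁿ-at a = F.trans (at.x-y-homo a A.1# (A.α A.^ n)) (F.+-cong (at.1#-homo a)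
    (F.-‿cong (F.trans (at.^-homo a A.α n) (CommutativeSemiringExp.^-congˡ F.commutativeSemiring n (Eval.eval-X a)))))

  1-αⁿ-at-0 : (F.0# at) 1-αⁿ F.≈ F.1#
  1-αⁿ-at-0 = F.trans (1-αⁿ-at F.0#) (F.trans (F.+-congˡ (F.-‿cong (0^m≈0 0<n)))
      (F.trans (F.+-congˡ (RingProperties.-0#≈0# F.ring)) (F.+-identityʳ F.1#)))
    where
    0^m≈0 : ∀ {m} → 0 < m → F.0# F.^ m F.≈ F.0#
    0^m≈0 {suc m} _ = F.zeroˡ _

  -- The disjunction lets the two factors share the points of 𝔽ₚ* in any manner, so one criterion
  -- serves all products with different distributions of roots.
  product≈1-αⁿ : ∀ f g d d′ → f HasDegree≤ d → g HasDegree≤ d′ → d ℕ.+ d′ ≤ n →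
    (F.0# at) f F.≈ F.1# → (F.0# at) g F.≈ F.1# →
    (∀ k → 0 < k → k < p → (F.fromℕ k at) f F.≈ F.0# ⊎ (F.fromℕ k at) g F.≈ F.0#) →
    f A.* g A.≈ 1-αⁿ
  product≈1-αⁿ f g d d′ deg-f deg-g d+d′≤n f[0]≈1 g[0]≈1 root = at-determines (f A.* g) 1-αⁿ
      (degree-mono d+d′≤n (degree-* deg-f deg-g))
      (degree-+ {A.1#} degree-const (degree-neg {A.α A.^ n} (degree-^ degree-X n))) agree
    where
    open SetoidReasoning F.setoid
    zero-product : ∀ a → (a at) f F.≈ F.0# ⊎ (a at) g F.≈ F.0# → (a at) f F.* (a at) g F.≈ F.0#
    zero-product a (inj₁ f≈0) = F.trans (F.*-congʳ f≈0) (F.zeroˡ _)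
    zero-product a (inj₂ g≈0) = F.trans (F.*-congˡ g≈0) (F.zeroʳ _)
    agree : ∀ i → i < p → (F.fromℕ i at) (f A.* g) F.≈ (F.fromℕ i at) 1-αⁿ
    agree zero    _   = begin
      (F.0# at) (f A.* g)               ≈⟨ at.*-homo F.0# f g ⟩
      (F.0# at) f F.* (F.0# at) g       ≈⟨ F.*-cong f[0]≈1 g[0]≈1 ⟩
      F.1# F.* F.1#                     ≈⟨ F.*-identityˡ F.1# ⟩
      F.1#                              ≈⟨ 1-αⁿ-at-0 ⟨
      (F.0# at) 1-αⁿ                    ∎
    agree (suc i) i<p = begin
      (a at) (f A.* g)                  ≈⟨ at.*-homo a f g ⟩
      (a at) f F.* (a at) g             ≈⟨ zero-product a (root (suc i) (s≤s z≤n) i<p) ⟩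
      F.0#                              ≈⟨ F.-‿inverseʳ F.1# ⟨
      F.1# F.- F.1#                     ≈⟨ F.+-congˡ (F.-‿cong (x^n≈1 (fromℕ≉0 (p∤small (s≤s z≤n) i<p)))) ⟨
      F.1# F.- a F.^ n                  ≈⟨ 1-αⁿ-at a ⟨
      (a at) 1-αⁿ                       ∎
      where a = F.fromℕ (suc i)

  linear : ℕ → A.Carrier
  linear k = A.1# A.+ A.α A.* A.const (F.fromℕ k F.⁻¹)

  linear-at : ∀ a k → (a at) (linear k) F.≈ F.1# F.+ a F.* F.fromℕ k F.⁻¹
  linear-at a k = F.trans (at.+-homo a A.1# (A.α A.* A.const (F.fromℕ k F.⁻¹)))
    (F.+-cong (at.1#-homo a) (F.trans (at.*-homo a A.α (A.const (F.fromℕ k F.⁻¹)))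
      (F.*-cong (Eval.eval-X a) (Eval.eval-const a (F.fromℕ k F.⁻¹)))))

  linear-root : ∀ {k} → 0 < k → k < p → (F.fromℕ k at) (linear (p ∸ k)) F.≈ F.0#
  linear-root {k} 0<k k<p = begin
    (F.fromℕ k at) (linear (p ∸ k))   ≈⟨ linear-at (F.fromℕ k) (p ∸ k) ⟩
    F.1# F.+ F.fromℕ k F.* u F.⁻¹     ≈⟨ F.+-congˡ (F.*-congʳ k≈-u) ⟩
    F.1# F.+ F.- u F.* u F.⁻¹         ≈⟨ F.+-congʳ (F.*-inverseʳ u≉0) ⟨
    u F.* u F.⁻¹ F.+ F.- u F.* u F.⁻¹ ≈⟨ F.distribʳ _ u (F.- u) ⟨
    (u F.- u) F.* u F.⁻¹              ≈⟨ F.*-congʳ (F.-‿inverseʳ u) ⟩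
    F.0# F.* u F.⁻¹                   ≈⟨ F.zeroˡ _ ⟩
    F.0#                              ∎
    where
    open SetoidReasoning F.setoid
    u = F.fromℕ (p ∸ k)
    k≈-u : F.fromℕ k F.≈ F.- u
    k≈-u = F.trans (F.reflexive (≡.cong F.fromℕ (≡.sym (ℕₚ.m∸[m∸n]≡n (ℕₚ.<⇒≤ k<p)))))
      (fromℕ[p-k] (ℕₚ.m∸n≤m p k))
    u≉0 : ¬ u F.≈ F.0#
    u≉0 = fromℕ≉0 (p∤small (ℕₚ.m<n⇒0<n∸m k<p) (ℕₚ.∸-monoʳ-< 0<k (ℕₚ.<⇒≤ k<p)))

  -- Products of the λ_k written through their exponents: identities between such products become
  -- identities between floors.
  Λ : (ℕ → ℕ) → A.Carrier
  Λ e = fold n (λ i → linear (suc i) A.^ e (suc i))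

  Λ-cong : ∀ e e′ → (∀ k → 0 < k → k < p → e k ≡ e′ k) → Λ e A.≈ Λ e′
  Λ-cong e e′ e≡e′ = fold-cong n (λ i → linear (suc i) A.^ e (suc i)) (λ i → linear (suc i) A.^ e′ (suc i))
    (λ i i<n → A.reflexive (≡.cong (linear (suc i) A.^_) (e≡e′ (suc i) (s≤s z≤n) (s≤s i<n))))

  Λ-+ : ∀ e e′ → Λ (λ k → e k ℕ.+ e′ k) A.≈ Λ e A.* Λ e′
  Λ-+ e e′ = A.trans
    (fold-cong n (λ i → linear (suc i) A.^ (e (suc i) ℕ.+ e′ (suc i)))
      (λ i → linear (suc i) A.^ e (suc i) A.* linear (suc i) A.^ e′ (suc i))
      (λ i _ → CommutativeSemiringExp.^-homo-* A.commutativeSemiring (linear (suc i)) (e (suc i)) (e′ (suc i))))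
    (fold-∙ n (λ i → linear (suc i) A.^ e (suc i)) (λ i → linear (suc i) A.^ e′ (suc i)))

  degree-Λ : ∀ e → Λ e HasDegree≤ ℕFold.fold n (λ i → e (suc i))
  degree-Λ e = degree-∏ n (λ i → linear (suc i) A.^ e (suc i)) (λ i → e (suc i))
    (λ i _ → degree-^ (degree-+ {A.1#} degree-const
      (degree-* {n′ = 0} degree-X (degree-const {F.fromℕ (suc i) F.⁻¹}))) (e (suc i)))

  Λ-at : ∀ a e → (a at) (Λ e) F.≈ Fold.fold F.*-commutativeMonoid n (λ i → (a at) (linear (suc i)) F.^ e (suc i))
  Λ-at a e = F.trans (at.∏-homo a n (λ i → linear (suc i) A.^ e (suc i)))
    (Fold.fold-cong F.*-commutativeMonoid n (λ i → (a at) (linear (suc i) A.^ e (suc i)))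
      (λ i → (a at) (linear (suc i)) F.^ e (suc i))
      (λ i _ → at.^-homo a (linear (suc i)) (e (suc i))))

  Λ-at-0 : ∀ e → (F.0# at) (Λ e) F.≈ F.1#
  Λ-at-0 e = F.trans (Λ-at F.0# e) (F.trans
      (Fold.fold-cong F.*-commutativeMonoid n (λ i → (F.0# at) (linear (suc i)) F.^ e (suc i)) (λ _ → F.1#)
        (λ i _ → F.trans (CommutativeSemiringExp.^-congˡ F.commutativeSemiring (e (suc i))
            (F.trans (linear-at F.0# (suc i)) (F.trans (F.+-congˡ (F.zeroˡ _)) (F.+-identityʳ F.1#))))
          (1^m≈1 (e (suc i)))))
      (Fold.fold-ε F.*-commutativeMonoid n))

  Λ-root : ∀ e {k} → 0 < k → k < p → 0 < e (p ∸ k) → (F.fromℕ k at) (Λ e) F.≈ F.0#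
  Λ-root e {k} 0<k k<p 0<e = F.trans (Λ-at a e)
      -- The vanishing factor is `linear (p ∸ k)`; as the factors start with `linear 1`, its
      -- position is `n ∸ k`.
      (∏-zero F.commutativeRing n (λ i → (a at) (linear (suc i)) F.^ e (suc i)) (ℕₚ.∸-monoʳ-< 0<k (ℕₚ.≤-pred k<p))
        (≡.subst (λ m → (a at) (linear m) F.^ e m F.≈ F.0#) (ℕₚ.+-∸-assoc 1 (ℕₚ.≤-pred k<p)) (zero-power 0<e)))
    where
    a = F.fromℕ k
    zero-power : ∀ {m} → 0 < m → (a at) (linear (p ∸ k)) F.^ m F.≈ F.0#
    zero-power {suc m} _ = F.trans (F.*-congʳ (linear-root 0<k k<p)) (F.zeroˡ _)

  Λ1≈1-αⁿ : Λ (λ _ → 1) A.≈ 1-αⁿ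
  Λ1≈1-αⁿ = A.trans (A.sym (A.*-identityʳ _))
    (product≈1-αⁿ (Λ (λ _ → 1)) A.1# (ℕFold.fold n (λ _ → 1)) 0 (degree-Λ (λ _ → 1)) degree-const
      (ℕₚ.≤-reflexive (≡.trans (ℕₚ.+-identityʳ _) (∑-1 n)))
      (Λ-at-0 (λ _ → 1)) (at.1#-homo F.0#)
      (λ k 0<k k<p → inj₁ (Λ-root (λ _ → 1) 0<k k<p (s≤s z≤n))))

  -- The identity, taken as the homomorphism in `evaluate-homo`, gives congruence in the point of
  -- evaluation.
  at-cong : ∀ {x y} → x F.≈ y → ∀ f → (x at) f F.≈ (y at) f
  at-cong x≈y = evaluate-homo F.commutativeRing F.commutativeRing F.commutativeRing
    (id-hom F.commutativeRing) (λ _ → F.refl) x≈y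

  module Bar = Evaluation F.commutativeRing A.commutativeRing (const-hom F.commutativeRing) (A.- A.α)
  open Bar using () renaming (eval to bar)

  bar-at : ∀ a f → (a at) (bar f) F.≈ ((F.- a) at) f
  bar-at a f = evaluate-homo F.commutativeRing A.commutativeRing F.commutativeRing
    {κ = λ x → x} (Eval.eval-hom a) (Eval.eval-const a)
    (F.trans (at.-‿homo a A.α) (F.-‿cong (Eval.eval-X a))) f

  ⌊n/2⌋+⌊n/2⌋≤n : ⌊ n /2⌋ ℕ.+ ⌊ n /2⌋ ≤ n
  ⌊n/2⌋+⌊n/2⌋≤n = ℕₚ.≤-trans (ℕₚ.+-monoʳ-≤ ⌊ n /2⌋ (ℕₚ.⌊n/2⌋≤⌈n/2⌉ n))
    (ℕₚ.≤-reflexive (ℕₚ.⌊n/2⌋+⌈n/2⌉≡n n))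

  carry-cases : ∀ {s k} → 0 < s → s < n → 0 < k → k < p → carry s k ≡ 0 ⊎ carry s (p ∸ k) ≡ 0
  carry-cases {s} {k} 0<s s<n 0<k k<p with carry s k | carry s (p ∸ k) | carry-reflect {s} {k} 0<s s<n 0<k k<p
  ... | zero        | _    | _ = inj₁ ≡.refl
  ... | suc zero    | zero | _ = inj₂ ≡.refl

  module _ {s : ℕ} (0<s : 0 < s) (s<n : s < n) where

    degree-bar-b : bar (b s) HasDegree≤ ⌊ n /2⌋
    degree-bar-b = degree-eval (degree-neg degree-X) (degree-b 0<s s<n)

    bar-b-at-0 : (F.0# at) (bar (b s)) F.≈ F.1#
    bar-b-at-0 = F.trans (bar-at F.0# (b s))
      (F.trans (at-cong (RingProperties.-0#≈0# F.ring) (b s)) (b-at-0 0<s s<n))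

    bar-b-root : ∀ {k} → 0 < k → k < p → carry s (p ∸ k) ≡ 0 → (F.fromℕ k at) (bar (b s)) F.≈ F.0#
    bar-b-root {k} 0<k k<p carry≡0 = F.trans (bar-at (F.fromℕ k) (b s))
      (F.trans (at-cong (F.sym (fromℕ[p-k] (ℕₚ.<⇒≤ k<p))) (b s))
        (b-root 0<s s<n (ℕₚ.m<n⇒0<n∸m k<p) (ℕₚ.∸-monoʳ-< 0<k (ℕₚ.<⇒≤ k<p)) carry≡0))

    b*bar-b : b s A.* bar (b s) A.≈ 1-αⁿ
    b*bar-b = product≈1-αⁿ (b s) (bar (b s)) ⌊ n /2⌋ ⌊ n /2⌋ (degree-b 0<s s<n) degree-bar-b
      ⌊n/2⌋+⌊n/2⌋≤n (b-at-0 0<s s<n) bar-b-at-0 root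
      where
      root : ∀ k → 0 < k → k < p → (F.fromℕ k at) (b s) F.≈ F.0# ⊎ (F.fromℕ k at) (bar (b s)) F.≈ F.0#
      root k 0<k k<p with carry-cases 0<s s<n 0<k k<p
      ... | inj₁ c≡0 = inj₁ (b-root 0<s s<n 0<k k<p c≡0)
      ... | inj₂ c≡0 = inj₂ (bar-b-root 0<k k<p c≡0)

    -- At k either the exponent of λ_{p-k} is positive, and that factor vanishes, or it is 0, and
    -- then -k = p - k is a root of b_{1,s}. The degree of the product `Λ (carry s)` is the sum of
    -- its exponents, found in `∑-carry`.
    Λ*bar-b : Λ (carry s) A.* bar (b s) A.≈ 1-αⁿ
    Λ*bar-b = product≈1-αⁿ (Λ (carry s)) (bar (b s)) ⌊ n /2⌋ ⌊ n /2⌋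
      (≡.subst (Λ (carry s) HasDegree≤_) (∑-carry 0<s s<n) (degree-Λ (carry s))) degree-bar-b
      ⌊n/2⌋+⌊n/2⌋≤n (Λ-at-0 (carry s)) bar-b-at-0 root
      where
      root : ∀ k → 0 < k → k < p → (F.fromℕ k at) (Λ (carry s)) F.≈ F.0# ⊎ (F.fromℕ k at) (bar (b s)) F.≈ F.0#
      root k 0<k k<p with carry s (p ∸ k) in c≡
      ... | suc _ = inj₁ (Λ-root (carry s) 0<k k<p (≡.subst (0 <_) (≡.sym c≡) (s≤s z≤n)))
      ... | zero  = inj₂ (bar-b-root 0<k k<p c≡)

    bar-b≉0 : ¬ bar (b s) A.≈ A.0#
    bar-b≉0 bar-b≈0 = F.1≉0 (F.trans (F.sym bar-b-at-0) (at.⟦⟧-cong F.0# bar-b≈0))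

    b≈Λ : b s A.≈ Λ (carry s)
    b≈Λ = A.*-cancelʳ bar-b≉0 (A.trans b*bar-b (A.sym Λ*bar-b))

  -- The symmetry is read off the exponents of the two factorisations, where it is
  -- `carry-complement`.
  b-symmetric : ∀ {s} → 0 < s → s < n → b (n ∸ s) A.≈ b s
  b-symmetric {s} 0<s s<n = A.trans (b≈Λ (ℕₚ.m<n⇒0<n∸m s<n) (ℕₚ.∸-monoʳ-< 0<s (ℕₚ.<⇒≤ s<n)))
    (A.trans (Λ-cong (carry (n ∸ s)) (carry s) (λ k 0<k k<p → carry-complement 0<s s<n 0<k k<p))
      (A.sym (b≈Λ 0<s s<n)))

  ∏b≈Λ : ∀ j → j < n → fold j (λ i → b (suc i)) A.≈ Λ (λ k → ⌊ suc j * k /p⌋)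
  ∏b≈Λ zero    _   = A.sym (A.trans (Λ-cong (λ k → ⌊ 1 * k /p⌋) (λ _ → 0) (λ k _ k<p → ⌊1*k⌋ k<p)) (fold-ε n))
  ∏b≈Λ (suc j) j<n = begin
    fold (suc j) (λ i → b (suc i))
      ≈⟨ fold-last j (λ i → b (suc i)) ⟩
    fold j (λ i → b (suc i)) A.* b (suc j)
      ≈⟨ A.*-cong (∏b≈Λ j (ℕₚ.<⇒≤ j<n)) (b≈Λ (s≤s z≤n) j<n) ⟩
    Λ (λ k → ⌊ suc j * k /p⌋) A.* Λ (carry (suc j))
      ≈⟨ Λ-+ (λ k → ⌊ suc j * k /p⌋) (carry (suc j)) ⟨
    Λ (λ k → ⌊ suc j * k /p⌋ ℕ.+ carry (suc j) k)
      ≈⟨ Λ-cong _ (λ k → ⌊ suc (suc j) * k /p⌋) (λ k _ _ → ⌊⌋-step {suc j} {k}) ⟩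
    Λ (λ k → ⌊ suc (suc j) * k /p⌋) ∎
    where open SetoidReasoning A.setoid

  -- Since k = 1 + ⌊(p-1)k/p⌋, the exponent splits into a constant 1, which gives the factor 1 - αⁿ,
  -- and the end of the telescope `∏b≈Λ`.
  ∏linear : Λ (λ k → k) A.≈ 1-αⁿ A.* fold (n ∸ 1) (λ i → b (suc i))
  ∏linear = begin
    Λ (λ k → k)
      ≈⟨ Λ-cong _ (λ k → suc ⌊ n * k /p⌋) (λ k 0<k k<p → ≡.sym (⌊n*k⌋ 0<n 0<k k<p)) ⟩
    Λ (λ k → suc ⌊ n * k /p⌋)
      ≈⟨ Λ-+ (λ _ → 1) (λ k → ⌊ n * k /p⌋) ⟩
    Λ (λ _ → 1) A.* Λ (λ k → ⌊ n * k /p⌋)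
      ≈⟨ A.*-cong Λ1≈1-αⁿ (A.sym (≡.subst (λ m → fold (n ∸ 1) (λ i → b (suc i)) A.≈ Λ (λ k → ⌊ m * k /p⌋))
           (ℕₚ.m+[n∸m]≡n 0<n) (∏b≈Λ (n ∸ 1) (ℕₚ.∸-monoʳ-< (s≤s z≤n) 0<n)))) ⟩
    1-αⁿ A.* fold (n ∸ 1) (λ i → b (suc i)) ∎
    where open SetoidReasoning A.setoid

  eval-α : ∀ f → evaluate F.commutativeRing A.commutativeRing A.const f A.α A.≈ f
  eval-α = eval-X-const F.commutativeRing

-- Comparison of coefficients

module _ (R : CommutativeRing c ℓ) (S : CommutativeRing d m)
  {ι : CommutativeRing.Carrier R → CommutativeRing.Carrier S} (ι-hom : Homomorphism R S ι)
  (y : CommutativeRing.Carrier S) where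
  private
    module S = CommutativeRing S
    module P = Polynomial R
    module Pₙ = RingNotation P.commutativeRing
    module Sₙ = RingNotation S
    module PF = Fold (CommutativeRing.+-commutativeMonoid P.commutativeRing)
    module SF = Fold S.+-commutativeMonoid
    module Ev = Evaluation R S ι-hom y
    module EvH = HomomorphismProperties P.commutativeRing S Ev.eval-hom

  eval-sum : ∀ n (a : ℕ → CommutativeRing.Carrier R) (e : ℕ → ℕ) →
    evaluate R S ι (P.- PF.fold n (λ i → P.const (a i) P.* P.X Pₙ.^ e i)) y
      S.≈ S.- SF.fold n (λ i → ι (a i) S.* y Sₙ.^ e i)
  eval-sum n a e = S.trans (EvH.-‿homo (PF.fold n monomial))
    (S.-‿cong (S.trans (EvH.∑-homo n monomial)
      (SF.fold-cong n (λ i → Ev.eval (monomial i)) (λ i → ι (a i) S.* y Sₙ.^ e i) (λ i _ →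
        S.trans (EvH.*-homo (P.const (a i)) (P.X Pₙ.^ e i))
          (S.*-cong (Ev.eval-const (a i)) (S.trans (EvH.^-homo P.X (e i))
            (CommutativeSemiringExp.^-congˡ S.commutativeSemiring (e i) Ev.eval-X)))))))
    where
    monomial : ℕ → P.Poly
    monomial i = P.const (a i) P.* P.X Pₙ.^ e i

-- Pairing the power k of X with the power p - k of U/X

module Duality (𝕂 : Field c ℓ) (Kₓ : IntegralDomain d m) (n : ℕ) where
  private
    module P = IntegralDomain Kₓ
    module K = Field 𝕂
    module Kₙ = RingNotation K.commutativeRing

  module Coefficients
    {const : K.Carrier → P.Carrier} (const-homo : Homomorphism K.commutativeRing P.commutativeRing const)
    (Xₚ : P.Carrier)
    (fromℕ-p≈0 : Kₙ.fromℕ (suc n) K.≈ K.0#)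
    (fromℕ≉0 : ∀ {k} → 0 < k → k < suc n → ¬ Kₙ.fromℕ k K.≈ K.0#)
    (u : K.Carrier) (u≉0 : ¬ u K.≈ K.0#)
    (β β′ : ℕ → K.Carrier)
    (β*β′≈u : ∀ {s} → 0 < s → s < n → β s K.* β′ s K.≈ u)
    (β-symmetric : ∀ {s} → 0 < s → s < n → β (n ∸ s) K.≈ β s)
    where

    private
      p = suc n
      𝕃 = FractionField.fractionField Kₓ
      module Pₙ = RingNotation P.commutativeRing
      module L where
        open Field 𝕃 public
        open RingNotation commutativeRing public
        open FractionField Kₓ public using (embed)
      module KF = Fold K.*-commutativeMonoid
      module PF = Fold P.+-commutativeMonoid
      module LF = Fold L.+-commutativeMonoid
      module E = HomomorphismProperties P.commutativeRing L.commutativeRing (embed-hom Kₓ)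
      module Lexp = CommutativeSemiringExp L.commutativeSemiring

      constant : K.Carrier → L.Carrier
      constant a = L.embed (const a)

      constant-hom : Homomorphism K.commutativeRing L.commutativeRing constant
      constant-hom = Composition.isRingHomomorphism L.trans
        const-homo (embed-hom Kₓ)
      module Con = HomomorphismProperties K.commutativeRing L.commutativeRing constant-hom

      D D′ : ℕ → K.Carrier
      D  j = KF.fold j (λ i → β (suc i))
      D′ j = KF.fold j (λ i → β′ (suc i))

      D*D′≈u^ : ∀ j → j < n → D j K.* D′ j K.≈ u Kₙ.^ j
      D*D′≈u^ zero    _   = K.*-identityˡ K.1#
      D*D′≈u^ (suc j) j<n = begin
        D (suc j) K.* D′ (suc j)
          ≈⟨ K.*-cong (KF.fold-last j (λ i → β (suc i))) (KF.fold-last j (λ i → β′ (suc i))) ⟩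
        (D j K.* β (suc j)) K.* (D′ j K.* β′ (suc j))
          ≈⟨ solve 4 (λ d x d′ x′ → (d :* x) :* (d′ :* x′) := (x :* x′) :* (d :* d′)) K.refl
               (D j) (β (suc j)) (D′ j) (β′ (suc j)) ⟩
        (β (suc j) K.* β′ (suc j)) K.* (D j K.* D′ j)
          ≈⟨ K.*-cong (β*β′≈u (s≤s z≤n) j<n) (D*D′≈u^ j (ℕₚ.<⇒≤ j<n)) ⟩
        u Kₙ.^ suc j ∎
        where
        open SetoidReasoning K.setoid
        open NaturalSolver K.commutativeSemiring

      -- By the symmetry the last factor β(i+1) of `D i` is also the next factor β(j+1) missing from
      -- `D j`; the factors move over one by one until the first product is empty. With i = k - 1
      -- and j = p - k - 1 these are the products in the coefficients of index k and p - k.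
      D*D≈D : ∀ i j → suc (i ℕ.+ j) ≡ n → D i K.* D j K.≈ D (n ∸ 1)
      D*D≈D zero    j ≡.refl = K.*-identityˡ _
      D*D≈D (suc i) j 2+i+j≡n = begin
        D (suc i) K.* D j                       ≈⟨ K.*-congʳ (KF.fold-last i (λ k → β (suc k))) ⟩
        D i K.* β (suc i) K.* D j               ≈⟨ K.*-assoc _ _ _ ⟩
        D i K.* (β (suc i) K.* D j)             ≈⟨ K.*-congˡ (K.*-comm _ _) ⟩
        D i K.* (D j K.* β (suc i))             ≈⟨ K.*-congˡ (K.*-congˡ (β-symmetric (s≤s z≤n) i<n)) ⟨
        D i K.* (D j K.* β (n ∸ suc i))         ≡⟨ ≡.cong (λ m → D i K.* (D j K.* β m)) n-i≡j ⟩
        D i K.* (D j K.* β (suc j))             ≈⟨ K.*-congˡ (KF.fold-last j (λ k → β (suc k))) ⟨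
        D i K.* D (suc j)                       ≈⟨ D*D≈D i (suc j) (≡.trans (≡.cong suc (ℕₚ.+-suc i j)) 2+i+j≡n) ⟩
        D (n ∸ 1)                               ∎
        where
        open SetoidReasoning K.setoid
        i<n : suc i < n
        i<n = ≡.subst (suc i <_) 2+i+j≡n (s≤s (s≤s (ℕₚ.m≤m+n i j)))
        n-i≡j : n ∸ suc i ≡ suc j
        n-i≡j = ≡.trans (≡.cong (_∸ suc i) (≡.sym 2+i+j≡n))
          (≡.trans (≡.cong (_∸ i) (≡.sym (ℕₚ.+-suc i j))) (ℕₚ.m+n∸m≡n i (suc j)))

      x^m≉0 : ∀ {x} → ¬ x K.≈ K.0# → ∀ m → ¬ x Kₙ.^ m K.≈ K.0#
      x^m≉0 x≉0 zero    = K.1≉0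
      x^m≉0 x≉0 (suc m) = IntegralDomain.*-nonZero K.integralDomain x≉0 (x^m≉0 x≉0 m)

      -- `D j` divides a power of u, so its nonvanishing reduces to that of u; the denominators of
      -- the coefficients are thereby genuine.
      D≉0 : ∀ j → j < n → ¬ D j K.≈ K.0#
      D≉0 j j<n Dj≈0 = x^m≉0 u≉0 j
        (K.trans (K.sym (D*D′≈u^ j j<n)) (K.trans (K.*-congʳ Dj≈0) (K.zeroˡ _)))

      D′≉0 : ∀ j → j < n → ¬ D′ j K.≈ K.0#
      D′≉0 j j<n D′j≈0 = x^m≉0 u≉0 j
        (K.trans (K.sym (D*D′≈u^ j j<n)) (K.trans (K.*-congˡ D′j≈0) (K.zeroʳ _)))

    coefficient : (ℕ → K.Carrier) → ℕ → K.Carrier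
    coefficient β k = K.1# K./ Kₙ.fromℕ k K./ (Kₙ.∏[ 1 ⋯< k ] β)

    G : (ℕ → K.Carrier) → P.Carrier
    G β = P.- (Pₙ.∑[ 1 ⋯< p ] λ k → const (coefficient β k) P.* Xₚ Pₙ.^ k)

    module _ (C : K.Carrier) (C≈u*D : C K.≈ u K.* KF.fold (n ∸ 1) (λ i → β (suc i)))
      (ξ : L.Carrier) (X*ξ≈u : L.embed Xₚ L.* ξ L.≈ constant u) where

      coefficient-duality : ∀ i j → suc (i ℕ.+ j) ≡ n →
        C K.* coefficient β (suc i) K.+ coefficient β′ (suc j) K.* u Kₙ.^ suc j K.≈ K.0#
      coefficient-duality i j 1+i+j≡n = begin
        C K.* (K.1# K.* x⁻¹ K.* D i K.⁻¹) K.+ (K.1# K.* y⁻¹ K.* D′ j K.⁻¹) K.* (u K.* u Kₙ.^ j)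
          -- C becomes u D_i D_j and uʲ becomes D_j D′_j. The denominators then cancel, and both
          -- terms have the common factor u D_j, next to 1/(i+1) and 1/(j+1).
          ≈⟨ K.+-cong (K.*-congʳ (K.trans C≈u*D (K.*-congˡ (K.sym (D*D≈D i j 1+i+j≡n)))))
                      (K.*-congˡ (K.*-congˡ (K.sym (D*D′≈u^ j j<n)))) ⟩
        (u K.* (D i K.* D j)) K.* (K.1# K.* x⁻¹ K.* D i K.⁻¹)
          K.+ (K.1# K.* y⁻¹ K.* D′ j K.⁻¹) K.* (u K.* (D j K.* D′ j))
          ≈⟨ solve 8 (λ u di dj di⁻ x y dj′ dj′⁻ →
               (u :* (di :* dj)) :* (con 1 :* x :* di⁻) :+ (con 1 :* y :* dj′⁻) :* (u :* (dj :* dj′))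
               := (x :* (di :* di⁻) :+ y :* (dj′ :* dj′⁻)) :* (u :* dj)) K.refl
               u (D i) (D j) (D i K.⁻¹) x⁻¹ y⁻¹ (D′ j) (D′ j K.⁻¹) ⟩
        (x⁻¹ K.* (D i K.* D i K.⁻¹) K.+ y⁻¹ K.* (D′ j K.* D′ j K.⁻¹)) K.* (u K.* D j)
          ≈⟨ K.*-congʳ (K.+-cong
               (K.trans (K.*-congˡ (K.*-inverseʳ (D≉0 i i<n))) (K.*-identityʳ _))
               (K.trans (K.*-congˡ (K.*-inverseʳ (D′≉0 j j<n))) (K.*-identityʳ _))) ⟩
        (x⁻¹ K.+ y⁻¹) K.* (u K.* D j)
          ≈⟨ K.*-congʳ x⁻¹+y⁻¹≈0 ⟩
        K.0# K.* (u K.* D j)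
          ≈⟨ K.zeroˡ _ ⟩
        K.0# ∎
        where
        open SetoidReasoning K.setoid
        open NaturalSolver K.commutativeSemiring
        i<n : i < n
        i<n = ≡.subst (i <_) 1+i+j≡n (s≤s (ℕₚ.m≤m+n i j))
        j<n : j < n
        j<n = ≡.subst (j <_) 1+i+j≡n (s≤s (ℕₚ.m≤n+m j i))
        x y x⁻¹ y⁻¹ : K.Carrier
        x = Kₙ.fromℕ (suc i)
        y = Kₙ.fromℕ (suc j)
        x⁻¹ = x K.⁻¹
        y⁻¹ = y K.⁻¹
        xx⁻¹≈1 : x K.* x⁻¹ K.≈ K.1#
        xx⁻¹≈1 = K.*-inverseʳ (fromℕ≉0 (s≤s z≤n) (s≤s i<n))
        yy⁻¹≈1 : y K.* y⁻¹ K.≈ K.1#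
        yy⁻¹≈1 = K.*-inverseʳ (fromℕ≉0 (s≤s z≤n) (s≤s j<n))
        x+y≈0 : x K.+ y K.≈ K.0#
        x+y≈0 = begin
          x K.+ y                                ≈⟨ SemiringMult.×-homo-+ K.semiring K.1# (suc i) (suc j) ⟨
          Kₙ.fromℕ (suc i ℕ.+ suc j)             ≡⟨ ≡.cong Kₙ.fromℕ (≡.cong suc (≡.trans (ℕₚ.+-suc i j) 1+i+j≡n)) ⟩
          Kₙ.fromℕ (suc n)                       ≈⟨ fromℕ-p≈0 ⟩
          K.0#                                   ∎
        x⁻¹+y⁻¹≈0 : x⁻¹ K.+ y⁻¹ K.≈ K.0#
        x⁻¹+y⁻¹≈0 = begin
          x⁻¹ K.+ y⁻¹
            ≈⟨ K.+-cong (K.trans (K.*-congˡ yy⁻¹≈1) (K.*-identityʳ x⁻¹)) (K.trans (K.*-congˡ xx⁻¹≈1) (K.*-identityʳ y⁻¹)) ⟨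
          x⁻¹ K.* (y K.* y⁻¹) K.+ y⁻¹ K.* (x K.* x⁻¹)
            ≈⟨ solve 4 (λ x y x⁻ y⁻ → x⁻ :* (y :* y⁻) :+ y⁻ :* (x :* x⁻) := (x :+ y) :* (x⁻ :* y⁻)) K.refl x y x⁻¹ y⁻¹ ⟩
          (x K.+ y) K.* (x⁻¹ K.* y⁻¹)
            ≈⟨ K.*-congʳ x+y≈0 ⟩
          K.0# K.* (x⁻¹ K.* y⁻¹)
            ≈⟨ K.zeroˡ _ ⟩
          K.0# ∎

      private
        X : L.Carrier
        X = L.embed Xₚ

        -- ξ plays the role of U/X and is known only through X ξ = u. Each power of ξ uses up one
        -- power of X, and `m ≤ p` leaves a natural exponent.
        X^p*ξ^m : ∀ {m} → m ≤ p → X L.^ p L.* ξ L.^ m L.≈ constant (u Kₙ.^ m) L.* X L.^ (p ∸ m)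
        X^p*ξ^m {m} m≤p = begin
          X L.^ p L.* ξ L.^ m
            ≡⟨ ≡.cong (λ k → X L.^ k L.* ξ L.^ m) (ℕₚ.m∸n+n≡m m≤p) ⟨
          X L.^ (p ∸ m ℕ.+ m) L.* ξ L.^ m
            ≈⟨ L.*-congʳ {ξ L.^ m} (Lexp.^-homo-* X (p ∸ m) m) ⟩
          X L.^ (p ∸ m) L.* X L.^ m L.* ξ L.^ m
            ≈⟨ L.*-assoc (X L.^ (p ∸ m)) (X L.^ m) (ξ L.^ m) ⟩
          X L.^ (p ∸ m) L.* (X L.^ m L.* ξ L.^ m)
            ≈⟨ L.*-congˡ {X L.^ (p ∸ m)} (Lexp.^-distrib-* X ξ m) ⟨
          X L.^ (p ∸ m) L.* (X L.* ξ) L.^ m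
            ≈⟨ L.*-congˡ {X L.^ (p ∸ m)} (Lexp.^-congˡ m X*ξ≈u) ⟩
          X L.^ (p ∸ m) L.* constant u L.^ m
            ≈⟨ L.*-congˡ {X L.^ (p ∸ m)} (Con.^-homo u m) ⟨
          X L.^ (p ∸ m) L.* constant (u Kₙ.^ m)
            ≈⟨ L.*-comm (X L.^ (p ∸ m)) (constant (u Kₙ.^ m)) ⟩
          constant (u Kₙ.^ m) L.* X L.^ (p ∸ m) ∎
          where open SetoidReasoning L.setoid

        monomial : (ℕ → K.Carrier) → ℕ → P.Carrier
        monomial γ i = const (coefficient γ (suc i)) P.* Xₚ Pₙ.^ suc i

        embed-monomial : ∀ γ i → L.embed (monomial γ i) L.≈ constant (coefficient γ (suc i)) L.* X L.^ suc i
        embed-monomial γ i = L.trans (E.*-homo (const (coefficient γ (suc i))) (Xₚ Pₙ.^ suc i))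
          (L.*-congˡ {constant (coefficient γ (suc i))} (E.^-homo Xₚ (suc i)))

        value : (ℕ → K.Carrier) → ℕ → L.Carrier
        value γ i = constant (coefficient γ (suc i)) L.* ξ L.^ suc i

        Σ Σ′ : L.Carrier
        Σ  = LF.fold n (λ i → L.embed (monomial β i))
        Σ′ = LF.fold n (λ i → value β′ i)

        term-duality : ∀ i → i < n →
          constant C L.* L.embed (monomial β i) L.+ X L.^ p L.* value β′ (n ∸ suc i) L.≈ L.0#
        term-duality i i<n = begin
          constant C L.* L.embed (monomial β i) L.+ X L.^ p L.* value β′ j
            ≈⟨ L.+-congʳ {X L.^ p L.* value β′ j} (L.*-congˡ {constant C} (embed-monomial β i)) ⟩
          constant C L.* (constant a L.* X L.^ suc i) L.+ X L.^ p L.* (constant a′ L.* ξ L.^ suc j)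
            ≈⟨ solve 6 (λ C a x z a′ w → C :* (a :* x) :+ z :* (a′ :* w) := C :* a :* x :+ a′ :* (z :* w)) L.refl
                 (constant C) (constant a) (X L.^ suc i) (X L.^ p) (constant a′) (ξ L.^ suc j) ⟩
          constant C L.* constant a L.* X L.^ suc i L.+ constant a′ L.* (X L.^ p L.* ξ L.^ suc j)
            ≈⟨ L.+-congˡ {constant C L.* constant a L.* X L.^ suc i}
               -- With j + 1 = n - i the remaining power of X is p - (j+1) = i + 1, the same as in
               -- the first term.
               (L.*-congˡ {constant a′} (L.trans (X^p*ξ^m (s≤s (ℕₚ.m∸n≤m n (suc i))))
                 (L.reflexive (≡.cong (λ m → constant (u Kₙ.^ suc j) L.* X L.^ m) (ℕₚ.m∸[m∸n]≡n i<n))))) ⟩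
          constant C L.* constant a L.* X L.^ suc i L.+ constant a′ L.* (constant (u Kₙ.^ suc j) L.* X L.^ suc i)
            ≈⟨ solve 5 (λ C a a′ w x → C :* a :* x :+ a′ :* (w :* x) := (C :* a :+ a′ :* w) :* x) L.refl
                 (constant C) (constant a) (constant a′) (constant (u Kₙ.^ suc j)) (X L.^ suc i) ⟩
          (constant C L.* constant a L.+ constant a′ L.* constant (u Kₙ.^ suc j)) L.* X L.^ suc i
            ≈⟨ L.*-congʳ {X L.^ suc i} (L.trans
                 (L.+-cong (L.sym (Con.*-homo C a)) (L.sym (Con.*-homo a′ (u Kₙ.^ suc j))))
                 (L.sym (Con.+-homo (C K.* a) (a′ K.* u Kₙ.^ suc j)))) ⟩
          constant (C K.* a K.+ a′ K.* u Kₙ.^ suc j) L.* X L.^ suc i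
            ≈⟨ L.*-congʳ {X L.^ suc i} (Con.⟦⟧-cong (coefficient-duality i j (ℕₚ.m+[n∸m]≡n i<n))) ⟩
          constant K.0# L.* X L.^ suc i
            ≈⟨ L.*-congʳ {X L.^ suc i} Con.0#-homo ⟩
          L.0# L.* X L.^ suc i
            ≈⟨ L.zeroˡ (X L.^ suc i) ⟩
          L.0# ∎
          where
          open SetoidReasoning L.setoid
          open NaturalSolver L.commutativeSemiring
          j = n ∸ suc i
          a = coefficient β (suc i)
          a′ = coefficient β′ (suc j)

        sum-duality : constant C L.* Σ L.+ X L.^ p L.* Σ′ L.≈ L.0#
        sum-duality = begin
          constant C L.* Σ L.+ X L.^ p L.* Σ′
            -- Reversing the second sum places the power p - k of ξ opposite the power k of X.
            ≈⟨ L.+-congˡ {constant C L.* Σ} (L.*-congˡ {X L.^ p} (LF.fold-reverse n (λ i → value β′ i))) ⟩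
          constant C L.* Σ L.+ X L.^ p L.* LF.fold n (λ i → value β′ (n ∸ suc i))
            ≈⟨ L.+-cong (fold-*ˡ n (constant C) (λ i → L.embed (monomial β i)))
                        (fold-*ˡ n (X L.^ p) (λ i → value β′ (n ∸ suc i))) ⟨
          LF.fold n (λ i → constant C L.* L.embed (monomial β i))
            L.+ LF.fold n (λ i → X L.^ p L.* value β′ (n ∸ suc i))
            ≈⟨ LF.fold-∙ n (λ i → constant C L.* L.embed (monomial β i))
                           (λ i → X L.^ p L.* value β′ (n ∸ suc i)) ⟨
          LF.fold n (λ i → constant C L.* L.embed (monomial β i) L.+ X L.^ p L.* value β′ (n ∸ suc i))
            ≈⟨ LF.fold-cong n _ (λ _ → L.0#) term-duality ⟩
          LF.fold n (λ _ → L.0#)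
            ≈⟨ LF.fold-ε n ⟩
          L.0# ∎
          where
          open SetoidReasoning L.setoid
          open Convolution L.commutativeRing using (fold-*ˡ)

      duality : ∀ v → v L.≈ L.- LF.fold n (λ i → constant (coefficient β′ (suc i)) L.* ξ L.^ suc i) →
        L.embed (const C P.* G β) L.≈ L.- (X L.^ p L.* v)
      duality v v≈-Σ′ = begin
        L.embed (const C P.* G β)             ≈⟨ E.*-homo (const C) (G β) ⟩
        constant C L.* L.embed (G β)          ≈⟨ L.*-congˡ {constant C} (L.trans (E.-‿homo (PF.fold n (monomial β)))
                                                   (L.-‿cong (E.∑-homo n (monomial β)))) ⟩
        constant C L.* L.- Σ                  ≈⟨ -‿distribʳ-* (constant C) Σ ⟨
        L.- (constant C L.* Σ)                ≈⟨ L.-‿cong (inverseˡ-unique (constant C L.* Σ) (X L.^ p L.* Σ′) sum-duality) ⟩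
        L.- (L.- (X L.^ p L.* Σ′))            ≈⟨ L.-‿cong (-‿distribʳ-* (X L.^ p) Σ′) ⟩
        L.- (X L.^ p L.* L.- Σ′)              ≈⟨ L.-‿cong (L.*-congˡ {X L.^ p} v≈-Σ′) ⟨
        L.- (X L.^ p L.* v)                   ∎
        where
        open SetoidReasoning L.setoid
        open RingProperties L.ring using (-‿distribʳ-*) renaming (+-inverseˡ-unique to inverseˡ-unique)

-- Rational functions over 𝔽ₚ

module Scalars (F : Field c ℓ) (D : IntegralDomain d m) where
  open FractionField D using (embed)
  private
    module F = Field F
    module Fₙ = RingNotation F.commutativeRing
    module A = IntegralDomain D
    module K = Field (FractionField.fractionField D)
    module Kₙ = RingNotation K.commutativeRing

  module Embedding
    {ι : F.Carrier → A.Carrier} (ι-hom : Homomorphism F.commutativeRing A.commutativeRing ι)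
    (ι-injective : ∀ {a} → ι a A.≈ A.0# → a F.≈ F.0#)
    (n : ℕ) (fromℕ-p≈0 : Fₙ.fromℕ (suc n) F.≈ F.0#)
    (fromℕ≉0 : ∀ {k} → 0 < k → k < suc n → ¬ Fₙ.fromℕ k F.≈ F.0#)
    where

    private
      K-field = FractionField.fractionField D

      scalar : F.Carrier → K.Carrier
      scalar a = embed (ι a)

      scalar-hom : Homomorphism F.commutativeRing K.commutativeRing scalar
      scalar-hom = Composition.isRingHomomorphism K.trans ι-hom (embed-hom D)

      module E = HomomorphismProperties A.commutativeRing K.commutativeRing (embed-hom D)
      module S = HomomorphismProperties F.commutativeRing K.commutativeRing scalar-hom

    scalar-fromℕ≉0 : ∀ {k} → 0 < k → k < suc n → ¬ Kₙ.fromℕ k K.≈ K.0#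
    scalar-fromℕ≉0 {k} 0<k k<p k≈0 = fromℕ≉0 0<k k<p (ι-injective
      (FractionField.embed-injective D {ι (Fₙ.fromℕ k)} {A.0#} (K.trans (S.fromℕ-homo k) k≈0)))

    scalar-fromℕ-p≈0 : Kₙ.fromℕ (suc n) K.≈ K.0#
    scalar-fromℕ-p≈0 = K.trans (K.sym (S.fromℕ-homo (suc n)))
      (K.trans (S.⟦⟧-cong fromℕ-p≈0) S.0#-homo)

    -- The inverse of k is formed in the small field on the left, while `r` is an inverse in the
    -- fraction field. Both invert the image of k, so they agree by cancellation.
    embed-linear : ∀ α {k} r → 0 < k → k < suc n → Kₙ.fromℕ k K.* r K.≈ K.1# →
      embed (A.1# A.+ α A.* ι (Fₙ.fromℕ k F.⁻¹)) K.≈ K.1# K.+ embed α K.* r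
    embed-linear α {k} r 0<k k<p kr≈1 = K.trans (E.+-homo A.1# (α A.* ι k⁻¹))
      (K.+-cong E.1#-homo (K.trans (E.*-homo α (ι k⁻¹)) (K.*-congˡ {embed α}
        (FieldProperties.*-cancelʳ K-field {scalar k⁻¹} {r} (scalar-fromℕ≉0 0<k k<p) (begin
          scalar k⁻¹ K.* Kₙ.fromℕ k                 ≈⟨ K.*-congˡ {scalar k⁻¹} (S.fromℕ-homo k) ⟨
          scalar k⁻¹ K.* scalar (Fₙ.fromℕ k)        ≈⟨ S.*-homo k⁻¹ (Fₙ.fromℕ k) ⟨
          scalar (k⁻¹ F.* Fₙ.fromℕ k)               ≈⟨ S.⟦⟧-cong (F.trans (F.*-comm k⁻¹ _) (F.*-inverseʳ (fromℕ≉0 0<k k<p))) ⟩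
          scalar F.1#                               ≈⟨ S.1#-homo ⟩
          K.1#                                      ≈⟨ kr≈1 ⟨
          Kₙ.fromℕ k K.* r                          ≈⟨ K.*-comm (Kₙ.fromℕ k) r ⟩
          r K.* Kₙ.fromℕ k                          ∎)))))
      where
      open SetoidReasoning K.setoid
      k⁻¹ = Fₙ.fromℕ k F.⁻¹

module RationalFunctions (D : IntegralDomain d m) where
  open FractionField D using (embed)
  private
    module A = IntegralDomain D
    module Aₙ = RingNotation A.commutativeRing
    module K = Field (FractionField.fractionField D)
    module Kₙ = RingNotation K.commutativeRing

  module Embedding
    (n : ℕ) (α : A.Carrier) (linear b b̄ : ℕ → A.Carrier)
    (1-αⁿ≉0 : ¬ A.1# A.- α Aₙ.^ n A.≈ A.0#)
    (b*b̄ : ∀ {s} → 0 < s → s < n → b s A.* b̄ s A.≈ A.1# A.- α Aₙ.^ n)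
    (b-symmetric : ∀ {s} → 0 < s → s < n → b (n ∸ s) A.≈ b s)
    (∏linear : Fold.fold A.*-commutativeMonoid n (λ i → linear (suc i) Aₙ.^ suc i)
               A.≈ (A.1# A.- α Aₙ.^ n) A.* Fold.fold A.*-commutativeMonoid (n ∸ 1) (λ i → b (suc i)))
    (λ′ β β′ : ℕ → K.Carrier)
    (embed-linear : ∀ {k} → 0 < k → k < suc n → embed (linear k) K.≈ λ′ k)
    (embed-b : ∀ s → embed (b s) K.≈ β s)
    (embed-b̄ : ∀ s → embed (b̄ s) K.≈ β′ s)
    where

    private
      module E = HomomorphismProperties A.commutativeRing K.commutativeRing (embed-hom D)
      module KF = Fold K.*-commutativeMonoid
      open Fold A.*-commutativeMonoid using (fold)

      1-αⁿ : A.Carrier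
      1-αⁿ = A.1# A.- α Aₙ.^ n

      u : K.Carrier
      u = K.1# K.- embed α Kₙ.^ n

      embed-1-αⁿ : embed 1-αⁿ K.≈ u
      embed-1-αⁿ = K.trans (E.x-y-homo A.1# (α Aₙ.^ n)) (K.+-cong E.1#-homo (K.-‿cong (E.^-homo α n)))

    u≉0 : ¬ u K.≈ K.0#
    u≉0 u≈0 = 1-αⁿ≉0 (FractionField.embed-injective D {1-αⁿ} {A.0#} (K.trans embed-1-αⁿ u≈0))

    β*β′≈u : ∀ {s} → 0 < s → s < n → β s K.* β′ s K.≈ u
    β*β′≈u {s} 0<s s<n = begin
      β s K.* β′ s                                        ≈⟨ K.*-cong (embed-b s) (embed-b̄ s) ⟨
      embed (b s) K.* embed (b̄ s)  ≈⟨ E.*-homo (b s) (b̄ s) ⟨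
      embed (b s A.* b̄ s)        ≈⟨ E.⟦⟧-cong (b*b̄ 0<s s<n) ⟩
      embed 1-αⁿ                                    ≈⟨ embed-1-αⁿ ⟩
      u                                                   ∎
      where open SetoidReasoning K.setoid

    β-symmetric : ∀ {s} → 0 < s → s < n → β (n ∸ s) K.≈ β s
    β-symmetric {s} 0<s s<n = K.trans (K.sym (embed-b (n ∸ s)))
      (K.trans (E.⟦⟧-cong (b-symmetric 0<s s<n)) (embed-b s))

    C≈u*D : (Kₙ.∏[ 1 ⋯< suc n ] λ k → λ′ k Kₙ.^ k) K.≈ u K.* KF.fold (n ∸ 1) (λ i → β (suc i))
    C≈u*D = begin
      KF.fold n (λ i → λ′ (suc i) Kₙ.^ suc i)
        ≈⟨ KF.fold-cong n (λ i → embed (linear (suc i) Aₙ.^ suc i)) (λ i → λ′ (suc i) Kₙ.^ suc i)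
             (λ i i<n → K.trans (E.^-homo (linear (suc i)) (suc i))
               (CommutativeSemiringExp.^-congˡ K.commutativeSemiring (suc i) (embed-linear (s≤s z≤n) (s≤s i<n)))) ⟨
      KF.fold n (λ i → embed (linear (suc i) Aₙ.^ suc i))
        ≈⟨ E.∏-homo n (λ i → linear (suc i) Aₙ.^ suc i) ⟨
      embed (fold n (λ i → linear (suc i) Aₙ.^ suc i))
        ≈⟨ E.⟦⟧-cong ∏linear ⟩
      embed (1-αⁿ A.* fold (n ∸ 1) (λ i → b (suc i)))
        ≈⟨ E.*-homo 1-αⁿ (fold (n ∸ 1) (λ i → b (suc i))) ⟩
      embed 1-αⁿ K.* embed (fold (n ∸ 1) (λ i → b (suc i)))
        ≈⟨ K.*-cong embed-1-αⁿ (K.trans (E.∏-homo (n ∸ 1) (λ i → b (suc i)))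
             (KF.fold-cong (n ∸ 1) (λ i → embed (b (suc i))) (λ i → β (suc i)) (λ i _ → embed-b (suc i)))) ⟩
      u K.* KF.fold (n ∸ 1) (λ i → β (suc i)) ∎
      where open SetoidReasoning K.setoid

-- Specialisation to 𝔽ₚ, 𝔽ₚ(α) and its polynomials in X

module Instance (n : ℕ) (p-prime : Prime (suc n)) where
  open Setting (suc n) p-prime
  open PrimeFieldProperties n p-prime

  isPrimeField : IsPrimeField 𝔽ₚ (suc n)
  isPrimeField = record { fromℕ-p≈0 = fromℕ-p≈0 ; fromℕ≉0 = fromℕ≉0 ; fermat = fermat }

  module Fac = Factorisation 𝔽ₚ n p-prime isPrimeField

  ι-hom : Homomorphism F.commutativeRing A.commutativeRing A.const
  ι-hom = const-hom F.commutativeRing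

  b̄ : ℕ → A.Carrier
  b̄ s = evaluate F.commutativeRing A.commutativeRing A.const (b 1 s) (A.- A.α)

  ι-injective : ∀ {a} → A.const a A.≈ A.0# → a F.≈ F.0#
  ι-injective a≈0 = Polynomial.coeff-≈ a≈0 0

  1-αⁿ≉0 : ¬ A.1# A.- A.α A.^ n A.≈ A.0#
  1-αⁿ≉0 u≈0 = F.1≉0 (F.trans (F.sym Fac.1-αⁿ-at-0) (Fac.at.⟦⟧-cong F.0# u≈0))

  b*b̄ : ∀ {s} → 0 < s → s < n → b 1 s A.* b̄ s A.≈ A.1# A.- A.α A.^ n
  b*b̄ = Fac.b*bar-b

  embed-eval : ∀ f x {y} → K.embed x K.≈ y →
    K.embed (evaluate F.commutativeRing A.commutativeRing A.const f x) K.≈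
    evaluate F.commutativeRing K.commutativeRing (λ a → K.embed (A.const a)) f y
  embed-eval f x x≈y = evaluate-homo F.commutativeRing A.commutativeRing K.commutativeRing (embed-hom 𝔽ₚ[α])
    (λ _ → K.refl) x≈y f

  -- `b⟨_,_⟩_` substitutes for α even when the value is α itself, so the embedded polynomial has to
  -- be identified with its own evaluation at α.
  embed-b : ∀ s → K.embed (b 1 s) K.≈ b⟨ 1 , s ⟩ K.α
  embed-b s = K.trans {K.embed (b 1 s)}
     {K.embed (evaluate F.commutativeRing A.commutativeRing A.const (b 1 s) A.α)} {b⟨ 1 , s ⟩ K.α}
     (FractionField.crossMultiply (A.*-congʳ {A.1#} (A.sym (Fac.eval-α (b 1 s)))))
     (embed-eval (b 1 s) A.α K.refl)

  embed-b̄ : ∀ s → K.embed (b̄ s) K.≈ b⟨ 1 , s ⟩ (K.- K.α)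
  embed-b̄ s = embed-eval (b 1 s) (A.- A.α) (IsRingHomomorphism.-‿homo (embed-hom 𝔽ₚ[α]) A.α)

  fromℕ-small≉0 : ∀ {k} → 0 < k → k < suc n → ¬ F.fromℕ k F.≈ F.0#
  fromℕ-small≉0 0<k k<p = fromℕ≉0 (Floor.p∤small n p-prime 0<k k<p)

  module S = Scalars.Embedding 𝔽ₚ 𝔽ₚ[α] ι-hom ι-injective n fromℕ-p≈0 fromℕ-small≉0

  embed-linear : ∀ {k} → 0 < k → k < suc n → K.embed (Fac.linear k) K.≈ K.1# K.+ K.α K./ K.fromℕ k
  embed-linear {k} 0<k k<p = S.embed-linear A.α (K.fromℕ k K.⁻¹) 0<k k<p (K.*-inverseʳ (S.scalar-fromℕ≉0 0<k k<p))

  module R = RationalFunctions.Embedding 𝔽ₚ[α] n A.α Fac.linear (b 1) b̄ 1-αⁿ≉0 b*b̄ Fac.b-symmetric Fac.∏linear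
    (λ k → K.1# K.+ K.α K./ K.fromℕ k) (λ s → b⟨ 1 , s ⟩ K.α) (λ s → b⟨ 1 , s ⟩ (K.- K.α))
    embed-linear embed-b embed-b̄

  u C : K.Carrier
  u = K.1# K.- K.α K.^ n
  C = K.∏[ 1 ⋯< suc n ] λ k → (K.1# K.+ K.α K./ K.fromℕ k) K.^ k

  X≉0 : ¬ L.X L.≈ L.0#
  -- The coefficient of index 1 distinguishes X from 0.
  X≉0 X≈0 = K.1≉0 (Polynomial.coeff-≈ (FractionField.embed-injective 𝔽ₚ⟨α⟩[X] {P.X} {P.0#} X≈0) 1)

  constant-hom : Homomorphism K.commutativeRing L.commutativeRing L.constant
  constant-hom = Composition.isRingHomomorphism L.trans (const-hom K.commutativeRing) (embed-hom 𝔽ₚ⟨α⟩[X])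

  module D = Duality.Coefficients 𝔽ₚ⟨α⟩ 𝔽ₚ⟨α⟩[X] n (const-hom K.commutativeRing) P.X
    S.scalar-fromℕ-p≈0 S.scalar-fromℕ≉0 u R.u≉0
    (λ s → b⟨ 1 , s ⟩ K.α) (λ s → b⟨ 1 , s ⟩ (K.- K.α)) R.β*β′≈u R.β-symmetric

  coefficient : K.Carrier → ℕ → K.Carrier
  coefficient γ k = K.1# K./ K.fromℕ k K./ (K.∏[ 1 ⋯< k ] λ s → b⟨ 1 , s ⟩ γ)

  eval-G : ∀ γ y → G⟨ γ ⟩ y L.≈
    L.- Fold.fold L.+-commutativeMonoid n (λ i → L.constant (coefficient γ (suc i)) L.* y L.^ suc i)
  eval-G γ y = eval-sum K.commutativeRing L.commutativeRing constant-hom y n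
    (λ i → coefficient γ (suc i)) suc

  -- Stated for variables y and v because conversion would unfold the decidable equality behind u / X.
  duality : ∀ y v → L.X L.* y L.≈ L.constant u →
    v L.≈ L.- Fold.fold L.+-commutativeMonoid n (λ i → L.constant (coefficient (K.- K.α) (suc i)) L.* y L.^ suc i) →
    L.embed (P.const C P.* G K.α) L.≈ L.- (L.X L.^ suc n L.* v)
  duality y v Xy≈u v≈ = D.duality C R.C≈u*D y Xy≈u v v≈

  x*[y/x]≈y : ∀ x y → ¬ x L.≈ L.0# → x L.* (y L./ x) L.≈ y
  x*[y/x]≈y x y = FieldProperties.x*[y/x]≈y 𝔽ₚ⟨α⟩⟨X⟩ y

  X*[u/X]≈u : L.X L.* (L.constant u L./ L.X) L.≈ L.constant u
  X*[u/X]≈u = x*[y/x]≈y L.X (L.constant u) X≉0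

  theorem : ∀ C′ u′ → C′ ≡ C → u′ ≡ u →
    L.embed (P.const C′ P.* G K.α) L.≈ L.- (L.X L.^ suc n L.* (G⟨ K.- K.α ⟩ (L.constant u′ L./ L.X)))
  theorem _ _ ≡.refl ≡.refl = duality (L.constant u L./ L.X) (G⟨ K.- K.α ⟩ (L.constant u L./ L.X)) X*[u/X]≈u
    (eval-G (K.- K.α) (L.constant u L./ L.X))

-- The identity is stated in the field of fractions K(X), where the argument U/X of the right-hand
-- side lives. The left-hand side is the image of a polynomial under `L.embed`, which is injective
-- by `embed-injective`.
theorem6 : (p : ℕ) (p-prime : Prime p) → 2 ∤ p →
    let open Setting p p-prime in
    L.embed (P.const (K.∏[ 1 ⋯< p ] λ k → (K.1# K.+ K.α K./ K.fromℕ k) K.^ k) P.* G K.α)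
    L.≈ L.- (L.X L.^ p L.* (G⟨ K.- K.α ⟩ (L.constant (K.1# K.- K.α K.^ (p ∸ 1)) L./ L.X)))
theorem6 zero    p-prime _ = ⊥-elim (¬prime[0] p-prime)
theorem6 (suc n) p-prime _ = Instance.theorem n p-prime
    (K.∏[ 1 ⋯< suc n ] λ k → (K.1# K.+ K.α K./ K.fromℕ k) K.^ k) (K.1# K.- K.α K.^ (suc n ∸ 1)) ≡.refl ≡.refl
  where open Setting (suc n) p-prime
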